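{- There are absolute constants such that for every tree $t$ of size $n\ge2$ in which $\sigma$ different node labels occur, each of rank at most $r\ge1$ (with $\sigma+r\ge 2$), one can compute from $t$ in time $O(n)$ a TSLP $\mathcal G$ with $\mathrm{val}(\mathcal G)=t$, $|\mathcal G|\in O\big(\frac{n\cdot\log(\sigma+r)\cdot r}{\log n}\big)$, and every nonterminal of $\mathcal G$ of rank at most $r$.
   Context: Trees: finite rooted ordered trees whose nodes are labelled by ranked symbols (terminals and nonterminals, each with a rank) or by parameters $x_1,x_2,\dots$ (leaves only); a node labelled by a symbol of rank $k$ has exactly $k$ ordered children. The size $|t|$ is the number of nodes not labelled by a parameter. A valid pattern of rank $n$ is a tree in which each of $x_1,\dots,x_n$ occurs exactly once, no other parameter occurs, and $x_1,\dots,x_n$ appear in this order in depth-first left-to-right order. A tree straight-line program (TSLP) $\mathcal G$ has finitely many nonterminals, a start nonterminal $S$ of rank $0$, and for each nonterminal $A$ of rank $n$ exactly one rule $A(x_1,\dots,x_n)\to t$ with $t$ a valid pattern of rank $n$ over terminals, nonterminals and $x_1,\dots,x_n$, such that the relation "$B$ occurs in the right-hand side of $A$" is acyclic. Each nonterminal $A$ derives a unique valid pattern $\mathrm{val}_{\mathcal G}(A)$ over terminals and parameters by repeatedly replacing nonterminals by their right-hand sides (substituting arguments for parameters); $\mathrm{val}(\mathcal G)=\mathrm{val}_{\mathcal G}(S)$. The size $|\mathcal G|$ is the sum of the sizes of all right-hand sides (parameters not counted). Time is measured in the RAM model with unit-cost operations on $O(\log n)$-bit numbers. -}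

module Defs where

open import Data.Fin using (Fin; toℕ)
open import Data.Fin.Induction using (spo-wellFounded)
open import Data.List using (List; []; _∷_; _++_; length; map; concat; sum; allFin; deduplicate)
open import Data.List.Membership.Propositional using (_∈_)
open import Data.List.Membership.Propositional.Properties using (∈-++⁺ˡ; ∈-++⁺ʳ)
open import Data.List.Relation.Unary.Any using (here; there)
open import Data.Nat using (ℕ; zero; suc; _+_; _*_; _∸_; _/_; _^_; _<_; _≟_; _≡ᵇ_)
open import Data.Bool using (if_then_else_)
open import Data.Product using (_×_; _,_; proj₁; proj₂)
open import Data.Sum using (_⊎_; inj₁; inj₂; [_,_]′)
open import Data.Unit using (⊤)
open import Data.Vec using (Vec; []; _∷_; lookup)
open import Induction.WellFounded using (Acc; acc; WellFounded)
open import Relation.Binary.Construct.Closure.Transitive using (TransClosure; [_])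
  renaming (_++_ to _++⁺_)
open import Relation.Binary.PropositionalEquality
  using (_≡_; refl; subst; isEquivalence; resp₂)
open import Relation.Nullary using (¬_)

record RankedAlphabet : Set₁ where
  field
    Symbol : Set
    rank   : Symbol → ℕ

open RankedAlphabet public

_⊎ᴿ_ : RankedAlphabet → RankedAlphabet → RankedAlphabet
Σ ⊎ᴿ Γ = record
  { Symbol = Symbol Σ ⊎ Symbol Γ
  ; rank   = [ rank Σ , rank Γ ]′
  }

-- The parameters x₁, …, xₙ are numbered from 0.
data Tree (Σ : RankedAlphabet) (n : ℕ) : Set where
  param : Fin n → Tree Σ n
  node  : (f : Symbol Σ) → Vec (Tree Σ n) (rank Σ f) → Tree Σ n

module _ {Σ : RankedAlphabet} where

  -- In depth-first left-to-right order, with repetitions.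
  labels  : ∀ {n} → Tree Σ n → List (Symbol Σ)
  labels* : ∀ {n k} → Vec (Tree Σ n) k → List (Symbol Σ)
  labels (param x)   = []
  labels (node f ts) = f ∷ labels* ts
  labels* []         = []
  labels* (t ∷ ts)   = labels t ++ labels* ts

  params  : ∀ {n} → Tree Σ n → List (Fin n)
  params* : ∀ {n k} → Vec (Tree Σ n) k → List (Fin n)
  params (param x)   = x ∷ []
  params (node f ts) = params* ts
  params* []         = []
  params* (t ∷ ts)   = params t ++ params* ts

  size : ∀ {n} → Tree Σ n → ℕ
  size t = length (labels t)

  ValidPattern : ∀ {n} → Tree Σ n → Set
  ValidPattern {n} t = params t ≡ allFin n

  _⟪_⟫  : ∀ {n k} → Tree Σ n → Vec (Tree Σ k) n → Tree Σ k
  _⟪_⟫* : ∀ {n k l} → Vec (Tree Σ n) l → Vec (Tree Σ k) n → Vec (Tree Σ k) l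
  param x   ⟪ us ⟫   = lookup us x
  node f ts ⟪ us ⟫   = node f (ts ⟪ us ⟫*)
  []        ⟪ us ⟫*  = []
  (t ∷ ts)  ⟪ us ⟫*  = (t ⟪ us ⟫) ∷ (ts ⟪ us ⟫*)

nonterminals : ∀ {m} → (Fin m → ℕ) → RankedAlphabet
nonterminals {m} ρ = record { Symbol = Fin m ; rank = ρ }

record TSLP (Σ : RankedAlphabet) : Set where
  field
    #nt        : ℕ
    ntRank     : Fin #nt → ℕ
    start      : Fin #nt
    start-rank : ntRank start ≡ 0
    rhs        : (A : Fin #nt) → Tree (Σ ⊎ᴿ nonterminals ntRank) (ntRank A)
    rhs-valid  : (A : Fin #nt) → ValidPattern (rhs A)

  _OccursIn_ : Fin #nt → Fin #nt → Set
  B OccursIn A = inj₂ B ∈ labels (rhs A)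

  field
    acyclic : (A : Fin #nt) → ¬ TransClosure _OccursIn_ A A

open TSLP using (#nt; ntRank; start; start-rank; rhs) public

module _ {Σ Γ : RankedAlphabet} where

  -- Replace every node labelled by B in Γ by the pattern p B, the arguments of
  -- the node taking the place of the parameters.
  expand  : ∀ {n} (t : Tree (Σ ⊎ᴿ Γ) n) →
            (p : ∀ B → inj₂ B ∈ labels t → Tree Σ (rank Γ B)) → Tree Σ n
  expand* : ∀ {n k} (ts : Vec (Tree (Σ ⊎ᴿ Γ) n) k) →
            (p : ∀ B → inj₂ B ∈ labels* ts → Tree Σ (rank Γ B)) → Vec (Tree Σ n) k
  expand (param x)          p = param x
  expand (node (inj₁ f) ts) p = node f (expand* ts (λ B B∈ → p B (there B∈)))
  expand (node (inj₂ B) ts) p =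
    p B (here refl) ⟪ expand* ts (λ C C∈ → p C (there C∈)) ⟫
  expand* []       p = []
  expand* (t ∷ ts) p =
    expand t (λ B B∈ → p B (∈-++⁺ˡ B∈)) ∷
    expand* ts (λ B B∈ → p B (∈-++⁺ʳ (labels t) B∈))

module _ {Σ : RankedAlphabet} (G : TSLP Σ) where
  open TSLP G using (_OccursIn_; acyclic)

  OccursIn⁺-wellFounded : WellFounded (TransClosure _OccursIn_)
  OccursIn⁺-wellFounded = spo-wellFounded {_≈_ = _≡_} record
    { isEquivalence = isEquivalence
    ; irrefl        = λ { {A} refl A⁺A → acyclic A A⁺A }
    ; trans         = _++⁺_
    ; <-resp-≈      = resp₂ (TransClosure _OccursIn_)
    }

  valAcc : ∀ A → Acc (TransClosure _OccursIn_) A → Tree Σ (ntRank G A)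
  valAcc A (acc below) =
    expand (rhs G A) (λ B B∈ → valAcc B (below [ B∈ ]))

  valOf : ∀ A → Tree Σ (ntRank G A)
  valOf A = valAcc A (OccursIn⁺-wellFounded A)

  val : Tree Σ 0
  val = subst (Tree Σ) (start-rank G) (valOf (start G))

  TSLP-size : ℕ
  TSLP-size = sum (map (λ A → size (rhs G A)) (allFin (#nt G)))

-- Symbols of terminal alphabets are named by natural numbers.
ℕ-alphabet : (ℕ → ℕ) → RankedAlphabet
ℕ-alphabet ρ = record { Symbol = ℕ ; rank = ρ }

numLabels : ∀ {ρ n} → Tree (ℕ-alphabet ρ) n → ℕ
numLabels t = length (deduplicate _≟_ (labels t))

-- Trees are written in preorder, three words (kind, name, rank) per node,
-- where kind is 0 for parameters, 1 for terminals and 2 for nonterminals.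
module _ {Σ : RankedAlphabet} (kind+name : Symbol Σ → ℕ × ℕ) where

  encodeTree  : ∀ {n} → Tree Σ n → List ℕ
  encodeTree* : ∀ {n k} → Vec (Tree Σ n) k → List ℕ
  encodeTree (param x)   = 0 ∷ toℕ x ∷ 0 ∷ []
  encodeTree (node f ts) =
    proj₁ (kind+name f) ∷ proj₂ (kind+name f) ∷ rank Σ f ∷ encodeTree* ts
  encodeTree* []         = []
  encodeTree* (t ∷ ts)   = encodeTree t ++ encodeTree* ts

encodeInput : ∀ {ρ} → Tree (ℕ-alphabet ρ) 0 → List ℕ
encodeInput t = size t ∷ encodeTree (1 ,_) t

encodeTSLP : ∀ {ρ} → TSLP (ℕ-alphabet ρ) → List ℕ
encodeTSLP G =
  #nt G ∷ toℕ (start G) ∷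
  concat (map (λ A → ntRank G A ∷
                     encodeTree [ (1 ,_) , (λ B → 2 , toℕ B) ]′ (rhs G A))
              (allFin (#nt G)))

-- A program mentions finitely many registers; the memory is addressed through
-- registers. Control flow is structured; compiling it to conditional jumps
-- changes running times by a constant factor only.

Reg : Set
Reg = ℕ

data Op : Set where
  add sub mul div : Op

-- Subtraction is truncated at 0, division rounds down, and x / 0 = 0.
⟦_⟧ : Op → ℕ → ℕ → ℕ
⟦ add ⟧ x y       = x + y
⟦ sub ⟧ x y       = x ∸ y
⟦ mul ⟧ x y       = x * y
⟦ div ⟧ x zero    = 0
⟦ div ⟧ x (suc y) = x / suc y

infixr 5 _⨾_

data Program : Set where
  set            : Reg → ℕ → Program  -- d := c
  calc           : Reg → Op → Reg → Reg → Program  -- d := a op b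
  load           : Reg → Reg → Program  -- d := mem[a]
  store          : Reg → Reg → Program  -- mem[a] := b
  _⨾_            : Program → Program → Program
  ifNonzero_then_else_ : Reg → Program → Program → Program
  whileNonzero_loop_   : Reg → Program → Program

record State : Set where
  constructor ⟨_,_⟩
  field
    reg : Reg → ℕ
    mem : ℕ → ℕ

open State public

_[_↦_] : (ℕ → ℕ) → ℕ → ℕ → (ℕ → ℕ)
(h [ a ↦ v ]) x = if x ≡ᵇ a then v else h x

-- w ⊢ s ─[ P ]→ s′ ∥ T: with words of w bits, P started in s halts in s′ after
-- T unit-cost steps. Nothing is derivable for a run in which a register would
-- receive a value of more than w bits; this also restricts the addresses used
-- and the values stored in memory.
data _⊢_─[_]→_∥_ (w : ℕ) : State → Program → State → ℕ → Set where

  set : ∀ {R M d c} → c < 2 ^ w →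
    w ⊢ ⟨ R , M ⟩ ─[ set d c ]→ ⟨ R [ d ↦ c ] , M ⟩ ∥ 1

  calc : ∀ {R M d o a b} → ⟦ o ⟧ (R a) (R b) < 2 ^ w →
    w ⊢ ⟨ R , M ⟩ ─[ calc d o a b ]→ ⟨ R [ d ↦ ⟦ o ⟧ (R a) (R b) ] , M ⟩ ∥ 1

  load : ∀ {R M d a} → M (R a) < 2 ^ w →
    w ⊢ ⟨ R , M ⟩ ─[ load d a ]→ ⟨ R [ d ↦ M (R a) ] , M ⟩ ∥ 1

  store : ∀ {R M a b} →
    w ⊢ ⟨ R , M ⟩ ─[ store a b ]→ ⟨ R , M [ R a ↦ R b ] ⟩ ∥ 1

  seq : ∀ {s s′ s″ P Q T T′} →
    w ⊢ s ─[ P ]→ s′ ∥ T → w ⊢ s′ ─[ Q ]→ s″ ∥ T′ →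
    w ⊢ s ─[ P ⨾ Q ]→ s″ ∥ (T + T′)

  if-nonzero : ∀ {s s′ a P Q T} → ¬ reg s a ≡ 0 →
    w ⊢ s ─[ P ]→ s′ ∥ T →
    w ⊢ s ─[ ifNonzero a then P else Q ]→ s′ ∥ (1 + T)

  if-zero : ∀ {s s′ a P Q T} → reg s a ≡ 0 →
    w ⊢ s ─[ Q ]→ s′ ∥ T →
    w ⊢ s ─[ ifNonzero a then P else Q ]→ s′ ∥ (1 + T)

  while-nonzero : ∀ {s s′ s″ a P T T′} → ¬ reg s a ≡ 0 →
    w ⊢ s ─[ P ]→ s′ ∥ T → w ⊢ s′ ─[ whileNonzero a loop P ]→ s″ ∥ T′ →
    w ⊢ s ─[ whileNonzero a loop P ]→ s″ ∥ (1 + T + T′)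

  while-zero : ∀ {s a P} → reg s a ≡ 0 →
    w ⊢ s ─[ whileNonzero a loop P ]→ s ∥ 1

memoryOf : List ℕ → ℕ → ℕ
memoryOf []       _       = 0
memoryOf (x ∷ xs) zero    = x
memoryOf (x ∷ xs) (suc a) = memoryOf xs a

-- The input occupies the memory from address 0 on; all else is 0.
initial : List ℕ → State
initial xs = ⟨ (λ _ → 0) , memoryOf xs ⟩

StoredAt : (ℕ → ℕ) → ℕ → List ℕ → Set
StoredAt M a []       = ⊤
StoredAt M a (x ∷ xs) = M a ≡ x × StoredAt M (suc a) xs

-- The output starts at the address held by register 0; its length is not
-- marked, the encoding of TSLPs being self-delimiting.
Outputs : State → List ℕ → Set
Outputs s xs = StoredAt (mem s) (reg s 0) xs

{-# OPTIONS --safe #-}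
-- The tree is cut, from the leaves up, into subtrees and one-hole contexts of fewer
-- than μ nodes, with μ ≈ log n / (4 log (σ + 2)). They become nonterminals of rank 0
-- and 1, and the nodes left over form the start rule. A node is left over only if the
-- pieces hanging off it have μ nodes in total or two of its subtrees are large; as it
-- brings along at most r pieces, the start rule has O(r n / μ) nodes. There are at most
-- (σ + 2)^μ different pieces, since their preorders are numbers of at most μ digits in
-- base σ + 2; naming equal pieces by the same nonterminal, all other rules together have
-- size O(n / μ) as well.
--
-- A machine whose memory is initially 0 finds the nonterminal of a piece in constant
-- time at the address given by its number. One scan of the preorder from right to left
-- finds where subtrees end and where the hole of each context is, another one from left
-- to right writes the grammar.
module Submission where

open import Defs
open import Data.Bool using (true; false; if_then_else_; T)
open import Data.Empty using (⊥; ⊥-elim)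
open import Data.Fin using (Fin; zero; suc; toℕ)
import Data.Fin.Properties as Finₚ
open import Data.Fin.Properties using (injective⇒≤; toℕ-injective)
open import Data.List using (List; []; _∷_; _++_; length; map; foldr; foldl; reverse; lookup; [_]; concatMap; concat; tabulate; upTo; deduplicate)
open import Data.List.Membership.Propositional using (_∈_)
open import Data.List.Membership.Propositional.Properties using (∈-lookup; ∈-++⁺ˡ; ∈-++⁺ʳ; ∈-upTo⁺; ∈-deduplicate⁺)
open import Data.List.Properties using (reverse-foldl; tabulate-cong; length-++; ++-assoc; ++-identityʳ; foldl-++; foldl-∷ʳ; map-++; reverse-injective; reverse-involutive; ∷-injective; concatMap-++; map-tabulate; tabulate-lookup; length-map; length-upTo)
open import Data.List.Relation.Unary.All as All using (All; []; _∷_)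
open import Data.List.Relation.Unary.All.Properties using (++⁻ˡ; ++⁻ʳ; ++⁺)
open import Data.List.Relation.Unary.AllPairs using (AllPairs; []; _∷_)
open import Data.List.Relation.Unary.Any using (here; there; index)
open import Data.List.Relation.Unary.Any.Properties using (reverse⁻)
open import Data.Maybe using (Maybe; just; nothing)
open import Data.Maybe.Properties using (just-injective)
open import Data.Nat using (ℕ; zero; suc; _+_; _*_; _∸_; _^_; _≤_; _<_; _≡ᵇ_; _≤ᵇ_; _≟_; _≤?_; z≤n; s≤s; _<?_; >-nonZero; ⌈_/2⌉; ⌊_/2⌋)
open import Data.Nat.Induction using (<-rec)
open import Data.Nat.ListAction using (sum)
open import Data.Nat.Logarithm
open import Data.Nat.Properties
open import Data.Nat.Tactic.RingSolver using (solve-∀)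
open import Data.Product using (_×_; _,_; proj₁; proj₂; Σ-syntax; ∃-syntax)
open import Data.Sum using (_⊎_; inj₁; inj₂; [_,_]′)
open import Data.Unit using (⊤; tt)
open import Data.Vec using (Vec; []; _∷_)
open import Induction.WellFounded using (acc)
open import Relation.Binary.Construct.Closure.Transitive using (TransClosure; _∷_) renaming ([_] to [_]⁺)
open import Relation.Binary.PropositionalEquality using (_≡_; _≢_; refl; sym; trans; cong; cong₂; subst; subst₂; module ≡-Reasoning)
open import Relation.Nullary using (¬_; yes; no; Dec)

-- The machine has neither recursion nor a stack, so both scans are flat loops, while trees, cuts
-- and grammars are inductive. `Reach` is the bridge: its assertion may hold between two rounds of a
-- loop, so that a run can be put together from segments along the recursion on the tree, the
-- numbers of rounds adding up to a multiple of `n`. A context is the second obstacle: it consists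
-- of two intervals of the preorder, and the subtree between them has to be treated on its own. The
-- scan copies both intervals at once, returns to the hole, and leaves at the end of the hole a jump
-- across the second interval. These jumps replace a stack. The number of a piece is complete only
-- when the piece has been copied. The copy is therefore a draft, kept if the number is new and
-- overwritten otherwise. The threshold is chosen with `n` near `(β ^ 4) ^ μ`, so that `β ^ μ`, the
-- bound on the number of pieces, is near the fourth root of `n`. The rules of the pieces then stay
-- below `n / μ`, and only the start rule has to be counted with care, by an amortisation over the
-- nodes of the tree.

infixr 5 _⍮_

-- An intermediate language with variables and arrays, and its translation.

data Code : Set where
  lit               : ℕ → ℕ → Code
  mov               : ℕ → ℕ → Code
  inc dec           : ℕ → Code
  plus minus times  : ℕ → ℕ → ℕ → Code
  fetch put         : ℕ → ℕ → ℕ → Code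
  input             : ℕ → ℕ → Code
  skip              : Code
  _⍮_               : Code → Code → Code
  cond              : ℕ → Code → Code → Code

-- Variable x lives in register 4 + x, cell i of array j at address
-- D + (16 * i + j), D being held by register 3; interleaving the arrays leaves
-- their indices unbounded. Registers 0, 1 and 2 are scratch.
address : ℕ → ℕ → Program
address j y =
  set 0 16 ⨾ calc 0 mul 0 (4 + y) ⨾ set 1 j ⨾ calc 0 add 0 1 ⨾ calc 0 add 3 0

compile : Code → Program
compile (lit x c)     = set (4 + x) c
compile (mov x y)     = set 0 0 ⨾ calc (4 + x) add 0 (4 + y)
compile (inc x)       = set 0 1 ⨾ calc (4 + x) add 0 (4 + x)
compile (dec x)       = set 0 1 ⨾ calc (4 + x) sub (4 + x) 0
compile (plus x y z)  = calc (4 + x) add (4 + y) (4 + z)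
compile (minus x y z) = calc (4 + x) sub (4 + y) (4 + z)
compile (times x y z) = calc (4 + x) mul (4 + y) (4 + z)
compile (fetch x j y) = address j y ⨾ load (4 + x) 0
compile (put j y z)   = address j y ⨾ store 0 (4 + z)
compile (input x y)   = load (4 + x) (4 + y)
compile skip          = set 0 0
compile (c ⍮ d)       = compile c ⨾ compile d
compile (cond x c d)  = ifNonzero (4 + x) then compile c else compile d

-- 6 is the longest translation of a basic instruction: five steps for an address and one memory
-- access. A conditional is charged for both branches, so that the charge does not depend on the
-- run.
cost : Code → ℕ
cost (c ⍮ d)      = cost c + cost d
cost (cond x c d) = suc (cost c + cost d)
cost _            = 6

-- Array numbers stay below the stride 16 of the interleaving, literals below the bound `V`. The
-- Boolean form makes the condition reduce to a product of units on a concrete code, where `_`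
-- proves it.
SmallConstants : Code → Set
SmallConstants (lit x c)     = T (c ≤ᵇ 15)
SmallConstants (fetch x j y) = T (j ≤ᵇ 15)
SmallConstants (put j y z)   = T (j ≤ᵇ 15)
SmallConstants (c ⍮ d)       = SmallConstants c × SmallConstants d
SmallConstants (cond x c d)  = SmallConstants c × SmallConstants d
SmallConstants _             = ⊤

record Store : Set where
  constructor ⟬_,_⟭
  field
    var : ℕ → ℕ
    arr : ℕ → ℕ → ℕ

open Store

_[_∙_↦_] : (ℕ → ℕ → ℕ) → ℕ → ℕ → ℕ → ℕ → ℕ → ℕ
(h [ j ∙ i ↦ z ]) j′ = if j′ ≡ᵇ j then h j [ i ↦ z ] else h j′

-- Updates of functions, and addresses of array cells.

≡ᵇ-same : ∀ m → (m ≡ᵇ m) ≡ true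
≡ᵇ-same zero    = refl
≡ᵇ-same (suc m) = ≡ᵇ-same m

≡ᵇ-diff : ∀ m n → m ≢ n → (m ≡ᵇ n) ≡ false
≡ᵇ-diff zero    zero    m≢n = ⊥-elim (m≢n refl)
≡ᵇ-diff zero    (suc n) m≢n = refl
≡ᵇ-diff (suc m) zero    m≢n = refl
≡ᵇ-diff (suc m) (suc n) m≢n = ≡ᵇ-diff m n (λ e → m≢n (cong suc e))

update-same : ∀ (h : ℕ → ℕ) i v → (h [ i ↦ v ]) i ≡ v
update-same h i v rewrite ≡ᵇ-same i = refl

update-diff : ∀ (h : ℕ → ℕ) i v x → x ≢ i → (h [ i ↦ v ]) x ≡ h x
update-diff h i v x x≢i rewrite ≡ᵇ-diff x i x≢i = refl

update-all : ∀ (P : ℕ → Set) (h : ℕ → ℕ) i v → (∀ x → P (h x)) → P v →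
  ∀ x → P ((h [ i ↦ v ]) x)
update-all P h i v ph pv x with x ≡ᵇ i
... | true  = pv
... | false = ph x

update-cong : ∀ {f g : ℕ → ℕ} i {u v} → (∀ x → f x ≡ g x) → u ≡ v →
  ∀ x → (f [ i ↦ u ]) x ≡ (g [ i ↦ v ]) x
update-cong i fg uv x with x ≡ᵇ i
... | true  = uv
... | false = fg x

cell : ℕ → ℕ → ℕ → ℕ
cell D j i = D + (16 * i + j)

cell-injective : ∀ D i j i′ j′ → j ≤ 15 → j′ ≤ 15 →
  cell D j i ≡ cell D j′ i′ → i ≡ i′ × j ≡ j′
cell-injective D i j i′ j′ j≤ j′≤ eq = go i i′ (+-cancelˡ-≡ D _ _ eq)
  where
  16+≢ : ∀ {j} k → j ≤ 15 → j ≢ 16 + k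
  16+≢ k j≤ refl = <⇒≱ (s≤s j≤) (m≤m+n 16 k)

  reassoc : ∀ k l → 16 * suc k + l ≡ 16 + (16 * k + l)
  reassoc = solve-∀

  go : ∀ i i′ → 16 * i + j ≡ 16 * i′ + j′ → i ≡ i′ × j ≡ j′
  go zero    zero     e = refl , e
  go zero    (suc i′) e = ⊥-elim (16+≢ _ j≤ (trans e (reassoc i′ j′)))
  go (suc i) zero     e = ⊥-elim (16+≢ _ j′≤ (trans (sym e) (reassoc i j)))
  go (suc i) (suc i′) e =
    let p , q = go i i′ (+-cancelˡ-≡ 16 _ _ (trans (sym (reassoc i j)) (trans e (reassoc i′ j′))))
    in cong suc p , q

-- Weakest preconditions and bounded iteration.

-- V bounds products, sums and the data present initially. Increments need no
-- bound of their own: after t steps all values are below V + t.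
module _ (D V : ℕ) (In : ℕ → ℕ) where

  -- Defined by recursion so that it evaluates on a concrete code: what remains of a loop body is a
  -- statement about nested updates at known indices, and most fields of an invariant then hold by
  -- `refl` or by the old field. Only sums, products and reads of the input leave side conditions.
  wp : Code → (Store → Set) → Store → Set
  wp (lit x c)     Φ ⟬ v , a ⟭ = Φ ⟬ v [ x ↦ c ] , a ⟭
  wp (mov x y)     Φ ⟬ v , a ⟭ = Φ ⟬ v [ x ↦ v y ] , a ⟭
  wp (inc x)       Φ ⟬ v , a ⟭ = Φ ⟬ v [ x ↦ suc (v x) ] , a ⟭
  wp (dec x)       Φ ⟬ v , a ⟭ = Φ ⟬ v [ x ↦ v x ∸ 1 ] , a ⟭
  wp (plus x y z)  Φ ⟬ v , a ⟭ = v y + v z < V × Φ ⟬ v [ x ↦ v y + v z ] , a ⟭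
  wp (minus x y z) Φ ⟬ v , a ⟭ = Φ ⟬ v [ x ↦ v y ∸ v z ] , a ⟭
  wp (times x y z) Φ ⟬ v , a ⟭ = v y * v z < V × Φ ⟬ v [ x ↦ v y * v z ] , a ⟭
  wp (fetch x j y) Φ ⟬ v , a ⟭ = Φ ⟬ v [ x ↦ a j (v y) ] , a ⟭
  wp (put j y z)   Φ ⟬ v , a ⟭ = Φ ⟬ v , a [ j ∙ v y ↦ v z ] ⟭
  wp (input x y)   Φ ⟬ v , a ⟭ = v y < D × Φ ⟬ v [ x ↦ In (v y) ] , a ⟭
  wp skip          Φ s         = Φ s
  wp (c ⍮ d)       Φ s         = wp c (wp d Φ) s
  wp (cond x c d)  Φ s         = (var s x ≢ 0 → wp c Φ s) × (var s x ≡ 0 → wp d Φ s)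

  wp-mono : ∀ c {Φ Ψ : Store → Set} → (∀ s → Φ s → Ψ s) → ∀ s → wp c Φ s → wp c Ψ s
  wp-mono (lit x c)     f s p       = f _ p
  wp-mono (mov x y)     f s p       = f _ p
  wp-mono (inc x)       f s p       = f _ p
  wp-mono (dec x)       f s p       = f _ p
  wp-mono (plus x y z)  f s (o , p) = o , f _ p
  wp-mono (minus x y z) f s p       = f _ p
  wp-mono (times x y z) f s (o , p) = o , f _ p
  wp-mono (fetch x j y) f s p       = f _ p
  wp-mono (put j y z)   f s p       = f _ p
  wp-mono (input x y)   f s (o , p) = o , f _ p
  wp-mono skip          f s p       = f _ p
  wp-mono (c ⍮ d)       f s p       = wp-mono c (wp-mono d f) s p
  wp-mono (cond x c d)  f s (p , q) = (λ h → wp-mono c f s (p h)) , (λ h → wp-mono d f s (q h))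

  -- `N` bounds the number of rounds. `Φ` need not make the guard zero, so it can describe a point
  -- in the middle of a run.
  Reach↓ : ℕ → Code → ℕ → (Store → Set) → Store → Set
  Reach↓ g c zero    Φ s = Φ s
  Reach↓ g c (suc N) Φ s = Φ s ⊎ (var s g ≢ 0 × wp c (Reach↓ g c N Φ) s)

  -- A record, so that unification can read off the arguments of Reach↓.
  record Reach (g : ℕ) (c : Code) (N : ℕ) (Φ : Store → Set) (s : Store) : Set where
    constructor wrap
    field
      unwrap : Reach↓ g c N Φ s

open Reach

module _ {D V : ℕ} {In : ℕ → ℕ} {g : ℕ} {c : Code} where

  reached : ∀ N {Φ s} → Φ s → Reach D V In g c N Φ s
  reached zero    p = wrap p
  reached (suc N) p = wrap (inj₁ p)

  iterate : ∀ {N Φ s} → var s g ≢ 0 →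
    wp D V In c (Reach D V In g c N Φ) s → Reach D V In g c (suc N) Φ s
  iterate g≢0 p = wrap (inj₂ (g≢0 , wp-mono D V In c (λ s → unwrap) _ p))

  reach-weaken : ∀ {M N Φ s} → M ≤ N → Reach D V In g c M Φ s → Reach D V In g c N Φ s
  reach-weaken {N = N} z≤n (wrap p)                = reached N p
  reach-weaken (s≤s l)     (wrap (inj₁ p))         = wrap (inj₁ p)
  reach-weaken (s≤s l)     (wrap (inj₂ (g≢0 , p))) =
    iterate g≢0 (wp-mono D V In c (λ s q → reach-weaken l (wrap q)) _ p)

  -- This turns one flat loop into a proof by structural recursion: each subtree contributes a
  -- segment of the run, and the budgets of the segments add up.
  reach-trans : ∀ {M N Φ Ψ s} → Reach D V In g c M Φ s →
    (∀ {s′} → Φ s′ → Reach D V In g c N Ψ s′) → Reach D V In g c (M + N) Ψ s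
  reach-trans {zero}      (wrap p)                f = f p
  reach-trans {suc M} {N} (wrap (inj₁ p))         f = reach-weaken (m≤n+m N (suc M)) (f p)
  reach-trans {suc M}     (wrap (inj₂ (g≢0 , p))) f =
    iterate g≢0 (wp-mono D V In c (λ s q → reach-trans {M} (wrap q) f) _ p)

-- The machine simulates the intermediate language within its word length.

module Simulation (w D V tmax : ℕ) (In : ℕ → ℕ)
  (In<V : ∀ i → i < D → In i < V) (16≤V : 16 ≤ V)
  (fits : D + (16 * (V + tmax) + 16) ≤ 2 ^ w) where

  -- The arrays begin at `D`, above the input, which hence remains readable. The index `t` is the
  -- charge so far: an increment raises a value by one and is charged more than that, so the bounds
  -- `V + t` survive it.
  record Represents (t : ℕ) (S : State) (s : Store) : Set where
    field
      vars : ∀ x → reg S (4 + x) ≡ var s x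
      base : reg S 3 ≡ D
      arrs : ∀ j i → j ≤ 15 → mem S (cell D j i) ≡ arr s j i
      inpt : ∀ i → i < D → mem S i ≡ In i
      var< : ∀ x → var s x < V + t
      arr< : ∀ j i → arr s j i < V + t

  open Represents

  Outcome : ℕ → ℕ → Program → State → (Store → Set) → Set
  Outcome t k P S Φ = ∃[ S′ ] ∃[ T ] ∃[ s′ ]
    (w ⊢ S ─[ P ]→ S′ ∥ T) × T ≤ k × Represents (t + k) S′ s′ × Φ s′

  word-fits : ∀ {t x} → t ≤ tmax → x < V + t → x < 2 ^ w
  word-fits {t} {x} t≤ x< = <-≤-trans x< (begin
    V + t                           ≤⟨ +-monoʳ-≤ V t≤ ⟩
    V + tmax                        ≤⟨ m≤n*m (V + tmax) 16 ⟩
    16 * (V + tmax)                 ≤⟨ m≤m+n _ 16 ⟩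
    16 * (V + tmax) + 16            ≤⟨ m≤n+m _ D ⟩
    D + (16 * (V + tmax) + 16)      ≤⟨ fits ⟩
    2 ^ w                           ∎)
    where open ≤-Reasoning

  cell< : ∀ {t j x} → t ≤ tmax → j ≤ 15 → x < V + t → cell D j x < 2 ^ w
  cell< {t} {j} {x} t≤ j≤ x< = begin-strict
    D + (16 * x + j)             <⟨ +-monoʳ-< D (+-mono-≤-< (*-monoʳ-≤ 16 (<⇒≤ x<)) (s≤s j≤)) ⟩
    D + (16 * (V + t) + 16)      ≤⟨ +-monoʳ-≤ D (+-monoˡ-≤ 16 (*-monoʳ-≤ 16 (+-monoʳ-≤ V t≤))) ⟩
    D + (16 * (V + tmax) + 16)   ≤⟨ fits ⟩
    2 ^ w                        ∎
    where open ≤-Reasoning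

  small< : ∀ {c} → c ≤ 16 → c < 2 ^ w
  small< c≤ = <-≤-trans (s≤s c≤) (begin
    17                           ≤⟨ ≤-trans (s≤s 16≤V) (m≤n+m (suc V) 16) ⟩
    16 + suc V                   ≤⟨ ≤-reflexive (+-comm 16 (suc V)) ⟩
    suc V + 16                   ≤⟨ +-monoˡ-≤ 16 sV≤ ⟩
    16 * (V + tmax) + 16         ≤⟨ m≤n+m _ D ⟩
    D + (16 * (V + tmax) + 16)   ≤⟨ fits ⟩
    2 ^ w                        ∎)
    where
      open ≤-Reasoning
      sV≤ : suc V ≤ 16 * (V + tmax)
      sV≤ = begin
        suc V            ≤⟨ +-monoˡ-≤ V (≤-trans (s≤s z≤n) 16≤V) ⟩
        V + V            ≡⟨ cong (V +_) (sym (+-identityʳ V)) ⟩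
        2 * V            ≤⟨ *-mono-≤ (s≤s (s≤s (z≤n {14}))) (m≤m+n V tmax) ⟩
        16 * (V + tmax)  ∎

  raise : ∀ {t k x} → x < V + t → x < V + (t + k)
  raise {t} {k} x< = <-≤-trans x< (+-monoʳ-≤ V (m≤m+n t k))

  represents-later : ∀ {t k S s} → Represents t S s → Represents (t + k) S s
  represents-later R = record
    { vars = vars R ; base = base R ; arrs = arrs R ; inpt = inpt R
    ; var< = λ x → raise (var< R x) ; arr< = λ j i → raise (arr< R j i) }

  -- Only the registers from 4 on and 3 matter, so scratch writes are invisible.
  assign : ∀ {t k S s R′} x {u v} → (∀ y → R′ (4 + y) ≡ reg S (4 + y)) → R′ 3 ≡ reg S 3 →
    u ≡ v → v < V + (t + k) → Represents t S s →
    Represents (t + k) ⟨ R′ [ 4 + x ↦ u ] , mem S ⟩ ⟬ var s [ x ↦ v ] , arr s ⟭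
  assign {t} {k} {S} x same same₃ u≡v v< R = record
    { vars = update-cong x (λ y → trans (same y) (vars R y)) u≡v
    ; base = trans same₃ (base R) ; arrs = arrs R ; inpt = inpt R
    ; var< = update-all (_< V + (t + k)) _ x _ (λ y → raise (var< R y)) v<
    ; arr< = λ j i → raise (arr< R j i) }

  scratch : ℕ → State → ℕ → (ℕ → ℕ)
  scratch j S y = (((reg S [ 0 ↦ 16 ]) [ 0 ↦ 16 * reg S (4 + y) ]) [ 1 ↦ j ])
    [ 0 ↦ 16 * reg S (4 + y) + j ]

  addressed : ℕ → State → ℕ → (ℕ → ℕ)
  addressed j S y = scratch j S y [ 0 ↦ reg S 3 + (16 * reg S (4 + y) + j) ]

  run-address : ∀ {t S s} j y → j ≤ 15 → t ≤ tmax → Represents t S s →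
    w ⊢ S ─[ address j y ]→ ⟨ addressed j S y , mem S ⟩ ∥ 5
  run-address {S = S} j y j≤ t≤ R =
    seq (set (small< ≤-refl)) (seq (calc (≤-<-trans (m≤m+n _ j) row<))
      (seq (set (small< (≤-trans j≤ (n≤1+n 15)))) (seq (calc row<) (calc all<))))
    where
    all< : reg S 3 + (16 * reg S (4 + y) + j) < 2 ^ w
    all< rewrite base R | vars R y = cell< t≤ j≤ (var< R y)
    row< : 16 * reg S (4 + y) + j < 2 ^ w
    row< = ≤-<-trans (m≤n+m _ (reg S 3)) all<

  addressed≡ : ∀ {t S s} j y → Represents t S s → addressed j S y 0 ≡ cell D j (var s y)
  addressed≡ j y R = cong₂ _+_ (base R) (cong (λ x → 16 * x + j) (vars R y))

  -- Interleaved cells of different arrays or indices have different addresses (`cell-injective`),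
  -- and all of them lie above the input.
  store-cell : ∀ {t k S s R′} j {i i′ u u′} → j ≤ 15 →
    (∀ y → R′ (4 + y) ≡ reg S (4 + y)) → R′ 3 ≡ reg S 3 →
    i′ ≡ cell D j i → u′ ≡ u → u < V + (t + k) → Represents t S s →
    Represents (t + k) ⟨ R′ , mem S [ i′ ↦ u′ ] ⟩ ⟬ var s , arr s [ j ∙ i ↦ u ] ⟭
  store-cell {t} {k} {S} {s} j {i} {u = u} j≤ same same₃ refl refl u< R = record
    { vars = λ y → trans (same y) (vars R y)
    ; base = trans same₃ (base R) ; arrs = arrs′
    ; inpt = λ i′ i′<D → trans (update-diff (mem S) _ _ i′
        (λ e → <⇒≱ i′<D (≤-trans (m≤m+n D _) (≤-reflexive (sym e))))) (inpt R i′ i′<D)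
    ; var< = λ x → raise (var< R x) ; arr< = arr<′ }
    where
    arrs′ : ∀ j′ i′ → j′ ≤ 15 →
      (mem S [ cell D j i ↦ u ]) (cell D j′ i′) ≡ (arr s [ j ∙ i ↦ u ]) j′ i′
    arrs′ j′ i′ j′≤ with j′ ≟ j
    ... | no j′≢j rewrite ≡ᵇ-diff j′ j j′≢j = trans
          (update-diff (mem S) _ _ _ (λ e → j′≢j (proj₂ (cell-injective D i′ j′ i j j′≤ j≤ e))))
          (arrs R j′ i′ j′≤)
    ... | yes refl rewrite ≡ᵇ-same j with i′ ≟ i
    ...   | yes refl = trans (update-same (mem S) _ u) (sym (update-same (arr s j) i u))
    ...   | no i′≢i  = trans
            (update-diff (mem S) _ _ _ (λ e → i′≢i (proj₁ (cell-injective D i′ j i j j≤ j≤ e))))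
            (trans (arrs R j i′ j≤) (sym (update-diff (arr s j) i u i′ i′≢i)))
    arr<′ : ∀ j′ i′ → (arr s [ j ∙ i ↦ u ]) j′ i′ < V + (t + k)
    arr<′ j′ i′ with j′ ≡ᵇ j
    ... | false = raise (arr< R j′ i′)
    ... | true  = update-all (_< V + (t + k)) (arr s j) i u (λ x → raise (arr< R j x)) u< i′

  grow : ∀ {t k x} → 1 ≤ k → x < V + t → suc x < V + (t + k)
  grow {t} {k} {x} 1≤k x< = begin-strict
    suc x        ≡⟨ +-comm 1 x ⟩
    x + 1        <⟨ +-mono-<-≤ x< 1≤k ⟩
    V + t + k    ≡⟨ +-assoc V t k ⟩
    V + (t + k)  ∎
    where open ≤-Reasoning

  fromV : ∀ {x} t → x < V → x < V + t
  fromV t x< = <-≤-trans x< (m≤m+n V t)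

  -- Induction on the code. The bound on values advances by the charge rather than by the time
  -- taken, so both branches of a conditional end with the same bound.
  simulate : ∀ c {t S s} {Φ : Store → Set} → SmallConstants c → t + cost c ≤ tmax →
    Represents t S s → wp D V In c Φ s → Outcome t (cost c) (compile c) S Φ
  simulate (lit x c) {t} ok t≤ R p =
    _ , _ , _ , set (small< (≤-trans c≤ (n≤1+n 15))) , s≤s z≤n ,
    assign x (λ _ → refl) refl refl
      (<-≤-trans (s≤s c≤) (≤-trans 16≤V (m≤m+n V _))) R , p
    where c≤ = ≤ᵇ⇒≤ c 15 ok
  simulate (mov x y) {t} {S} ok t≤ R p =
    _ , _ , _ , seq (set (small< z≤n)) (calc (word-fits {t} (m+n≤o⇒m≤o t t≤) v<)) , s≤s (s≤s z≤n) ,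
    assign x (λ _ → refl) refl (vars R y) (raise (var< R y)) R , p
    where v< = subst (_< V + t) (sym (vars R y)) (var< R y)
  simulate (inc x) {t} ok t≤ R p =
    _ , _ , _ , seq (set (small< (s≤s z≤n)))
      (calc (word-fits {t + 6} t≤ (subst (_< V + (t + 6)) (cong suc (sym (vars R x))) sv<))) , s≤s (s≤s z≤n) ,
    assign x (λ _ → refl) refl (cong suc (vars R x)) sv< R , p
    where sv< = grow {t} {k = 6} (s≤s z≤n) (var< R x)
  simulate (dec x) {t} ok t≤ R p =
    _ , _ , _ , seq (set (small< (s≤s z≤n)))
      (calc (word-fits {t} (m+n≤o⇒m≤o t t≤) (subst (_< V + t) (cong (_∸ 1) (sym (vars R x))) pv<))) , s≤s (s≤s z≤n) ,
    assign x (λ _ → refl) refl (cong (_∸ 1) (vars R x)) (raise pv<) R , p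
    where pv< = ≤-<-trans (m∸n≤m _ 1) (var< R x)
  simulate (plus x y z) {t} ok t≤ R (o , p) =
    _ , _ , _ , calc (word-fits {t} (m+n≤o⇒m≤o t t≤) (fromV t
      (subst (_< V) (sym (cong₂ _+_ (vars R y) (vars R z))) o))) , s≤s z≤n ,
    assign x (λ _ → refl) refl (cong₂ _+_ (vars R y) (vars R z)) (fromV _ o) R , p
  simulate (minus x y z) {t} {S} {s} ok t≤ R p =
    _ , _ , _ , calc (word-fits {t} (m+n≤o⇒m≤o t t≤)
      (subst (_< V + t) (sym (cong₂ _∸_ (vars R y) (vars R z))) d<)) , s≤s z≤n ,
    assign x (λ _ → refl) refl (cong₂ _∸_ (vars R y) (vars R z)) (raise d<) R , p
    where d< = ≤-<-trans (m∸n≤m (var s y) (var s z)) (var< R y)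
  simulate (times x y z) {t} ok t≤ R (o , p) =
    _ , _ , _ , calc (word-fits {t} (m+n≤o⇒m≤o t t≤) (fromV t
      (subst (_< V) (sym (cong₂ _*_ (vars R y) (vars R z))) o))) , s≤s z≤n ,
    assign x (λ _ → refl) refl (cong₂ _*_ (vars R y) (vars R z)) (fromV _ o) R , p
  simulate (fetch x j y) {t} {S} {s} ok t≤ R p =
    _ , _ , _ , seq (run-address j y j≤ t≤′ R)
      (load (word-fits {t} t≤′ (subst (_< V + t) (sym cell≡) (arr< R j (var s y))))) , ≤-refl ,
    assign x (λ _ → refl) refl cell≡ (raise (arr< R j (var s y))) R , p
    where
    j≤ = ≤ᵇ⇒≤ j 15 ok
    t≤′ = m+n≤o⇒m≤o t t≤
    cell≡ : mem S (addressed j S y 0) ≡ arr s j (var s y)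
    cell≡ = trans (cong (mem S) (addressed≡ j y R)) (arrs R j (var s y) j≤)
  simulate (put j y z) {t} {S} {s} ok t≤ R p =
    _ , _ , _ , seq (run-address j y j≤ (m+n≤o⇒m≤o t t≤) R) store , ≤-refl ,
    store-cell {S = S} {R′ = addressed j S y} j j≤ (λ _ → refl) refl
      (addressed≡ j y R) (vars R z) (raise (var< R z)) R , p
    where
    j≤ = ≤ᵇ⇒≤ j 15 ok
  simulate (input x y) {t} {S} {s} ok t≤ R (y<D , p) =
    _ , _ , _ , load (word-fits {t} (m+n≤o⇒m≤o t t≤) (subst (_< V + t) (sym m≡) in<)) , s≤s z≤n ,
    assign x (λ _ → refl) refl m≡ (raise in<) R , p
    where
    m≡ : mem S (reg S (4 + y)) ≡ In (var s y)
    m≡ = trans (cong (mem S) (vars R y)) (inpt R _ y<D)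
    in< = fromV t (In<V _ y<D)
  simulate skip ok t≤ R p =
    _ , _ , _ , set (small< z≤n) , s≤s z≤n ,
    record { vars = vars R ; base = base R ; arrs = arrs R ; inpt = inpt R
           ; var< = λ x → raise (var< R x) ; arr< = λ j i → raise (arr< R j i) } , p
  simulate (c ⍮ d) {t} (okc , okd) t≤ R p
    with simulate c okc (m+n≤o⇒m≤o (t + cost c) (subst (_≤ tmax) (sym (+-assoc t _ _)) t≤)) R p
  ... | _ , T , _ , run , T≤ , R′ , q
    with simulate d okd (subst (_≤ tmax) (sym (+-assoc t _ _)) t≤) R′ q
  ... | S″ , T′ , s″ , run′ , T′≤ , R″ , r =
    _ , _ , _ , seq run run′ , +-mono-≤ T≤ T′≤ ,
    subst (λ k → Represents k S″ s″) (+-assoc t _ _) R″ , r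
  simulate (cond x c d) {t} {S} {s} (okc , okd) t≤ R (p , q) with var s x ≟ 0
  ... | no x≢0
    with simulate c okc (≤-trans (+-monoʳ-≤ t c≤) t≤) R (p x≢0)
    where c≤ = ≤-trans (m≤m+n (cost c) (cost d)) (n≤1+n _)
  ...   | S′ , T , s′ , run , T≤ , R′ , r =
    _ , _ , _ , if-nonzero (λ e → x≢0 (trans (sym (vars R x)) e)) run ,
    s≤s (≤-trans T≤ (m≤m+n (cost c) (cost d))) ,
    subst (λ k → Represents k S′ s′) (trans (+-assoc t (cost c) _) (cong (t +_) (+-suc (cost c) (cost d))))
      (represents-later {k = suc (cost d)} R′) , r
  simulate (cond x c d) {t} {S} {s} (okc , okd) t≤ R (p , q)
      | yes x≡0
    with simulate d okd (≤-trans (+-monoʳ-≤ t d≤) t≤) R (q x≡0)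
    where d≤ = ≤-trans (m≤n+m (cost d) (cost c)) (n≤1+n _)
  ...   | S′ , T , s′ , run , T≤ , R′ , r =
    _ , _ , _ , if-zero (trans (vars R x) x≡0) run ,
    s≤s (≤-trans T≤ (m≤n+m (cost d) (cost c))) ,
    subst (λ k → Represents k S′ s′)
      (trans (+-assoc t (cost d) _) (cong (t +_) (trans (+-suc (cost d) (cost c)) (cong suc (+-comm (cost d) (cost c))))))
      (represents-later {k = suc (cost c)} R′) , r

  simulate-loop : ∀ g c N {t S s} {Φ : Store → Set} → SmallConstants c →
    t + suc (N * suc (cost c)) ≤ tmax → Represents t S s →
    Reach D V In g c N (λ s′ → var s′ g ≡ 0 × Φ s′) s →
    Outcome t (suc (N * suc (cost c))) (whileNonzero (4 + g) loop compile c) S Φ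
  simulate-loop g c N {S = S} ok t≤ R p = go N t≤ R (unwrap p)
    where
    finish : ∀ {t S s k} {Φ : Store → Set} → Represents t S s → var s g ≡ 0 × Φ s →
      Outcome t (suc k) (whileNonzero (4 + g) loop compile c) S Φ
    finish R (g≡0 , p) =
      _ , _ , _ , while-zero (trans (vars R g) g≡0) , s≤s z≤n , represents-later R , p
    go : ∀ N {t S s} {Φ : Store → Set} → t + suc (N * suc (cost c)) ≤ tmax → Represents t S s →
      Reach↓ D V In g c N (λ s′ → var s′ g ≡ 0 × Φ s′) s →
      Outcome t (suc (N * suc (cost c))) (whileNonzero (4 + g) loop compile c) S Φ
    go zero    t≤ R p        = finish R p
    go (suc N) t≤ R (inj₁ p) = finish R p
    go (suc N) {t} t≤ R (inj₂ (g≢0 , p))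
      with simulate c ok (≤-trans (+-monoʳ-≤ t (≤-trans (n≤1+n _) (≤-trans (m≤m+n (suc (cost c)) _) (n≤1+n _)))) t≤) R p
    ... | _ , T , _ , run , T≤ , R′ , q
      with go N (≤-trans (≤-reflexive (+-assoc t _ _)) (≤-trans (+-monoʳ-≤ t budget) t≤)) R′ q
      where
      budget : cost c + suc (N * suc (cost c)) ≤ suc (suc (cost c) + N * suc (cost c))
      budget = ≤-trans (≤-reflexive (+-suc (cost c) _)) (n≤1+n _)
    ... | S″ , T′ , s″ , run′ , T′≤ , R″ , r =
      _ , _ , _ , while-nonzero (λ e → g≢0 (trans (sym (vars R g)) e)) run run′ ,
      ≤-trans (s≤s (+-mono-≤ T≤ T′≤)) (≤-reflexive (cong suc (+-suc (cost c) _))) ,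
      subst (λ k → Represents k S″ s″) total (represents-later {k = 1} R″) , r
      where
      total : t + cost c + suc (N * suc (cost c)) + 1 ≡ t + suc (suc (cost c) + N * suc (cost c))
      total = arith t (cost c) (N * suc (cost c))
        where
        arith : ∀ t k m → t + k + suc m + 1 ≡ t + suc (suc k + m)
        arith = solve-∀

-- Lists stored in memory, and buffers that grow at the end.

stored-cong : ∀ {M M′ : ℕ → ℕ} a xs →
  (∀ x → a ≤ x → x < a + length xs → M′ x ≡ M x) → StoredAt M a xs → StoredAt M′ a xs
stored-cong a []       same _         = tt
stored-cong a (x ∷ xs) same (e , es) =
  trans (same a ≤-refl (m<m+n a (s≤s z≤n))) e ,
  stored-cong (suc a) xs
    (λ y a<y y< → same y (<⇒≤ a<y) (subst (y <_) (sym (+-suc a _)) y<)) es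

stored-++⁻ : ∀ {M : ℕ → ℕ} a xs {ys} → StoredAt M a (xs ++ ys) →
  StoredAt M a xs × StoredAt M (a + length xs) ys
stored-++⁻ {M} a [] {ys} s = tt , subst (λ b → StoredAt M b ys) (sym (+-identityʳ a)) s
stored-++⁻ {M} a (x ∷ xs) {ys} (e , s) =
  let p , q = stored-++⁻ (suc a) xs s
  in (e , p) , subst (λ b → StoredAt M b ys) (sym (+-suc a _)) q

stored-++⁺ : ∀ {M : ℕ → ℕ} a xs {ys} → StoredAt M a xs →
  StoredAt M (a + length xs) ys → StoredAt M a (xs ++ ys)
stored-++⁺ {M} a []       {ys} _       s = subst (λ b → StoredAt M b ys) (+-identityʳ a) s
stored-++⁺ {M} a (x ∷ xs) {ys} (e , p) s =
  e , stored-++⁺ (suc a) xs p (subst (λ b → StoredAt M b ys) (+-suc a _) s)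

Buffer : (ℕ → ℕ) → ℕ → List ℕ → Set
Buffer M p xs = p ≡ length xs × StoredAt M 0 xs

push : ∀ {M : ℕ → ℕ} {p xs u v} → u ≡ v → Buffer M p xs → Buffer (M [ p ↦ u ]) (suc p) (xs ++ [ v ])
push {M} {xs = xs} {v = v} refl (refl , s) =
  sym (trans (length-++ xs) (+-comm _ 1)) ,
  stored-++⁺ 0 xs
    (stored-cong 0 xs (λ x _ x< → update-diff M (length xs) v x (<⇒≢ x<)) s)
    (update-same M (length xs) v , tt)

push₃ : ∀ {M : ℕ → ℕ} {p xs u₁ u₂ u₃ v₁ v₂ v₃} → u₁ ≡ v₁ → u₂ ≡ v₂ → u₃ ≡ v₃ → Buffer M p xs →
  Buffer (((M [ p ↦ u₁ ]) [ suc p ↦ u₂ ]) [ suc (suc p) ↦ u₃ ]) (suc (suc (suc p)))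
    (xs ++ v₁ ∷ v₂ ∷ v₃ ∷ [])
push₃ {xs = xs} {v₁ = v₁} {v₂} {v₃} e₁ e₂ e₃ b = subst (Buffer _ _)
  (trans (++-assoc (xs ++ [ v₁ ]) [ v₂ ] [ v₃ ]) (++-assoc xs [ v₁ ] (v₂ ∷ v₃ ∷ [])))
  (push e₃ (push e₂ (push e₁ b)))

-- Dictionaries of keyed entries in order of first occurrence.

-- find d κ is the position of the key κ in d counted from 1, and 0 if κ does
-- not occur.
module Dictionary {A : Set} (key : A → ℕ) where

  next : ℕ → ℕ
  next zero    = zero
  next (suc i) = suc (suc i)

  find : List A → ℕ → ℕ
  find []       κ = 0
  find (x ∷ xs) κ = if κ ≡ᵇ key x then 1 else next (find xs κ)

  insert : List A → A → List A
  insert []       x = x ∷ []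
  insert (y ∷ ys) x = if key x ≡ᵇ key y then y ∷ ys else y ∷ insert ys x

  collect : List A → List A → List A
  collect = foldl insert

  -- The prefix order. New entries go to the end, so positions never change once given (`find-⊑`),
  -- and a reference written early is still right in the final dictionary.
  _⊑_ : List A → List A → Set
  d ⊑ e = ∃[ z ] e ≡ d ++ z

  Distinct : List A → Set
  Distinct = AllPairs (λ x y → key x ≢ key y)

  next≡0 : ∀ i → next i ≡ 0 → i ≡ 0
  next≡0 zero e = refl

  insert-new : ∀ d x → find d (key x) ≡ 0 → insert d x ≡ d ++ [ x ]
  insert-new []      x e = refl
  insert-new (y ∷ d) x e with key x ≡ᵇ key y
  insert-new (y ∷ d) x () | true
  ... | false = cong (y ∷_) (insert-new d x (next≡0 _ e))

  insert-old : ∀ d x → find d (key x) ≢ 0 → insert d x ≡ d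
  insert-old []      x e = ⊥-elim (e refl)
  insert-old (y ∷ d) x e with key x ≡ᵇ key y
  ... | true  = refl
  ... | false = cong (y ∷_) (insert-old d x (λ e′ → e (cong next e′)))

  insert-⊑ : ∀ d x → d ⊑ insert d x
  insert-⊑ d x with find d (key x) ≟ 0
  ... | yes e = [ x ] , insert-new d x e
  ... | no ne = [] , trans (insert-old d x ne) (sym (++-identityʳ d))

  ⊑-trans : ∀ {d e f} → d ⊑ e → e ⊑ f → d ⊑ f
  ⊑-trans {d} (y , refl) (z , refl) = y ++ z , ++-assoc d y z

  ⊑-refl : ∀ {d} → d ⊑ d
  ⊑-refl {d} = [] , sym (++-identityʳ d)

  collect-⊑ : ∀ d xs → d ⊑ collect d xs
  collect-⊑ d []       = ⊑-refl
  collect-⊑ d (x ∷ xs) = ⊑-trans (insert-⊑ d x) (collect-⊑ (insert d x) xs)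

  collect-++ : ∀ d xs ys → collect d (xs ++ ys) ≡ collect (collect d xs) ys
  collect-++ = foldl-++ insert

  find-++ : ∀ d z κ → find d κ ≢ 0 → find (d ++ z) κ ≡ find d κ
  find-++ []      z κ e = ⊥-elim (e refl)
  find-++ (x ∷ d) z κ e with κ ≡ᵇ key x
  ... | true  = refl
  ... | false = cong next (find-++ d z κ (λ e′ → e (cong next e′)))

  find-⊑ : ∀ {d e} κ → d ⊑ e → find d κ ≢ 0 → find e κ ≡ find d κ
  find-⊑ {d} κ (z , refl) = find-++ d z κ

  -- A new entry changes the table of positions at a single key. Hence one write into an array that
  -- is zero at first keeps it equal to `find`.
  find-snoc : ∀ d x κ → find d (key x) ≡ 0 →
    find (d ++ [ x ]) κ ≡ (find d [ key x ↦ suc (length d) ]) κ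
  find-snoc []      x κ e = refl
  find-snoc (y ∷ d) x κ e with key x ≟ key y
  find-snoc (y ∷ d) x κ e | yes q rewrite q | ≡ᵇ-same (key y) = ⊥-elim (1+n≢0 e)
  find-snoc (y ∷ d) x κ e | no q rewrite ≡ᵇ-diff (key x) (key y) q
    with κ ≟ key y | find-snoc d x κ (next≡0 _ e)
  ... | yes refl | _ rewrite ≡ᵇ-same (key y) | ≡ᵇ-diff (key y) (key x) (λ e′ → q (sym e′)) = refl
  ... | no q′    | ih rewrite ≡ᵇ-diff κ (key y) q′ | ih with κ ≡ᵇ key x
  ...   | true  = refl
  ...   | false = refl

  find-insert : ∀ d x → find (insert d x) (key x) ≢ 0
  find-insert d x with find d (key x) ≟ 0
  ... | yes e rewrite insert-new d x e | find-snoc d x (key x) e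
              | ≡ᵇ-same (key x) = 1+n≢0
  ... | no ne rewrite insert-old d x ne = ne

  find-collect : ∀ d xs → All (λ x → find (collect d xs) (key x) ≢ 0) xs
  find-collect d []       = []
  find-collect d (x ∷ xs) =
    subst (_≢ 0) (sym (find-⊑ (key x) (collect-⊑ (insert d x) xs) (find-insert d x)))
      (find-insert d x)
    ∷ find-collect (insert d x) xs

  find-lookup : ∀ d κ i → find d κ ≡ suc i → Σ[ j ∈ Fin (length d) ] toℕ j ≡ i × key (lookup d j) ≡ κ
  find-lookup (x ∷ d) κ i e with κ ≟ key x
  find-lookup (x ∷ d) κ i e | yes q rewrite q | ≡ᵇ-same (key x) = zero , suc-injective e , refl
  find-lookup (x ∷ d) κ i e | no q rewrite ≡ᵇ-diff κ (key x) q with find d κ in eq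
  find-lookup (x ∷ d) κ i () | no q | zero
  ... | suc i′ = let j , p , r = find-lookup d κ i′ eq
                 in suc j , trans (cong suc p) (suc-injective e) , r

  find-≤ : ∀ d κ → find d κ ≤ length d
  find-≤ []      κ = z≤n
  find-≤ (x ∷ d) κ with κ ≡ᵇ key x
  ... | true  = s≤s z≤n
  ... | false with find d κ | find-≤ d κ
  ...   | zero  | _ = z≤n
  ...   | suc i | p = s≤s p

  all-insert : ∀ {P : A → Set} d x → All P d → P x → All P (insert d x)
  all-insert []      x []       q = q ∷ []
  all-insert (y ∷ d) x (p ∷ ps) q with key x ≡ᵇ key y
  ... | true  = p ∷ ps
  ... | false = p ∷ all-insert d x ps q

  all-collect : ∀ {P : A → Set} d xs → All P d → All P xs → All P (collect d xs)
  all-collect d []       ps []       = ps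
  all-collect d (x ∷ xs) ps (q ∷ qs) = all-collect (insert d x) xs (all-insert d x ps q) qs

  insert-length : ∀ d x → length (insert d x) ≤ suc (length d)
  insert-length []      x = ≤-refl
  insert-length (y ∷ d) x with key x ≡ᵇ key y
  ... | true  = n≤1+n _
  ... | false = s≤s (insert-length d x)

  collect-length : ∀ d xs → length (collect d xs) ≤ length d + length xs
  collect-length d []       = m≤m+n (length d) 0
  collect-length d (x ∷ xs) = ≤-trans (collect-length (insert d x) xs)
    (≤-trans (+-monoˡ-≤ _ (insert-length d x)) (≤-reflexive (sym (+-suc (length d) _))))

  distinct-insert : ∀ d x → Distinct d → Distinct (insert d x)
  distinct-insert []      x []       = [] ∷ []
  distinct-insert (y ∷ d) x (p ∷ ps) with key x ≟ key y
  ... | yes q rewrite q | ≡ᵇ-same (key y) = p ∷ ps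
  ... | no q rewrite ≡ᵇ-diff (key x) (key y) q =
    all-insert d x p (λ e → q (sym e)) ∷ distinct-insert d x ps

  distinct-collect : ∀ d xs → Distinct d → Distinct (collect d xs)
  distinct-collect d []       p = p
  distinct-collect d (x ∷ xs) p = distinct-collect (insert d x) xs (distinct-insert d x p)

  lookup-injective : ∀ {d} → Distinct d → ∀ i j → key (lookup d i) ≡ key (lookup d j) → i ≡ j
  lookup-injective (p ∷ ps) zero    zero    e = refl
  lookup-injective (p ∷ ps) zero    (suc j) e = ⊥-elim (All.lookup p (∈-lookup j) e)
  lookup-injective (p ∷ ps) (suc i) zero    e = ⊥-elim (All.lookup p (∈-lookup i) (sym e))
  lookup-injective (p ∷ ps) (suc i) (suc j) e = cong suc (lookup-injective ps i j e)

  -- Pigeonhole: sending an entry to the place of its key in `ys` is injective. It bounds both the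
  -- number of symbols and the number of clusters.
  distinct-length : ∀ {d} ys → Distinct d → All (λ x → key x ∈ ys) d → length d ≤ length ys
  distinct-length {d} ys p q = injective⇒≤ {f = λ i → index (mem∈ i)} λ {i} {j} e →
    lookup-injective p i j (index-injective (mem∈ i) (mem∈ j) e)
    where
    mem∈ : ∀ i → key (lookup d i) ∈ ys
    mem∈ i = All.lookup q (∈-lookup i)
    index-injective : ∀ {x y : ℕ} {zs} (x∈ : x ∈ zs) (y∈ : y ∈ zs) → index x∈ ≡ index y∈ → x ≡ y
    index-injective (here refl) (here refl) e = refl
    index-injective (there p)   (there q)   e = index-injective p q (Finₚ.suc-injective e)

-- Words as numbers in base β.

module Radix (β : ℕ) where

  radix : List ℕ → ℕ
  radix = foldl (λ c d → c * β + d) 0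

  radix-snoc : ∀ ds d → radix (ds ++ [ d ]) ≡ radix ds * β + d
  radix-snoc ds d = foldl-∷ʳ (λ c d → c * β + d) 0 d ds

  -- `radix` follows the program, which appends digits at the end. Read from the least significant
  -- digit, the number yields to division with remainder at the head of the list.
  least : List ℕ → ℕ
  least = foldr (λ d c → c * β + d) 0

  radix-reverse : ∀ ds → radix ds ≡ least (reverse ds)
  radix-reverse ds = trans (cong radix (sym (reverse-involutive ds)))
    (go (reverse ds))
    where
    go : ∀ es → radix (reverse es) ≡ least es
    go es = reverse-foldl (λ c d → c * β + d) 0 es

  quotient-unique : ∀ q q′ {x x′} → x < β → x′ < β → q * β + x ≡ q′ * β + x′ → q ≡ q′ × x ≡ x′
  quotient-unique zero    zero     x< x′< e = refl , e
  quotient-unique zero    (suc q′) x< x′< e = ⊥-elim (<⇒≱ x<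
    (subst (β ≤_) (sym e) (≤-trans (m≤m+n β (q′ * β)) (m≤m+n _ _))))
  quotient-unique (suc q) zero     x< x′< e = ⊥-elim (<⇒≱ x′<
    (subst (β ≤_) e (≤-trans (m≤m+n β (q * β)) (m≤m+n _ _))))
  quotient-unique (suc q) (suc q′) {x} {x′} x< x′< e =
    let p , r = quotient-unique q q′ x< x′<
                  (+-cancelˡ-≡ β _ _ (trans (sym (+-assoc β (q * β) x)) (trans e (+-assoc β (q′ * β) x′))))
    in cong suc p , r

  Digit : ℕ → Set
  Digit d = 1 ≤ d × d < β

  -- Digits are nonzero, so that leading digits count.
  least-injective : ∀ {ds es} → All Digit ds → All Digit es → least ds ≡ least es → ds ≡ es
  least-injective []       []       e = refl
  least-injective []       ((1≤ , _) ∷ qs) e =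
    ⊥-elim (<⇒≢ (≤-trans 1≤ (m≤n+m _ _)) e)
  least-injective ((1≤ , _) ∷ ps) [] e =
    ⊥-elim (<⇒≢ (≤-trans 1≤ (m≤n+m _ _)) (sym e))
  least-injective {d ∷ ds} {d′ ∷ es} ((_ , p) ∷ ps) ((_ , q) ∷ qs) e =
    let r , s = quotient-unique (least ds) (least es) p q e
    in cong₂ _∷_ s (least-injective ps qs r)

  radix-injective : ∀ {ds es} → All Digit ds → All Digit es → radix ds ≡ radix es → ds ≡ es
  radix-injective {ds} {es} p q e = reverse-injective
    (least-injective (digits p) (digits q)
      (trans (sym (radix-reverse ds)) (trans e (radix-reverse es))))
    where
    digits : ∀ {fs} → All Digit fs → All Digit (reverse fs)
    digits r = All.tabulate (λ x∈ → All.lookup r (reverse⁻ x∈))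

  radix-bound : ∀ {ds} → All (_< β) ds → radix ds < β ^ length ds
  radix-bound {ds} p = go ds 0 0 p (s≤s z≤n)
    where
    -- The accumulator stands for the `k` digits already read.
    go : ∀ ds c k → All (_< β) ds → c < β ^ k →
      foldl (λ c d → c * β + d) c ds < β ^ (k + length ds)
    go [] c k [] c< = subst (λ k → c < β ^ k) (sym (+-identityʳ k)) c<
    go (d ∷ ds) c k (d< ∷ ps) c< =
      subst (λ k → foldl (λ c d → c * β + d) (c * β + d) ds < β ^ k) (sym (+-suc k _))
        (go ds (c * β + d) (suc k) ps (begin-strict
          c * β + d      <⟨ +-monoʳ-< (c * β) d< ⟩
          c * β + β      ≡⟨ +-comm (c * β) β ⟩
          suc c * β      ≤⟨ *-monoˡ-≤ β c< ⟩
          β ^ k * β      ≡⟨ *-comm (β ^ k) β ⟩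
          β ^ suc k      ∎))
      where open ≤-Reasoning

-- Preorder words, one-hole contexts and their patterns.

module _ {Σ : RankedAlphabet} where

  weaken  : ∀ {n} → Tree Σ 0 → Tree Σ n
  weaken* : ∀ {n k} → Vec (Tree Σ 0) k → Vec (Tree Σ n) k
  weaken (node f ts) = node f (weaken* ts)
  weaken* []         = []
  weaken* (t ∷ ts)   = weaken t ∷ weaken* ts

  weaken-⟪⟫  : ∀ {n k} (t : Tree Σ 0) (us : Vec (Tree Σ k) n) → weaken t ⟪ us ⟫ ≡ weaken t
  weaken-⟪⟫* : ∀ {n k l} (ts : Vec (Tree Σ 0) l) (us : Vec (Tree Σ k) n) →
    weaken* ts ⟪ us ⟫* ≡ weaken* ts
  weaken-⟪⟫ (node f ts) us = cong (node f) (weaken-⟪⟫* ts us)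
  weaken-⟪⟫* []         us = refl
  weaken-⟪⟫* (t ∷ ts)   us = cong₂ _∷_ (weaken-⟪⟫ t us) (weaken-⟪⟫* ts us)

  weaken-0  : (t : Tree Σ 0) → weaken t ≡ t
  weaken-0* : ∀ {l} (ts : Vec (Tree Σ 0) l) → weaken* ts ≡ ts
  weaken-0 (node f ts) = cong (node f) (weaken-0* ts)
  weaken-0* []         = refl
  weaken-0* (t ∷ ts)   = cong₂ _∷_ (weaken-0 t) (weaken-0* ts)

  params-weaken  : ∀ {n} (t : Tree Σ 0) → params (weaken {n} t) ≡ []
  params-weaken* : ∀ {n l} (ts : Vec (Tree Σ 0) l) → params* (weaken* {n} ts) ≡ []
  params-weaken (node f ts) = params-weaken* ts
  params-weaken* []         = refl
  params-weaken* (t ∷ ts)   = cong₂ _++_ (params-weaken t) (params-weaken* ts)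

  word  : ∀ {n} → Tree Σ n → List (Maybe (Symbol Σ))
  word* : ∀ {n k} → Vec (Tree Σ n) k → List (Maybe (Symbol Σ))
  word (param x)   = nothing ∷ []
  word (node f ts) = just f ∷ word* ts
  word* []         = []
  word* (t ∷ ts)   = word t ++ word* ts

  word-weaken  : ∀ {n} (t : Tree Σ 0) → word (weaken {n} t) ≡ map just (labels t)
  word-weaken* : ∀ {n l} (ts : Vec (Tree Σ 0) l) → word* (weaken* {n} ts) ≡ map just (labels* ts)
  word-weaken (node f ts) = cong (just f ∷_) (word-weaken* ts)
  word-weaken* []         = refl
  word-weaken* (t ∷ ts)   = trans (cong₂ _++_ (word-weaken t) (word-weaken* ts))
    (sym (map-++ just (labels t) (labels* ts)))

  module _ {n} (unique : (x y : Fin n) → x ≡ y) where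

    -- Preorder with known ranks is uniquely readable. The tails `xs` and `ys` are needed because
    -- the end of a subtree is not marked in the word. A parameter leaves only `nothing`, whence the
    -- assumption `unique`.
    parse  : (t u : Tree Σ n) {xs ys : List (Maybe (Symbol Σ))} →
      word t ++ xs ≡ word u ++ ys → t ≡ u × xs ≡ ys
    parse* : ∀ {k} (ts us : Vec (Tree Σ n) k) {xs ys : List (Maybe (Symbol Σ))} →
      word* ts ++ xs ≡ word* us ++ ys → ts ≡ us × xs ≡ ys
    parse (param x) (param y) e = cong param (unique x y) , proj₂ (∷-injective e)
    parse (param x) (node g us) ()
    parse (node f ts) (param y) ()
    parse (node f ts) (node g us) e with just-injective (proj₁ (∷-injective e))
    ... | refl = let p , q = parse* ts us (proj₂ (∷-injective e)) in cong (node f) p , q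
    parse* [] [] e = refl , e
    parse* (t ∷ ts) (u ∷ us) {xs} {ys} e =
      let p , q = parse t u (trans (sym (++-assoc (word t) (word* ts) xs))
                              (trans e (++-assoc (word u) (word* us) ys)))
          r , s = parse* ts us q
      in cong₂ _∷_ p r , s

    word-injective : (t u : Tree Σ n) → word t ≡ word u → t ≡ u
    word-injective t u e = proj₁ (parse t u (cong (_++ []) e))

  encodeTree-weaken  : ∀ (kn : Symbol Σ → ℕ × ℕ) {n} (t : Tree Σ 0) →
    encodeTree kn (weaken {n} t) ≡
    concatMap (λ f → proj₁ (kn f) ∷ proj₂ (kn f) ∷ rank Σ f ∷ []) (labels t)
  encodeTree-weaken* : ∀ (kn : Symbol Σ → ℕ × ℕ) {n l} (ts : Vec (Tree Σ 0) l) →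
    encodeTree* kn (weaken* {n} ts) ≡
    concatMap (λ f → proj₁ (kn f) ∷ proj₂ (kn f) ∷ rank Σ f ∷ []) (labels* ts)
  encodeTree-weaken kn (node f ts) =
    cong (λ z → proj₁ (kn f) ∷ proj₂ (kn f) ∷ rank Σ f ∷ z) (encodeTree-weaken* kn ts)
  encodeTree-weaken* kn []       = refl
  encodeTree-weaken* kn (t ∷ ts) =
    trans (cong₂ _++_ (encodeTree-weaken kn t) (encodeTree-weaken* kn ts))
      (sym (concatMap-++ _ (labels t) (labels* ts)))

  size>0 : (t : Tree Σ 0) → 0 < size t
  size>0 (node f ts) = s≤s z≤n

  -- A separate type rather than patterns of rank 1: recursion on it leads to the hole, and the
  -- pattern `pattern₁` is valid by construction.
  data Ctx  : Set
  data Ctx* : ℕ → Set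

  data Ctx where
    □    : Ctx
    node : (f : Symbol Σ) → Ctx* (rank Σ f) → Ctx

  data Ctx* where
    here  : ∀ {k} → Ctx → Vec (Tree Σ 0) k → Ctx* (suc k)
    there : ∀ {k} → Tree Σ 0 → Ctx* k → Ctx* (suc k)

  plug  : Ctx → Tree Σ 0 → Tree Σ 0
  plug* : ∀ {k} → Ctx* k → Tree Σ 0 → Vec (Tree Σ 0) k
  plug □           u = u
  plug (node f cs) u = node f (plug* cs u)
  plug* (here c ts)  u = plug c u ∷ ts
  plug* (there t cs) u = t ∷ plug* cs u

  pattern₁  : Ctx → Tree Σ 1
  pattern₁* : ∀ {k} → Ctx* k → Vec (Tree Σ 1) k
  pattern₁ □           = param zero
  pattern₁ (node f cs) = node f (pattern₁* cs)
  pattern₁* (here c ts)  = pattern₁ c ∷ weaken* ts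
  pattern₁* (there t cs) = weaken t ∷ pattern₁* cs

  before  : Ctx → List (Symbol Σ)
  before* : ∀ {k} → Ctx* k → List (Symbol Σ)
  before □           = []
  before (node f cs) = f ∷ before* cs
  before* (here c ts)  = before c
  before* (there t cs) = labels t ++ before* cs

  after  : Ctx → List (Symbol Σ)
  after* : ∀ {k} → Ctx* k → List (Symbol Σ)
  after □           = []
  after (node f cs) = after* cs
  after* (here c ts)  = after c ++ labels* ts
  after* (there t cs) = after* cs

  size* : ∀ {n k} → Vec (Tree Σ n) k → ℕ
  size* ts = length (labels* ts)

  ctxSize : Ctx → ℕ
  ctxSize c = length (before c) + length (after c)

  ctxSize* : ∀ {k} → Ctx* k → ℕ
  ctxSize* cs = length (before* cs) + length (after* cs)

  -- A context occupies two intervals of the preorder, with the tree in its hole between them. The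
  -- program sees contexts only in this form.
  labels-plug  : ∀ c u → labels (plug c u) ≡ before c ++ labels u ++ after c
  labels-plug* : ∀ {k} (cs : Ctx* k) u → labels* (plug* cs u) ≡ before* cs ++ labels u ++ after* cs
  labels-plug □           u = sym (++-identityʳ (labels u))
  labels-plug (node f cs) u = cong (f ∷_) (labels-plug* cs u)
  labels-plug* (here c ts) u rewrite labels-plug c u =
    trans (++-assoc (before c) _ _) (cong (before c ++_) (++-assoc (labels u) _ _))
  labels-plug* (there t cs) u rewrite labels-plug* cs u =
    sym (++-assoc (labels t) (before* cs) _)

  plug-⟪⟫  : ∀ c u → pattern₁ c ⟪ u ∷ [] ⟫ ≡ plug c u
  plug-⟪⟫* : ∀ {k} (cs : Ctx* k) u → pattern₁* cs ⟪ u ∷ [] ⟫* ≡ plug* cs u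
  plug-⟪⟫ □           u = refl
  plug-⟪⟫ (node f cs) u = cong (node f) (plug-⟪⟫* cs u)
  plug-⟪⟫* (here c ts)  u =
    cong₂ _∷_ (plug-⟪⟫ c u) (trans (weaken-⟪⟫* ts (u ∷ [])) (weaken-0* ts))
  plug-⟪⟫* (there t cs) u =
    cong₂ _∷_ (trans (weaken-⟪⟫ t (u ∷ [])) (weaken-0 t)) (plug-⟪⟫* cs u)

  params-pattern  : ∀ c → params (pattern₁ c) ≡ zero ∷ []
  params-pattern* : ∀ {k} (cs : Ctx* k) → params* (pattern₁* cs) ≡ zero ∷ []
  params-pattern □           = refl
  params-pattern (node f cs) = params-pattern* cs
  params-pattern* (here c ts)  = cong₂ _++_ (params-pattern c) (params-weaken* ts)
  params-pattern* (there t cs) = cong₂ _++_ (params-weaken t) (params-pattern* cs)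

  word-pattern  : ∀ c → word (pattern₁ c) ≡ map just (before c) ++ nothing ∷ map just (after c)
  word-pattern* : ∀ {k} (cs : Ctx* k) →
    word* (pattern₁* cs) ≡ map just (before* cs) ++ nothing ∷ map just (after* cs)
  word-pattern □           = refl
  word-pattern (node f cs) = cong (just f ∷_) (word-pattern* cs)
  word-pattern* (here c ts) rewrite word-pattern c | word-weaken* {1} ts | map-++ just (after c) (labels* ts) =
    ++-assoc (map just (before c)) _ _
  word-pattern* (there t cs) rewrite word-pattern* cs | word-weaken {1} t | map-++ just (labels t) (before* cs) =
    sym (++-assoc (map just (labels t)) (map just (before* cs)) _)

  size-plug : ∀ c u → size (plug c u) ≡ ctxSize c + size u
  size-plug c u rewrite labels-plug c u | length-++ (before c) {labels u ++ after c} | length-++ (labels u) {after c} =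
    arith (length (before c)) (size u) (length (after c))
    where
    arith : ∀ x y z → x + (y + z) ≡ x + z + y
    arith = solve-∀

  ctxSize*-here : ∀ {k} c (ts : Vec (Tree Σ 0) k) → ctxSize* (here c ts) ≡ ctxSize c + size* ts
  ctxSize*-here c ts rewrite length-++ (after c) {labels* ts} = sym (+-assoc (length (before c)) _ _)

  ctxSize*-there : ∀ {k} t (cs : Ctx* k) → ctxSize* (there t cs) ≡ size t + ctxSize* cs
  ctxSize*-there t cs rewrite length-++ (labels t) {before* cs} = +-assoc (size t) _ _

  -- Cutting a tree, and the size of what is left over.

  -- Trees of fewer than μ nodes become one nonterminal of rank 0. A larger tree
  -- is a context of fewer than μ nodes, to become a nonterminal of rank 1 unless
  -- it is the hole, around a tree whose root remains a terminal of the start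
  -- rule. A root remains only if the parts below it that are cut off there
  -- have at least μ − 1 nodes in total (loose) or two subtrees are large (branches).
  module Cutting (μ : ℕ) (0<μ : 0 < μ) where

    data Cut  : Tree Σ 0 → Set
    data Cut* : ∀ {k} → Vec (Tree Σ 0) k → Set
    data Core : Tree Σ 0 → Set

    loose     : ∀ {t} → Cut t → ℕ
    loose*    : ∀ {k} {ts : Vec (Tree Σ 0) k} → Cut* ts → ℕ
    branches  : ∀ {t} → Cut t → ℕ
    branches* : ∀ {k} {ts : Vec (Tree Σ 0) k} → Cut* ts → ℕ

    data Cut where
      small : ∀ {t} → size t < μ → Cut t
      big   : ∀ c {u} → ctxSize c < μ → Core u → μ ≤ size (plug c u) → Cut (plug c u)

    data Cut* where
      []  : Cut* []
      _∷_ : ∀ {k t} {ts : Vec (Tree Σ 0) k} → Cut t → Cut* ts → Cut* (t ∷ ts)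

    data Core where
      core : ∀ f {ts} (rs : Cut* ts) → μ ≤ suc (loose* rs) ⊎ 2 ≤ branches* rs →
        μ ≤ size (node f ts) → Core (node f ts)

    loose {t} (small _) = size t
    loose (big c _ _ _) = ctxSize c
    loose* []       = 0
    loose* (r ∷ rs) = loose r + loose* rs

    branches (small _)     = 0
    branches (big c _ _ _) = 1
    branches* []       = 0
    branches* (r ∷ rs) = branches r + branches* rs

    -- Exactly one child is large. Indexing by the context `cs` around its core shows the parent as
    -- `node f cs` plugged with the same core, that is, the child's context extended by one node.
    data Single {u} (κ : Core u) : ∀ {k} (cs : Ctx* k) → Cut* (plug* cs u) → Set where
      here  : ∀ {k} {ts : Vec (Tree Σ 0) k} {rs : Cut* ts} {c c< c≥} → branches* rs ≡ 0 →
        Single κ (here c ts) (big c c< κ c≥ ∷ rs)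
      there : ∀ {k t t<} {cs : Ctx* k} {rs} → Single κ cs rs → Single κ (there t cs) (small t< ∷ rs)

    data Branching : ∀ {k} {ts : Vec (Tree Σ 0) k} → Cut* ts → Set where
      none : ∀ {k} {ts : Vec (Tree Σ 0) k} {rs : Cut* ts} → branches* rs ≡ 0 → Branching rs
      one  : ∀ {k u} {κ : Core u} {cs : Ctx* k} {rs} → Single κ cs rs → Branching rs
      many : ∀ {k} {ts : Vec (Tree Σ 0) k} {rs : Cut* ts} → 2 ≤ branches* rs → Branching rs

    branching : ∀ {k} {ts : Vec (Tree Σ 0) k} (rs : Cut* ts) → Branching rs
    branching [] = none refl
    branching (small _ ∷ rs) with branching rs
    ... | none e = none e
    ... | one s  = one (there s)
    ... | many l = many l
    branching (big c _ κ _ ∷ rs) with branches* rs in eq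
    ... | zero  = one (here eq)
    ... | suc b = many (s≤s (subst (1 ≤_) (sym eq) (s≤s z≤n)))

    loose-none : ∀ {k} {ts : Vec (Tree Σ 0) k} (rs : Cut* ts) → branches* rs ≡ 0 → loose* rs ≡ size* ts
    loose-none [] e = refl
    loose-none {ts = t ∷ ts} (small _ ∷ rs) e =
      trans (cong (size t +_) (loose-none rs e)) (sym (length-++ (labels t)))

    loose-single : ∀ {k u} {κ : Core u} {cs : Ctx* k} {rs} → Single κ cs rs → loose* rs ≡ ctxSize* cs
    loose-single (here {ts = ts} {rs} {c} e) =
      trans (cong (ctxSize c +_) (loose-none rs e)) (sym (ctxSize*-here c ts))
    loose-single (there {t = t} {cs = cs} s) =
      trans (cong (size t +_) (loose-single s)) (sym (ctxSize*-there t cs))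

    -- The program takes these decisions in the same order.
    build  : ∀ f {ts} (rs : Cut* ts) → Dec (size (node f ts) < μ) → Branching rs → Cut (node f ts)
    build₁ : ∀ f {u} {κ : Core u} {cs : Ctx* (rank Σ f)} {rs} → Single κ cs rs →
      μ ≤ size (node f (plug* cs u)) → Dec (ctxSize (node f cs) < μ) → Cut (node f (plug* cs u))
    build f rs (yes s<) b = small s<
    build f rs (no s≮) (none e) = big □ 0<μ (core f rs (inj₁ μ≤) (≮⇒≥ s≮)) (≮⇒≥ s≮)
      where μ≤ = ≤-trans (≮⇒≥ s≮) (≤-reflexive (cong suc (sym (loose-none rs e))))
    build f rs (no s≮) (one s)  = build₁ f s (≮⇒≥ s≮) (_ <? μ)
    build f rs (no s≮) (many l) = big □ 0<μ (core f rs (inj₂ l) (≮⇒≥ s≮)) (≮⇒≥ s≮)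
    build₁ f {κ = κ} {cs} s μ≤ (yes c<) = big (node f cs) c< κ μ≤
    build₁ f {rs = rs} s μ≤ (no c≮)     = big □ 0<μ (core f rs (inj₁ μ≤′) μ≤) μ≤
      where μ≤′ = ≤-trans (≮⇒≥ c≮) (≤-reflexive (cong suc (sym (loose-single s))))

    cut  : ∀ t → Cut t
    cut* : ∀ {k} (ts : Vec (Tree Σ 0) k) → Cut* ts
    cut (node f ts) = build f (cut* ts) (_ <? μ) (branching (cut* ts))
    cut* []         = []
    cut* (t ∷ ts)   = cut t ∷ cut* ts

    skeletonSize  : ∀ {t} → Cut t → ℕ
    skeletonSize* : ∀ {k} {ts : Vec (Tree Σ 0) k} → Cut* ts → ℕ
    coreSize      : ∀ {u} → Core u → ℕ
    skeletonSize (small _)              = 1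
    skeletonSize (big □ _ κ _)          = coreSize κ
    skeletonSize (big (node f cs) _ κ _) = suc (coreSize κ)
    skeletonSize* []       = 0
    skeletonSize* (r ∷ rs) = skeletonSize r + skeletonSize* rs
    coreSize (core f rs _ _) = suc (skeletonSize* rs)

    module _ (r : ℕ) where

      Narrow : List (Symbol Σ) → Set
      Narrow = All (λ f → rank Σ f ≤ r)

      -- An amortised count in which a node of the start rule costs `μ` and each node of the tree
      -- brings `2 * suc r`. The credit of loose nodes remains unspent, and every core keeps a
      -- reserve of `μ * suc r`. The summand `μ` on the right is what the parent pays for the single
      -- nonterminal of a piece. In `core-bound` the root has to pay for itself and at most `r`
      -- pieces, which takes `μ * suc r`, and to set aside an equal reserve.
      skeleton-bound  : ∀ {t} (q : Cut t) → Narrow (labels t) →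
        μ * skeletonSize q + branches q * (μ * suc r) + 2 * suc r * loose q ≤ μ + 2 * suc r * size t
      skeleton-bound* : ∀ {k} {ts : Vec (Tree Σ 0) k} (qs : Cut* ts) → Narrow (labels* ts) →
        μ * skeletonSize* qs + branches* qs * (μ * suc r) + 2 * suc r * loose* qs ≤ μ * k + 2 * suc r * size* ts
      core-bound : ∀ {u} (κ : Core u) → Narrow (labels u) →
        μ * coreSize κ + μ * suc r ≤ 2 * suc r * size u

      skeleton-bound {t} (small _) nt = ≤-reflexive (arith μ (2 * suc r * size t))
        where
        arith : ∀ m x → m * 1 + 0 + x ≡ m + x
        arith = solve-∀
      skeleton-bound (big c {u} c< κ c≥) nt = begin
        μ * skeletonSize (big c c< κ c≥) + 1 * (μ * suc r) + 2 * suc r * ctxSize c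
          ≤⟨ +-monoˡ-≤ _ (+-monoˡ-≤ _ (*-monoʳ-≤ μ (closed c c< c≥))) ⟩
        μ * suc (coreSize κ) + 1 * (μ * suc r) + 2 * suc r * ctxSize c
          ≡⟨ arith₁ μ (coreSize κ) r (ctxSize c) ⟩
        μ + (μ * coreSize κ + μ * suc r) + 2 * suc r * ctxSize c
          ≤⟨ +-monoˡ-≤ _ (+-monoʳ-≤ μ (core-bound κ
               (++⁻ˡ (labels u) (++⁻ʳ (before c) (subst Narrow (labels-plug c u) nt))))) ⟩
        μ + 2 * suc r * size u + 2 * suc r * ctxSize c
          ≡⟨ arith₂ μ (2 * suc r) (size u) (ctxSize c) ⟩
        μ + 2 * suc r * (ctxSize c + size u)
          ≡⟨ cong (λ x → μ + 2 * suc r * x) (sym (size-plug c u)) ⟩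
        μ + 2 * suc r * size (plug c u) ∎
        where
        open ≤-Reasoning
        closed : ∀ c c< c≥ → skeletonSize (big c c< κ c≥) ≤ suc (coreSize κ)
        closed □           _ _ = n≤1+n _
        closed (node f cs) _ _ = ≤-refl
        arith₁ : ∀ m s r c → m * suc s + 1 * (m * suc r) + 2 * suc r * c ≡ m + (m * s + m * suc r) + 2 * suc r * c
        arith₁ = solve-∀
        arith₂ : ∀ m x u c → m + x * u + x * c ≡ m + x * (c + u)
        arith₂ = solve-∀
      skeleton-bound* [] nt = ≤-reflexive (arith μ (2 * suc r))
        where
        arith : ∀ m x → m * 0 + 0 + x * 0 ≡ m * 0 + x * 0
        arith = solve-∀
      skeleton-bound* {suc k} {t ∷ ts} (q ∷ qs) nt = begin
        μ * (skeletonSize q + skeletonSize* qs) + (branches q + branches* qs) * (μ * suc r)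
          + 2 * suc r * (loose q + loose* qs)
          ≡⟨ arith₁ μ (2 * suc r) (μ * suc r) (skeletonSize q) (skeletonSize* qs) (branches q) (branches* qs) (loose q) (loose* qs) ⟩
        (μ * skeletonSize q + branches q * (μ * suc r) + 2 * suc r * loose q)
          + (μ * skeletonSize* qs + branches* qs * (μ * suc r) + 2 * suc r * loose* qs)
          ≤⟨ +-mono-≤ (skeleton-bound q (++⁻ˡ (labels t) nt)) (skeleton-bound* qs (++⁻ʳ (labels t) nt)) ⟩
        (μ + 2 * suc r * size t) + (μ * k + 2 * suc r * size* ts)
          ≡⟨ arith₂ μ (2 * suc r) k (size t) (size* ts) ⟩
        μ * suc k + 2 * suc r * (size t + size* ts)
          ≡⟨ cong (λ x → μ * suc k + 2 * suc r * x) (sym (length-++ (labels t))) ⟩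
        μ * suc k + 2 * suc r * size* (t ∷ ts) ∎
        where
        open ≤-Reasoning
        arith₁ : ∀ m x y a b c d e f →
          m * (a + b) + (c + d) * y + x * (e + f) ≡ (m * a + c * y + x * e) + (m * b + d * y + x * f)
        arith₁ = solve-∀
        arith₂ : ∀ m x k s u → (m + x * s) + (m * k + x * u) ≡ m * suc k + x * (s + u)
        arith₂ = solve-∀
      core-bound (core f {ts} qs large _) (ρ≤ ∷ nt) = +-cancelʳ-≤ (μ * suc r) _ _ (begin
        μ * suc s + μ * suc r + μ * suc r
          ≡⟨ arith₁ μ s r ⟩
        (μ + μ * s) + 2 * (μ * suc r)
          ≤⟨ +-monoʳ-≤ (μ + μ * s) (enough large) ⟩
        (μ + μ * s) + (h * (μ * suc r) + 2 * suc r * suc l)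
          ≡⟨ arith₂ μ s r h l ⟩
        (μ * s + h * (μ * suc r) + 2 * suc r * l) + (μ + 2 * suc r)
          ≤⟨ +-monoˡ-≤ _ (skeleton-bound* qs nt) ⟩
        (μ * rank Σ f + 2 * suc r * size* ts) + (μ + 2 * suc r)
          ≤⟨ +-monoˡ-≤ _ (+-monoˡ-≤ _ (*-monoʳ-≤ μ ρ≤)) ⟩
        (μ * r + 2 * suc r * size* ts) + (μ + 2 * suc r)
          ≡⟨ arith₃ μ r (size* ts) ⟩
        2 * suc r * suc (size* ts) + μ * suc r ∎)
        where
        open ≤-Reasoning
        s = skeletonSize* qs
        h = branches* qs
        l = loose* qs
        -- Both halves are covered either by the credit of `μ` loose nodes, the root included, or by
        -- the reserves of two large children, one being spent and the other passed on.
        enough : μ ≤ suc l ⊎ 2 ≤ h → 2 * (μ * suc r) ≤ h * (μ * suc r) + 2 * suc r * suc l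
        enough (inj₁ μ≤) = ≤-trans (≤-trans (≤-reflexive (comm μ r)) (*-monoʳ-≤ (2 * suc r) μ≤)) (m≤n+m _ _)
          where
          comm : ∀ m r → 2 * (m * suc r) ≡ 2 * suc r * m
          comm = solve-∀
        enough (inj₂ 2≤) = ≤-trans (*-monoˡ-≤ (μ * suc r) 2≤) (m≤m+n _ _)
        arith₁ : ∀ m s r → m * suc s + m * suc r + m * suc r ≡ (m + m * s) + 2 * (m * suc r)
        arith₁ = solve-∀
        arith₂ : ∀ m s r h l → (m + m * s) + (h * (m * suc r) + 2 * suc r * suc l)
          ≡ (m * s + h * (m * suc r) + 2 * suc r * l) + (m + 2 * suc r)
        arith₂ = solve-∀
        arith₃ : ∀ m r z → (m * r + 2 * suc r * z) + (m + 2 * suc r) ≡ 2 * suc r * suc z + m * suc r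
        arith₃ = solve-∀

-- Clusters, their words and their encodings.

OfToken : (ℕ → Set) → Maybe ℕ → Set
OfToken P nothing  = ⊤
OfToken P (just f) = P f

tokenDigit : ℕ → (ℕ → ℕ) → Maybe ℕ → ℕ
tokenDigit hole δ nothing  = hole
tokenDigit hole δ (just f) = δ f

module Clusters (ρ : ℕ → ℕ) where

  Term : Set
  Term = Tree (ℕ-alphabet ρ) 0

  data Cluster : Set where
    closed : Term → Cluster
    opened : Ctx {ℕ-alphabet ρ} → Cluster

  pattern-of : Cluster → ∃[ n ] Tree (ℕ-alphabet ρ) n
  pattern-of (closed t) = 0 , t
  pattern-of (opened c) = 1 , pattern₁ c

  clusterRank : Cluster → ℕ
  clusterRank x = proj₁ (pattern-of x)

  clusterWord : Cluster → List (Maybe ℕ)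
  clusterWord x = word (proj₂ (pattern-of x))

  clusterSize : Cluster → ℕ
  clusterSize x = size (proj₂ (pattern-of x))

  token : Maybe ℕ → List ℕ
  token nothing  = 0 ∷ 0 ∷ 0 ∷ []
  token (just f) = 1 ∷ f ∷ ρ f ∷ []

  encodeTree≡  : ∀ {n} → (∀ (x : Fin n) → toℕ x ≡ 0) → (t : Tree (ℕ-alphabet ρ) n) →
    encodeTree (1 ,_) t ≡ concatMap token (word t)
  encodeTree≡* : ∀ {n k} → (∀ (x : Fin n) → toℕ x ≡ 0) → (ts : Vec (Tree (ℕ-alphabet ρ) n) k) →
    encodeTree* (1 ,_) ts ≡ concatMap token (word* ts)
  encodeTree≡ 0s (param x)   = cong (λ y → 0 ∷ y ∷ 0 ∷ []) (0s x)
  encodeTree≡ 0s (node f ts) = cong (λ z → 1 ∷ f ∷ ρ f ∷ z) (encodeTree≡* 0s ts)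
  encodeTree≡* 0s []       = refl
  encodeTree≡* 0s (t ∷ ts) = trans (cong₂ _++_ (encodeTree≡ 0s t) (encodeTree≡* 0s ts))
    (sym (concatMap-++ token (word t) (word* ts)))

  clusterCode : Cluster → List ℕ
  clusterCode x = clusterRank x ∷ concatMap token (clusterWord x)

  clusterCode≡ : ∀ x → clusterCode x ≡ clusterRank x ∷ encodeTree (1 ,_) (proj₂ (pattern-of x))
  clusterCode≡ (closed t) = cong (0 ∷_) (sym (encodeTree≡ (λ ()) t))
  clusterCode≡ (opened c) = cong (1 ∷_) (sym (encodeTree≡ (λ { zero → refl }) (pattern₁ c)))

  clusterWord-closed : ∀ t → clusterWord (closed t) ≡ map just (labels t)
  clusterWord-closed t = trans (cong word (sym (weaken-0 t))) (word-weaken {n = 0} t)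

  closed≢opened : ∀ t c → clusterWord (closed t) ≢ clusterWord (opened c)
  closed≢opened t c e = go (labels t) (before c)
    (trans (sym (clusterWord-closed t)) (trans e (word-pattern c)))
    where
    go : ∀ (xs ys : List ℕ) {zs} → map just xs ≢ map just ys ++ nothing ∷ zs
    go []       []       ()
    go []       (_ ∷ _)  ()
    go (_ ∷ _)  []       ()
    go (_ ∷ xs) (_ ∷ ys) e = go xs ys (proj₂ (∷-injective e))

  -- Equality of patterns is all that a rule requires, so contexts themselves are never compared.
  -- The two kinds are told apart by `nothing`, which occurs only in words of contexts.
  clusterWord-injective : ∀ x y → clusterWord x ≡ clusterWord y → pattern-of x ≡ pattern-of y
  clusterWord-injective (closed t) (closed u) e = cong (0 ,_) (word-injective (λ ()) t u e)
  clusterWord-injective (closed t) (opened c) e = ⊥-elim (closed≢opened t c e)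
  clusterWord-injective (opened c) (closed t) e = ⊥-elim (closed≢opened t c (sym e))
  clusterWord-injective (opened c) (opened d) e =
    cong (1 ,_) (word-injective (λ { zero zero → refl }) _ _ e)

  module Parts (μ : ℕ) (0<μ : 0 < μ) where
    open Cutting {ℕ-alphabet ρ} μ 0<μ

    -- In the order in which the program completes them: a context precedes the pieces inside its
    -- hole, although a part of it lies behind them in the preorder. The empty context is no piece.
    parts     : ∀ {t} → Cut t → List Cluster
    parts*    : ∀ {k} {ts : Vec Term k} → Cut* ts → List Cluster
    coreParts : ∀ {u} → Core u → List Cluster
    parts (small {t} _)            = closed t ∷ []
    parts (big □ _ κ _)            = coreParts κ
    parts (big c@(node _ _) _ κ _) = opened c ∷ coreParts κ
    parts* []       = []
    parts* (q ∷ qs) = parts q ++ parts* qs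
    coreParts (core f qs _ _) = parts* qs

  -- The grammar of a cut, its value, size and encoding.

  module Skeleton (μ : ℕ) (0<μ : 0 < μ) (key : Cluster → ℕ) (D : List Cluster) where
    open Cutting {ℕ-alphabet ρ} μ 0<μ
    open Dictionary key
    open Parts μ 0<μ

    -- The text of the start rule, read off the cut directly, so that the program can be verified
    -- without mention of grammars. `start-code` identifies it with the encoding of the rule.
    code     : ∀ {t} → Cut t → List ℕ
    code*    : ∀ {k} {ts : Vec Term k} → Cut* ts → List ℕ
    coreCode : ∀ {u} → Core u → List ℕ
    code (small {t} _)            = 2 ∷ find D (key (closed t)) ∷ 0 ∷ []
    code (big □ _ κ _)            = coreCode κ
    code (big c@(node _ _) _ κ _) = 2 ∷ find D (key (opened c)) ∷ 1 ∷ coreCode κ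
    code* []       = []
    code* (q ∷ qs) = code q ++ code* qs
    coreCode (core f qs _ _) = 1 ∷ f ∷ ρ f ∷ code* qs

    -- Nonterminal 0 is the start symbol, so a position of `D` counted from 1 is the number of its
    -- nonterminal.
    ranks : Fin (suc (length D)) → ℕ
    ranks zero    = 0
    ranks (suc i) = clusterRank (lookup D i)

    Alphabet : RankedAlphabet
    Alphabet = ℕ-alphabet ρ ⊎ᴿ nonterminals ranks

    naming : ℕ ⊎ Fin (suc (length D)) → ℕ × ℕ
    naming = [ (1 ,_) , (λ B → 2 , toℕ B) ]′

    embed  : ∀ {n} → Tree (ℕ-alphabet ρ) n → Tree Alphabet n
    embed* : ∀ {n k} → Vec (Tree (ℕ-alphabet ρ) n) k → Vec (Tree Alphabet n) k
    embed (param x)   = param x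
    embed (node f ts) = node (inj₁ f) (embed* ts)
    embed* []         = []
    embed* (t ∷ ts)   = embed t ∷ embed* ts

    params-embed  : ∀ {n} (t : Tree (ℕ-alphabet ρ) n) → params (embed t) ≡ params t
    params-embed* : ∀ {n k} (ts : Vec (Tree (ℕ-alphabet ρ) n) k) → params* (embed* ts) ≡ params* ts
    params-embed (param x)   = refl
    params-embed (node f ts) = params-embed* ts
    params-embed* []         = refl
    params-embed* (t ∷ ts)   = cong₂ _++_ (params-embed t) (params-embed* ts)

    labels-embed  : ∀ {n} (t : Tree (ℕ-alphabet ρ) n) → labels (embed t) ≡ map inj₁ (labels t)
    labels-embed* : ∀ {n k} (ts : Vec (Tree (ℕ-alphabet ρ) n) k) → labels* (embed* ts) ≡ map inj₁ (labels* ts)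
    labels-embed (param x)   = refl
    labels-embed (node f ts) = cong (inj₁ f ∷_) (labels-embed* ts)
    labels-embed* []         = refl
    labels-embed* (t ∷ ts)   = trans (cong₂ _++_ (labels-embed t) (labels-embed* ts))
      (sym (map-++ inj₁ (labels t) (labels* ts)))

    encode-embed  : ∀ {n} (t : Tree (ℕ-alphabet ρ) n) → encodeTree naming (embed t) ≡ encodeTree (1 ,_) t
    encode-embed* : ∀ {n k} (ts : Vec (Tree (ℕ-alphabet ρ) n) k) →
      encodeTree* naming (embed* ts) ≡ encodeTree* (1 ,_) ts
    encode-embed (param x)   = refl
    encode-embed (node f ts) = cong (λ z → 1 ∷ f ∷ ρ f ∷ z) (encode-embed* ts)
    encode-embed* []         = refl
    encode-embed* (t ∷ ts)   = cong₂ _++_ (encode-embed t) (encode-embed* ts)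

    expand-embed  : ∀ {n} (t : Tree (ℕ-alphabet ρ) n) p → expand (embed t) p ≡ t
    expand-embed* : ∀ {n k} (ts : Vec (Tree (ℕ-alphabet ρ) n) k) p → expand* (embed* ts) p ≡ ts
    expand-embed (param x)   p = refl
    expand-embed (node f ts) p = cong (node f) (expand-embed* ts _)
    expand-embed* []         p = refl
    expand-embed* (t ∷ ts)   p = cong₂ _∷_ (expand-embed t _) (expand-embed* ts _)

    expand-cong  : ∀ {n} (t : Tree Alphabet n) {p q} → (∀ B B∈ → p B B∈ ≡ q B B∈) → expand t p ≡ expand t q
    expand-cong* : ∀ {n k} (ts : Vec (Tree Alphabet n) k) {p q} →
      (∀ B B∈ → p B B∈ ≡ q B B∈) → expand* ts p ≡ expand* ts q
    expand-cong (param x)          e = refl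
    expand-cong (node (inj₁ f) ts) e = cong (node f) (expand-cong* ts (λ B B∈ → e B (there B∈)))
    expand-cong (node (inj₂ B) ts) e =
      cong₂ _⟪_⟫ (e B (here refl)) (expand-cong* ts (λ C C∈ → e C (there C∈)))
    expand-cong* []       e = refl
    expand-cong* (t ∷ ts) e = cong₂ _∷_ (expand-cong t (λ B B∈ → e B (∈-++⁺ˡ B∈)))
      (expand-cong* ts (λ B B∈ → e B (∈-++⁺ʳ (labels t) B∈)))

    -- The entry found under the key of `x` need not be `x` itself, but it has the same pattern.
    Listed : Cluster → Set
    Listed x = Σ[ i ∈ Fin (length D) ] pattern-of (lookup D i) ≡ pattern-of x × suc (toℕ i) ≡ find D (key x)

    -- The arguments are counted by the rank in `p`. Matching on the equation spares every later
    -- lemma a transport of vectors.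
    call : ∀ i {p} → pattern-of (lookup D i) ≡ p → Vec (Tree Alphabet 0) (proj₁ p) → Tree Alphabet 0
    call i refl us = node (inj₂ (suc i)) us

    startTree  : ∀ {t} (q : Cut t) → All Listed (parts q) → Tree Alphabet 0
    startTree* : ∀ {k} {ts : Vec Term k} (qs : Cut* ts) → All Listed (parts* qs) → Vec (Tree Alphabet 0) k
    coreTree   : ∀ {u} (κ : Core u) → All Listed (coreParts κ) → Tree Alphabet 0
    startTree (small _) ((i , e , _) ∷ [])            = call i e []
    startTree (big □ _ κ _) ls                        = coreTree κ ls
    startTree (big (node _ _) _ κ _) ((i , e , _) ∷ ls) = call i e (coreTree κ ls ∷ [])
    startTree* []       ls = []
    startTree* (q ∷ qs) ls = startTree q (++⁻ˡ (parts q) ls) ∷ startTree* qs (++⁻ʳ (parts q) ls)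
    coreTree (core f qs _ _) ls = node (inj₁ f) (startTree* qs ls)

    IsRule : Symbol Alphabet → Set
    IsRule (inj₁ f)       = ⊤
    IsRule (inj₂ zero)    = ⊥
    IsRule (inj₂ (suc i)) = ⊤

    call-rules : ∀ i {p} (e : pattern-of (lookup D i) ≡ p) us → All IsRule (labels* us) → All IsRule (labels (call i e us))
    call-rules i refl us rs = tt ∷ rs

    start-rules  : ∀ {t} (q : Cut t) ls → All IsRule (labels (startTree q ls))
    start-rules* : ∀ {k} {ts : Vec Term k} (qs : Cut* ts) ls → All IsRule (labels* (startTree* qs ls))
    core-rules   : ∀ {u} (κ : Core u) ls → All IsRule (labels (coreTree κ ls))
    start-rules (small _) ((i , e , _) ∷ []) = call-rules i e [] []
    start-rules (big □ _ κ _) ls = core-rules κ ls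
    start-rules (big (node _ _) _ κ _) ((i , e , _) ∷ ls) = call-rules i e _ (++⁺ (core-rules κ ls) [])
    start-rules* []       ls = []
    start-rules* (q ∷ qs) ls = ++⁺ (start-rules q _) (start-rules* qs _)
    core-rules (core f qs _ _) ls = tt ∷ start-rules* qs ls

    call-size : ∀ i {p} (e : pattern-of (lookup D i) ≡ p) us → size (call i e us) ≡ suc (size* us)
    call-size i refl us = refl

    start-size  : ∀ {t} (q : Cut t) ls → size (startTree q ls) ≡ skeletonSize q
    start-size* : ∀ {k} {ts : Vec Term k} (qs : Cut* ts) ls → size* (startTree* qs ls) ≡ skeletonSize* qs
    core-size   : ∀ {u} (κ : Core u) ls → size (coreTree κ ls) ≡ coreSize κ
    start-size (small _) ((i , e , _) ∷ []) = call-size i e []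
    start-size (big □ _ κ _) ls = core-size κ ls
    start-size (big (node _ _) _ κ _) ((i , e , _) ∷ ls) = trans (call-size i e _)
      (cong suc (trans (cong length (++-identityʳ (labels (coreTree κ ls)))) (core-size κ ls)))
    start-size* []       ls = refl
    start-size* (q ∷ qs) ls = trans (length-++ (labels (startTree q _))) (cong₂ _+_ (start-size q _) (start-size* qs _))
    core-size (core f qs _ _) ls = cong suc (start-size* qs ls)

    call-code : ∀ i {p} (e : pattern-of (lookup D i) ≡ p) us →
      encodeTree naming (call i e us) ≡ 2 ∷ suc (toℕ i) ∷ proj₁ p ∷ encodeTree* naming us
    call-code i refl us = refl

    start-code  : ∀ {t} (q : Cut t) ls → encodeTree naming (startTree q ls) ≡ code q
    start-code* : ∀ {k} {ts : Vec Term k} (qs : Cut* ts) ls → encodeTree* naming (startTree* qs ls) ≡ code* qs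
    core-code   : ∀ {u} (κ : Core u) ls → encodeTree naming (coreTree κ ls) ≡ coreCode κ
    start-code (small _) ((i , e , j) ∷ []) = trans (call-code i e []) (cong (λ x → 2 ∷ x ∷ 0 ∷ []) j)
    start-code (big □ _ κ _) ls = core-code κ ls
    start-code (big (node _ _) _ κ _) ((i , e , j) ∷ ls) = trans (call-code i e _)
      (cong₂ (λ x z → 2 ∷ x ∷ 1 ∷ z) j (trans (++-identityʳ (encodeTree naming (coreTree κ ls))) (core-code κ ls)))
    start-code* []       ls = refl
    start-code* (q ∷ qs) ls = cong₂ _++_ (start-code q _) (start-code* qs _)
    core-code (core f qs _ _) ls = cong (λ z → 1 ∷ f ∷ ρ f ∷ z) (start-code* qs ls)

    module _ (values : ∀ B → Tree (ℕ-alphabet ρ) (ranks B))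
             (values-rule : ∀ i → values (suc i) ≡ proj₂ (pattern-of (lookup D i))) where

      call-value : ∀ i {p} (e : pattern-of (lookup D i) ≡ p) us →
        expand (call i e us) (λ B _ → values B) ≡ proj₂ p ⟪ expand* us (λ B _ → values B) ⟫
      call-value i refl us = cong (_⟪ expand* us (λ B _ → values B) ⟫) (values-rule i)

      start-value  : ∀ {t} (q : Cut t) ls → expand (startTree q ls) (λ B _ → values B) ≡ t
      start-value* : ∀ {k} {ts : Vec Term k} (qs : Cut* ts) ls → expand* (startTree* qs ls) (λ B _ → values B) ≡ ts
      core-value   : ∀ {u} (κ : Core u) ls → expand (coreTree κ ls) (λ B _ → values B) ≡ u
      start-value (small {t} _) ((i , e , _) ∷ []) = trans (call-value i e [])
        (trans (cong (_⟪ [] ⟫) (sym (weaken-0 t))) (trans (weaken-⟪⟫ t []) (weaken-0 t)))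
      start-value (big □ _ κ _) ls = core-value κ ls
      start-value (big c@(node _ _) {u} _ κ _) ((i , e , _) ∷ ls) = trans (call-value i e _)
        (trans (cong (λ v → pattern₁ c ⟪ v ∷ [] ⟫) (core-value κ ls)) (plug-⟪⟫ c u))
      start-value* []       ls = refl
      start-value* (q ∷ qs) ls = cong₂ _∷_ (start-value q _) (start-value* qs _)
      core-value (core f qs _ _) ls = cong (node f) (start-value* qs ls)

    module Grammar {t} (q : Cut t) (listed : All Listed (parts q)) where

      rules : (A : Fin (suc (length D))) → Tree Alphabet (ranks A)
      rules zero    = startTree q listed
      rules (suc i) = embed (proj₂ (pattern-of (lookup D i)))

      valid : ∀ A → ValidPattern (rules A)
      -- There is no parameter of type `Fin 0`, so the list of parameters can only be empty.
      valid zero with params (startTree q listed)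
      ... | []     = refl
      ... | () ∷ _
      valid (suc i) with lookup D i
      ... | closed u with params (embed u)
      ...   | []     = refl
      ...   | () ∷ _
      valid (suc i) | opened c = trans (params-embed (pattern₁ c)) (params-pattern c)

      _Below_ : Fin (suc (length D)) → Fin (suc (length D)) → Set
      B Below A = inj₂ B ∈ labels (rules A)

      no-calls : ∀ xs {B} → ¬ (inj₂ B ∈ map {B = Symbol Alphabet} inj₁ xs)
      no-calls (x ∷ xs) (there B∈) = no-calls xs B∈

      below-start : ∀ {B A} → B Below A → A ≡ zero
      below-start {A = zero}  B∈ = refl
      below-start {B} {suc i} B∈ = ⊥-elim (no-calls (labels u) (subst (inj₂ B ∈_) (labels-embed u) B∈))
        where u = proj₂ (pattern-of (lookup D i))

      above-rule : ∀ {B A} → B Below A → B ≢ zero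
      above-rule {A = zero}  B∈ refl = All.lookup (start-rules q listed) B∈
      above-rule {A = suc i} B∈ refl with below-start {zero} {suc i} B∈
      ... | ()

      -- Only the start rule calls nonterminals, and never the start symbol. A path thus ends in
      -- `zero` and does not begin there.
      acyclic-rules : ∀ A → ¬ TransClosure _Below_ A A
      acyclic-rules A p = first p (last p)
        where
        last : ∀ {A B} → TransClosure _Below_ A B → B ≡ zero
        last {A} {B} [ b ]⁺ = below-start {A} {B} b
        last (b ∷ p)        = last p
        first : ∀ {A B} → TransClosure _Below_ A B → A ≢ zero
        first {A} {B} [ b ]⁺      = above-rule {A} {B} b
        first {A} (_∷_ {y = B} b p) = above-rule {A} {B} b

      grammar : TSLP (ℕ-alphabet ρ)
      grammar = record
        { #nt = suc (length D) ; ntRank = ranks ; start = zero ; start-rank = refl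
        ; rhs = rules ; rhs-valid = valid ; acyclic = acyclic-rules }

      rule-value : ∀ i a → valAcc grammar (suc i) a ≡ proj₂ (pattern-of (lookup D i))
      rule-value i (acc below) = expand-embed (proj₂ (pattern-of (lookup D i))) _

      grammar-value : val grammar ≡ t
      grammar-value = go (OccursIn⁺-wellFounded grammar zero)
        where
        values : ∀ B → Tree (ℕ-alphabet ρ) (ranks B)
        -- A default value, since the start symbol never occurs in a rule.
        values zero    = t
        values (suc i) = proj₂ (pattern-of (lookup D i))
        go : ∀ a → valAcc grammar zero a ≡ t
        go (acc below) = trans
          (expand-cong (startTree q listed) {q = λ B _ → values B} same)
          (start-value values (λ i → refl) q listed)
          where
          -- Every call is evaluated with an accessibility proof of its own. By `rule-value` the
          -- result does not depend on it, so one family of values serves all calls.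
          same : ∀ B B∈ → valAcc grammar B (below [ B∈ ]⁺) ≡ values B
          same zero    B∈ = ⊥-elim (above-rule {A = zero} B∈ refl)
          same (suc i) B∈ = rule-value i (below [ B∈ ]⁺)

      grammar-size : TSLP-size grammar ≡ skeletonSize q + sum (map clusterSize D)
      grammar-size = cong₂ _+_ (start-size q listed) (cong sum (begin
        map (λ A → size (rules A)) (tabulate suc)
          ≡⟨ map-tabulate suc (λ A → size (rules A)) ⟩
        tabulate (λ i → size (rules (suc i)))
          ≡⟨ tabulate-cong (λ i →
               trans (cong length (labels-embed (proj₂ (pattern-of (lookup D i))))) (length-map inj₁ (labels (proj₂ (pattern-of (lookup D i)))))) ⟩
        tabulate (λ i → clusterSize (lookup D i))
          ≡⟨ sym (map-tabulate (lookup D) clusterSize) ⟩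
        map clusterSize (tabulate (lookup D))
          ≡⟨ cong (map clusterSize) (tabulate-lookup D) ⟩
        map clusterSize D ∎))
        where open ≡-Reasoning

      grammar-code : encodeTSLP grammar ≡
        (suc (length D) ∷ 0 ∷ 0 ∷ code q) ++ concatMap clusterCode D
      grammar-code = cong₂ (λ xs ys → (suc (length D) ∷ 0 ∷ 0 ∷ xs) ++ ys) (start-code q listed)
        (cong concat (begin
        map (λ A → ranks A ∷ encodeTree naming (rules A)) (tabulate suc)
          ≡⟨ map-tabulate suc (λ A → ranks A ∷ encodeTree naming (rules A)) ⟩
        tabulate (λ i → ranks (suc i) ∷ encodeTree naming (rules (suc i)))
          ≡⟨ tabulate-cong (λ i →
               trans (cong (ranks (suc i) ∷_) (encode-embed (proj₂ (pattern-of (lookup D i)))))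
                     (sym (clusterCode≡ (lookup D i)))) ⟩
        tabulate (λ i → clusterCode (lookup D i))
          ≡⟨ sym (map-tabulate (lookup D) clusterCode) ⟩
        map clusterCode (tabulate (lookup D))
          ≡⟨ cong (map clusterCode) (tabulate-lookup D) ⟩
        map clusterCode D ∎))
        where open ≡-Reasoning

      grammar-rank : ∀ A → ntRank grammar A ≤ 1
      grammar-rank zero    = z≤n
      grammar-rank (suc i) with lookup D i
      ... | closed _ = z≤n
      ... | opened _ = ≤-refl

-- Comparisons expressed by truncated subtraction.

0<⇒≢0 : ∀ {m} → 0 < m → m ≢ 0
0<⇒≢0 (s≤s _) ()

≢0⇒0< : ∀ {m} → m ≢ 0 → 0 < m
≢0⇒0< {zero}  m≢0 = ⊥-elim (m≢0 refl)
≢0⇒0< {suc m} _   = s≤s z≤n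

≤⇒∸≡0 : ∀ {m n} → m ≤ n → m ∸ n ≡ 0
≤⇒∸≡0 = m≤n⇒m∸n≡0

<⇒∸≢0 : ∀ {m n} → n < m → m ∸ n ≢ 0
<⇒∸≢0 n<m = 0<⇒≢0 (m<n⇒0<n∸m n<m)

∸≢0⇒< : ∀ {m n} → m ∸ n ≢ 0 → n < m
∸≢0⇒< {m} {n} ne = ≰⇒> (λ m≤n → ne (≤⇒∸≡0 m≤n))

∸≡0⇒≤ : ∀ {m n} → m ∸ n ≡ 0 → m ≤ n
∸≡0⇒≤ = m∸n≡0⇒m≤n

m<2^m : ∀ m → m < 2 ^ m
m<2^m zero    = s≤s z≤n
m<2^m (suc m) = begin-strict
  suc m          <⟨ +-mono-≤-< (m^n>0 2 m) (m<2^m m) ⟩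
  2 ^ m + 2 ^ m  ≡⟨ cong (2 ^ m +_) (sym (+-identityʳ (2 ^ m))) ⟩
  2 ^ suc m      ∎
  where open ≤-Reasoning

-- Reading the input, numbering the symbols and finding the threshold.

module Names = Dictionary {ℕ} (λ f → f)

-- Variables throughout: 0 n, 1 the number of symbols seen, 2 the base β, 3 the digit of
-- holes, 4 μ. Arrays: 0 symbols, 1 their ranks, 2 their digits, 3 ends of subtrees,
-- 4 holes, 5 jumps, 6 digit of a symbol, 7 nonterminal of a number, 8 the encoded rules
-- of the clusters, 9 the rest of the output.
scanInit scanBody : Code
scanInit = lit 1 0 ⍮ lit 5 2 ⍮ lit 6 0 ⍮ mov 7 0
scanBody =
  input 8 5 ⍮ inc 5 ⍮ input 9 5 ⍮ inc 5 ⍮ inc 5 ⍮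
  put 0 6 8 ⍮ put 1 6 9 ⍮
  fetch 10 6 8 ⍮ cond 10 skip (inc 1 ⍮ mov 10 1 ⍮ put 6 8 10) ⍮
  put 2 6 10 ⍮ inc 6 ⍮ dec 7

-- The machine has no logarithm, so powers of `β ^ 4` are computed until one exceeds `n`. The guard
-- is `n + 1` minus the power, nonzero as long as the power is at most `n`. The last power is at
-- most `n * β ^ 4`, which is why that number has to fit into a word.
thresholdInit thresholdBody : Code
thresholdInit =
  mov 3 1 ⍮ inc 3 ⍮ mov 2 3 ⍮ inc 2 ⍮ times 5 2 2 ⍮ times 5 5 5 ⍮
  mov 6 5 ⍮ lit 4 1 ⍮ mov 8 0 ⍮ inc 8 ⍮ minus 7 8 6
thresholdBody = times 6 6 5 ⍮ inc 4 ⍮ minus 7 8 6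

triples : (ℕ → ℕ) → List ℕ → List ℕ
triples ρ = concatMap (λ f → 1 ∷ f ∷ ρ f ∷ [])

module Scanning (ρ : ℕ → ℕ) (D V : ℕ) (In : ℕ → ℕ) where
  open Names

  -- `at` is the address of the next node's three words. Variable 5 is one ahead, since the kind of
  -- a node is not read. Array 6 is addressed by the names of the symbols themselves and agrees with
  -- `find` everywhere, zero meaning a symbol not met yet.
  record Scan (n : ℕ) (ls xs ys : List ℕ) (s : Store) : Set where
    field
      all-labels : xs ++ ys ≡ ls
      total      : var s 0 ≡ n
      count      : var s 1 ≡ length (collect [] xs)
      remaining  : var s 7 ≡ length ys
      at         : ℕ
      at≡        : var s 5 ≡ suc at
      inside     : at + 3 * length ys ≤ D
      stored     : StoredAt In at (triples ρ ys)
      names      : Buffer (arr s 0) (var s 6) xs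
      arities    : Buffer (arr s 1) (var s 6) (map ρ xs)
      digits     : Buffer (arr s 2) (var s 6) (map (find (collect [] xs)) xs)
      table      : ∀ κ → arr s 6 κ ≡ find (collect [] xs) κ
      jumps0     : ∀ i → arr s 5 i ≡ 0
      codes0     : ∀ i → arr s 7 i ≡ 0

  open Scan

  map-find-insert : ∀ xs f → map (find (collect [] (xs ++ [ f ]))) xs ≡ map (find (collect [] xs)) xs
  map-find-insert xs f rewrite collect-++ [] xs [ f ] = go (find-collect [] xs)
    where
    go : ∀ {zs} → All (λ x → find (collect [] xs) x ≢ 0) zs →
      map (find (insert (collect [] xs) f)) zs ≡ map (find (collect [] xs)) zs
    go []       = refl
    go (p ∷ ps) = cong₂ _∷_ (find-⊑ _ (insert-⊑ (collect [] xs) f) p) (go ps)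

  push-map : ∀ {M p xs u} (g : ℕ → ℕ) f → u ≡ g f → Buffer M p (map g xs) →
    Buffer (M [ p ↦ u ]) (suc p) (map g (xs ++ [ f ]))
  push-map {xs = xs} g f e b = subst (Buffer _ _) (sym (map-++ g xs [ f ])) (push e b)

  scan : ∀ {n ls} ys {xs s} → Scan n ls xs ys s →
    Reach D V In 7 scanBody (length ys) (λ s′ → var s′ 7 ≡ 0 × Scan n ls ls [] s′) s
  scan {n} {ls} [] {xs} {s} S = reached 0 (remaining S ,
    subst (λ zs → Scan n ls zs [] s) (trans (sym (++-identityʳ xs)) (all-labels S)) S)
  scan (f ∷ ys) {xs} {s} S with stored S
  ... | _ , f≡ , ρ≡ , rest = iterate
    (λ e → 1+n≢0 (trans (sym (remaining S)) e))
    (in₁ , in₂ ,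
      (λ z≢0 → scan ys {xs ++ [ f ]} (record
        { all-labels = trans (++-assoc xs [ f ] ys) (all-labels S)
        ; total = total S
        ; count = trans (count S) (cong length (sym (same-old z≢0)))
        ; remaining = cong (_∸ 1) (remaining S)
        ; at = 3 + at S ; at≡ = cong (3 +_) (at≡ S) ; inside = inside′ ; stored = rest
        ; names = push name≡ (names S)
        ; arities = push-map ρ f (trans (cong (λ a → In (suc a)) (at≡ S)) ρ≡) (arities S)
        ; digits = push-map (find (collect [] (xs ++ [ f ]))) f (trans cell≡ (cong (λ e → find e f) (sym (same-old z≢0))))
            (subst (Buffer _ _) (sym (map-find-insert xs f)) (digits S))
        ; table = λ κ → trans (table S κ) (cong (λ e → find e κ) (sym (same-old z≢0)))
        ; jumps0 = jumps0 S ; codes0 = codes0 S })) ,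
      (λ z≡0 → scan ys {xs ++ [ f ]} (record
        { all-labels = trans (++-assoc xs [ f ] ys) (all-labels S)
        ; total = total S
        ; count = new-count z≡0
        ; remaining = cong (_∸ 1) (remaining S)
        ; at = 3 + at S ; at≡ = cong (3 +_) (at≡ S) ; inside = inside′ ; stored = rest
        ; names = push name≡ (names S)
        ; arities = push-map ρ f (trans (cong (λ a → In (suc a)) (at≡ S)) ρ≡) (arities S)
        ; digits = push-map (find (collect [] (xs ++ [ f ]))) f (new-find z≡0)
            (subst (Buffer _ _) (sym (map-find-insert xs f)) (digits S))
        ; table = new-table z≡0
        ; jumps0 = jumps0 S ; codes0 = codes0 S })))
    where
    d = collect [] xs
    room : at S + 3 ≤ D
    room = ≤-trans (+-monoʳ-≤ (at S) (*-monoʳ-≤ 3 (s≤s z≤n))) (inside S)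
    in₁ : var s 5 < D
    in₁ rewrite at≡ S = ≤-trans (≤-trans (n≤1+n _) (≤-reflexive (+-comm 3 (at S)))) room
    in₂ : suc (var s 5) < D
    in₂ rewrite at≡ S = ≤-trans (≤-reflexive (+-comm 3 (at S))) room
    name≡ : In (var s 5) ≡ f
    name≡ = trans (cong In (at≡ S)) f≡
    cell≡ : arr s 6 (In (var s 5)) ≡ find d f
    cell≡ = trans (cong (arr s 6) name≡) (table S f)
    step : collect [] (xs ++ [ f ]) ≡ insert d f
    step = collect-++ [] xs [ f ]
    inside′ : 3 + at S + 3 * length ys ≤ D
    inside′ = ≤-trans (≤-reflexive (arith (at S) (length ys))) (inside S)
      where
      arith : ∀ a l → 3 + a + 3 * l ≡ a + 3 * suc l
      arith = solve-∀
    same-old : arr s 6 (In (var s 5)) ≢ 0 → collect [] (xs ++ [ f ]) ≡ d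
    same-old z≢0 = trans step (insert-old d f (λ e → z≢0 (trans cell≡ e)))
    module _ (z≡0 : arr s 6 (In (var s 5)) ≡ 0) where
      absent : find d f ≡ 0
      absent = trans (sym cell≡) z≡0
      same : collect [] (xs ++ [ f ]) ≡ d ++ [ f ]
      same = trans step (insert-new d f absent)
      new-count : suc (var s 1) ≡ length (collect [] (xs ++ [ f ]))
      new-count = trans (cong suc (count S)) (trans (+-comm 1 _) (trans (sym (length-++ d)) (cong length (sym same))))
      new-find : suc (var s 1) ≡ find (collect [] (xs ++ [ f ])) f
      new-find = sym (trans (cong (λ e → find e f) same) (trans (find-snoc d f f absent)
        (trans (update-same (find d) f _) (cong suc (sym (count S))))))
      new-table : ∀ κ → (arr s 6 [ In (var s 5) ↦ suc (var s 1) ]) κ ≡ find (collect [] (xs ++ [ f ])) κ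
      new-table κ = trans (cong (λ g → (arr s 6 [ g ↦ suc (var s 1) ]) κ) name≡)
        (trans (update-cong f (table S) (cong suc (count S)) κ)
          (sym (trans (cong (λ e → find e κ) same) (find-snoc d f κ absent))))

module Threshold (D V : ℕ) (In : ℕ → ℕ) (n β : ℕ) (1≤n : 1 ≤ n) (2≤β : 2 ≤ β) (n*b<V : n * β ^ 4 < V) where

  b : ℕ
  b = β ^ 4

  2≤b : 2 ≤ b
  2≤b = begin
    2 * 1            ≤⟨ *-mono-≤ 2≤β (^-monoˡ-≤ 3 (≤-trans (s≤s z≤n) 2≤β)) ⟩
    β ^ 4            ∎
    where open ≤-Reasoning

  record Growing (m : ℕ) (s : Store) : Set where
    field
      vb : var s 5 ≡ b
      vB : var s 6 ≡ b ^ suc m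
      vμ : var s 4 ≡ suc m
      vn : var s 8 ≡ suc n
      vg : var s 7 ≡ suc n ∸ b ^ suc m
      low : b ^ m ≤ n

  open Growing

  -- The `k` rounds cannot run out, since `m < 2 ^ m ≤ b ^ m ≤ n` as long as the loop runs. `Keep`
  -- carries facts untouched by variables 4, 6 and 7 through the loop.
  grow : ∀ k {m s} → n < m + k → Growing m s → (Keep : Store → Set) →
    (∀ s x y z → Keep s → Keep ⟬ ((var s [ 6 ↦ x ]) [ 4 ↦ y ]) [ 7 ↦ z ] , arr s ⟭) → Keep s →
    Reach D V In 7 thresholdBody k
      (λ s′ → var s′ 7 ≡ 0 × Keep s′ × ∃[ m ] var s′ 4 ≡ suc m × b ^ m ≤ n × n < b ^ suc m) s
  grow k {m} {s} n< G Keep keep K with suc n ≤? b ^ suc m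
  grow k {m} {s} n< G Keep keep K | yes n<B =
    reached k (trans (vg G) (≤⇒∸≡0 n<B) , K , m , vμ G , low G , n<B)
  grow zero {m} n< G Keep keep K | no n≮B = ⊥-elim (<-irrefl refl (begin-strict
    n        <⟨ n< ⟩
    m + 0    ≡⟨ +-identityʳ m ⟩
    m        <⟨ m<2^m m ⟩
    2 ^ m    ≤⟨ ^-monoˡ-≤ m 2≤b ⟩
    b ^ m    ≤⟨ low G ⟩
    n        ∎))
    where open ≤-Reasoning
  grow (suc k) {m} {s} n< G Keep keep K | no n≮B = iterate
    (λ e → <⇒∸≢0 (≰⇒> n≮B) (trans (sym (vg G)) e))
    (B*b< , grow k (≤-trans n< (≤-reflexive (+-suc m k))) (record
      { vb = vb G ; vB = B≡ ; vμ = cong suc (vμ G) ; vn = vn G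
      ; vg = cong₂ _∸_ (vn G) B≡ ; low = ≤-pred (≰⇒> n≮B) })
      Keep keep (keep s _ _ _ K))
    where
    B≡ : var s 6 * var s 5 ≡ b ^ suc (suc m)
    B≡ = trans (cong₂ _*_ (vB G) (vb G)) (*-comm (b ^ suc m) b)
    B*b< : var s 6 * var s 5 < V
    B*b< rewrite vB G | vb G = ≤-<-trans (*-monoˡ-≤ b (≤-pred (≰⇒> n≮B))) n*b<V

-- The scan from right to left: ends of subtrees and holes.

module Layout (ρ : ℕ → ℕ) (μ : ℕ) (0<μ : 0 < μ) where
  open Cutting {ℕ-alphabet ρ} μ 0<μ
  open Clusters ρ using (Term)

  -- E and C record, for the nodes of a subtree at position o of the preorder,
  -- where their subtrees end and at which node the context starting there has its hole.
  module _ (E C : ℕ → ℕ) where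

    -- Nothing is claimed about nodes strictly inside a small subtree or a context. The second scan
    -- visits none of them as a node of its own.
    Filled     : ∀ {t} → Cut t → ℕ → Set
    Filled*    : ∀ {k} {ts : Vec Term k} → Cut* ts → ℕ → Set
    FilledCore : ∀ {u} → Core u → ℕ → Set
    Filled (small {t} _) o     = E o ≡ o + size t
    Filled (big c {u} _ κ _) o = E o ≡ o + size (plug c u) × C o ≡ o + length (before c) ×
      FilledCore κ (o + length (before c))
    Filled* [] o                     = ⊤
    Filled* (_∷_ {t = t} q qs) o     = Filled q o × Filled* qs (o + size t)
    FilledCore (core f {ts} qs _ _) o = E o ≡ o + size (node {ℕ-alphabet ρ} f ts) × C o ≡ o × Filled* qs (suc o)

    filledCore-end : ∀ {u} (κ : Core u) {o} → FilledCore κ o → E o ≡ o + size u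
    filledCore-end (core f qs _ _) (e , _) = e

  module _ {E C E′ C′ : ℕ → ℕ} where

    filled-cong     : ∀ {t} (q : Cut t) o → (∀ x → o ≤ x → E′ x ≡ E x × C′ x ≡ C x) →
      Filled E C q o → Filled E′ C′ q o
    filled-cong*    : ∀ {k} {ts : Vec Term k} (qs : Cut* ts) o → (∀ x → o ≤ x → E′ x ≡ E x × C′ x ≡ C x) →
      Filled* E C qs o → Filled* E′ C′ qs o
    filledCore-cong : ∀ {u} (κ : Core u) o → (∀ x → o ≤ x → E′ x ≡ E x × C′ x ≡ C x) →
      FilledCore E C κ o → FilledCore E′ C′ κ o
    filled-cong (small _) o same e = trans (proj₁ (same o ≤-refl)) e
    filled-cong (big c _ κ _) o same (e , h , r) =
      trans (proj₁ (same o ≤-refl)) e , trans (proj₂ (same o ≤-refl)) h ,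
      filledCore-cong κ _ (λ x le → same x (≤-trans (m≤m+n o _) le)) r
    filled-cong* [] o same _ = tt
    filled-cong* (q ∷ qs) o same (r , rs) =
      filled-cong q o same r , filled-cong* qs _ (λ x le → same x (≤-trans (m≤m+n o _) le)) rs
    filledCore-cong (core f qs _ _) o same (e , h , r) =
      trans (proj₁ (same o ≤-refl)) e , trans (proj₂ (same o ≤-refl)) h ,
      filled-cong* qs _ (λ x le → same x (≤-trans (n≤1+n o) le)) r

  -- What variable 9 holds once the children are passed, with `q` the value left in it from before.
  lastBig : ∀ {k} {ts : Vec Term k} → Cut* ts → ℕ → ℕ → ℕ
  lastBig [] p q = q
  lastBig (_∷_ {t = t} (small _) qs) p q     = lastBig qs (p + size t) q
  lastBig (_∷_ {t = t} (big _ _ _ _) qs) p q = lastBig qs (p + size t) p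

  lastBig-none : ∀ {k} {ts : Vec Term k} (qs : Cut* ts) p q → branches* qs ≡ 0 → lastBig qs p q ≡ q
  lastBig-none [] p q e = refl
  lastBig-none (small _ ∷ qs) p q e = lastBig-none qs _ q e

  single-branches : ∀ {k u} {κ : Core u} {cs : Ctx* k} {qs} → Single κ cs qs → branches* qs ≡ 1
  single-branches (here e)  = cong suc e
  single-branches (there s) = single-branches s

  single-filled : ∀ {E C k u} {κ : Core u} {cs : Ctx* k} {qs} (s : Single κ cs qs) p q → Filled* E C qs p →
    C (lastBig qs p q) ≡ p + length (before* cs) × FilledCore E C κ (p + length (before* cs))
  single-filled {C = C} (here {rs = qs} {c} e) p q ((_ , h , r) , _) =
    trans (cong C (lastBig-none qs _ p e)) h , r
  single-filled {E} {C} {κ = κ} (there {t = t} {cs = cs} s) p q (_ , rs) =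
    let e , r = single-filled s (p + size t) q rs
    in trans e assoc , subst (FilledCore E C κ) assoc r
    where
    assoc : p + size t + length (before* cs) ≡ p + length (labels t ++ before* cs)
    assoc = trans (+-assoc p _ _) (cong (p +_) (sym (length-++ (labels t))))

-- The node treated is one less than variable 5. Variable 6 runs through its children,
-- of which 7 are left, 8 were large, and 9 was the last large one; 12 is its hole.
fillSetup fillTest fillChoose fillKid fillStore fillFinish fillInit fillBody : Code
fillSetup = mov 11 5 ⍮ dec 11 ⍮ fetch 7 1 11 ⍮ mov 6 5 ⍮ lit 8 0
fillTest =
  fetch 13 4 9 ⍮ fetch 14 3 13 ⍮ minus 14 14 13 ⍮ minus 15 6 5 ⍮ minus 15 15 14 ⍮
  minus 15 4 15 ⍮ cond 15 (mov 12 13) skip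
fillChoose = mov 12 5 ⍮ cond 8 (mov 11 8 ⍮ dec 11 ⍮ cond 11 skip fillTest) skip
fillKid =
  fetch 10 3 6 ⍮ minus 11 10 6 ⍮ inc 11 ⍮ minus 11 11 4 ⍮ cond 11 (inc 8 ⍮ mov 9 6) skip ⍮
  mov 6 10 ⍮ dec 7
fillStore = put 3 5 6 ⍮ put 4 5 12 ⍮ fillSetup
fillFinish = dec 5 ⍮ fillChoose ⍮ fillStore
fillInit = mov 5 0 ⍮ fillSetup
fillBody = cond 7 fillKid fillFinish

-- Everything the loop leaves alone, as one value: its preservation is a single equation, and `refl`
-- for each instruction.
record FillFrame : Set where
  constructor fillFrame
  field
    v₀ v₁ v₂ v₃ v₄ : ℕ
    a₀ a₁ a₂ a₅ a₇ : ℕ → ℕ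

fillFrameOf : Store → FillFrame
fillFrameOf s = fillFrame (var s 0) (var s 1) (var s 2) (var s 3) (var s 4)
  (arr s 0) (arr s 1) (arr s 2) (arr s 5) (arr s 7)

module Filling (ρ : ℕ → ℕ) (μ : ℕ) (0<μ : 0 < μ) (D V : ℕ) (In : ℕ → ℕ)
  (F : FillFrame) (v₄≡μ : FillFrame.v₄ F ≡ μ) where
  open Cutting {ℕ-alphabet ρ} μ 0<μ
  open Clusters ρ using (Term)
  open Layout ρ μ 0<μ
  open FillFrame F using (a₁)

  Loop : ℕ → (Store → Set) → Store → Set
  Loop = Reach D V In 5 fillBody

  -- All nodes from `o` on are done, and the next one is `o ∸ 1`. Variable 5 is the guard of the
  -- loop. It stays one above the node, or else the loop would stop before the root, which is node
  -- 0.
  record Ready (o : ℕ) (E C : ℕ → ℕ) (s : Store) : Set where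
    field
      frame : fillFrameOf s ≡ F
      at    : var s 5 ≡ o
      ptr   : var s 6 ≡ o
      kids  : var s 7 ≡ a₁ (o ∸ 1)
      heavy : var s 8 ≡ 0
      ends  : arr s 3 ≡ E
      holes : arr s 4 ≡ C

  record Counting (o p k h q : ℕ) (E C : ℕ → ℕ) (s : Store) : Set where
    field
      frame : fillFrameOf s ≡ F
      at    : var s 5 ≡ suc o
      ptr   : var s 6 ≡ p
      kids  : var s 7 ≡ k
      heavy : var s 8 ≡ h
      last  : var s 9 ≡ q
      ends  : arr s 3 ≡ E
      holes : arr s 4 ≡ C

  open Counting

  at≢0 : ∀ {o p k h q E C s} → Counting o p k h q E C s → var s 5 ≢ 0
  at≢0 R e = 1+n≢0 (trans (sym (at R)) e)

  v₄≡ : ∀ s → fillFrameOf s ≡ F → var s 4 ≡ μ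
  v₄≡ s e = trans (cong FillFrame.v₄ e) v₄≡μ

  -- With the increment, the difference is nonzero exactly if `μ ≤ z`.
  heavyTest : ∀ {s o p k h q E C} → Counting o p k h q E C s → ∀ z → E p ≡ p + z →
    suc (arr s 3 (var s 6) ∸ var s 6) ∸ var s 4 ≡ suc z ∸ μ
  heavyTest {s} {p = p} R z e = cong₂ _∸_
    (cong suc (trans (cong₂ (λ g x → g x ∸ x) (ends R) (ptr R)) (trans (cong (_∸ p) e) (m+n∸m≡n p z))))
    (v₄≡ s (frame R))

  recount : ∀ {k o p p′ h h′ q E C s} → p ≡ p′ → h ≡ h′ →
    Loop k (Counting o p 0 h q E C) s → Loop k (Counting o p′ 0 h′ q E C) s
  recount refl refl l = l

  after-kid : ∀ {k} p t (ts : Vec Term k) → p + size t + size* ts ≡ p + size* (t ∷ ts)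
  after-kid p t ts = trans (+-assoc p _ _) (cong (p +_) (sym (length-++ (labels t))))

  scanKids : ∀ {k} {ts : Vec Term k} (qs : Cut* ts) {o p h q E C s} → Filled* E C qs p →
    Counting o p k h q E C s →
    Loop k (Counting o (p + size* ts) 0 (h + branches* qs) (lastBig qs p q) E C) s
  scanKids [] {p = p} {h} _ R =
    recount (sym (+-identityʳ p)) (sym (+-identityʳ h)) (reached 0 R)
  scanKids {suc k} {t ∷ ts} (small t< ∷ qs) {p = p} (f , fs) R = iterate (at≢0 R)
    ( (λ _ → (λ ne → ⊥-elim (ne (trans (heavyTest R (size t) f) (≤⇒∸≡0 t<)))) ,
             (λ _ → recount (after-kid p t ts) refl
               (scanKids qs fs (record
                 { frame = frame R ; at = at R ; ptr = trans (cong₂ (λ g x → g x) (ends R) (ptr R)) f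
                 ; kids = cong (_∸ 1) (kids R) ; heavy = heavy R ; last = last R
                 ; ends = ends R ; holes = holes R }))))
    , (λ e → ⊥-elim (1+n≢0 (trans (sym (kids R)) e))))
  scanKids {suc k} {t ∷ ts} (big c c< κ t≥ ∷ qs) {p = p} {h} (f , fs) R = iterate (at≢0 R)
    ( (λ _ → (λ _ → recount (after-kid p t ts) (sym (+-suc h _))
               (scanKids qs fs (record
                 { frame = frame R ; at = at R ; ptr = trans (cong₂ (λ g x → g x) (ends R) (ptr R)) (proj₁ f)
                 ; kids = cong (_∸ 1) (kids R) ; heavy = cong suc (heavy R) ; last = ptr R
                 ; ends = ends R ; holes = holes R }))) ,
             (λ e → ⊥-elim (<⇒∸≢0 (s≤s t≥) (trans (sym (heavyTest R (size t) (proj₁ f))) e))))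
    , (λ e → ⊥-elim (1+n≢0 (trans (sym (kids R)) e))))

  record Same (s s′ : Store) : Set where
    field
      frame≡ : fillFrameOf s′ ≡ fillFrameOf s
      v₅≡    : var s′ 5 ≡ var s 5
      v₆≡    : var s′ 6 ≡ var s 6
      arr≡   : arr s′ ≡ arr s

  same : ∀ {s s′} → fillFrameOf s′ ≡ fillFrameOf s → var s′ 5 ≡ var s 5 → var s′ 6 ≡ var s 6 →
    arr s′ ≡ arr s → Same s s′
  same p q r t = record { frame≡ = p ; v₅≡ = q ; v₆≡ = r ; arr≡ = t }

  -- For small subtrees: their hole is never looked up, so whichever way the program decides is
  -- right.
  choose-any : ∀ {Φ s} → (∀ s′ → Same s s′ → Φ s′) → wp D V In fillChoose Φ s
  choose-any f =
    (λ _ → (λ _ → f _ (same refl refl refl refl)) ,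
           (λ _ → (λ _ → f _ (same refl refl refl refl)) , (λ _ → f _ (same refl refl refl refl)))) ,
    (λ _ → f _ (same refl refl refl refl))

  choose-root : ∀ {Φ s} → var s 8 ≢ 1 → (∀ s′ → Same s s′ → var s′ 12 ≡ var s 5 → Φ s′) →
    wp D V In fillChoose Φ s
  choose-root {s = s} h≢1 f =
    (λ h≢0 → (λ _ → f _ (same refl refl refl refl) refl) ,
             (λ h≤1 → ⊥-elim (h≢1 (≤-antisym (m∸n≡0⇒m≤n {m = var s 8} h≤1) (≢0⇒0< h≢0))))) ,
    (λ _ → f _ (same refl refl refl refl) refl)

  choose-one : ∀ {Φ s} c z → var s 8 ≡ 1 → arr s 4 (var s 9) ≡ c →
    var s 4 ∸ ((var s 6 ∸ var s 5) ∸ (arr s 3 c ∸ c)) ≡ z →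
    (z ≢ 0 → ∀ s′ → Same s s′ → var s′ 12 ≡ c → Φ s′) →
    (z ≡ 0 → ∀ s′ → Same s s′ → var s′ 12 ≡ var s 5 → Φ s′) →
    wp D V In fillChoose Φ s
  choose-one {s = s} c z h≡1 refl refl f g =
    (λ _ → (λ ne → ⊥-elim (ne (cong (_∸ 1) h≡1))) ,
           (λ _ → (λ z≢0 → f z≢0 _ (same refl refl refl refl) refl) ,
                  (λ z≡0 → g z≡0 _ (same refl refl refl refl) refl))) ,
    (λ e → ⊥-elim (1+n≢0 (trans (sym h≡1) e)))

  steps  : Term → ℕ
  steps* : ∀ {k} → Vec Term k → ℕ
  steps (node f ts) = steps* ts + (ρ f + 1)
  steps* []         = 0
  steps* (t ∷ ts)   = steps* ts + steps t

  -- A round either finishes a node or passes a child. Every node is finished once and, the root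
  -- excepted, passed once.
  steps-bound  : ∀ t → suc (steps t) ≤ 2 * size t
  steps-bound* : ∀ {k} (ts : Vec Term k) → steps* ts + k ≤ 2 * size* ts
  steps-bound (node f ts) = begin
    suc (steps* ts + (ρ f + 1))  ≡⟨ arith (steps* ts) (ρ f) ⟩
    steps* ts + ρ f + 2          ≤⟨ +-monoˡ-≤ 2 (steps-bound* ts) ⟩
    2 * size* ts + 2             ≡⟨ arith′ (size* ts) ⟩
    2 * suc (size* ts)           ∎
    where
    open ≤-Reasoning
    arith : ∀ x y → suc (x + (y + 1)) ≡ x + y + 2
    arith = solve-∀
    arith′ : ∀ x → 2 * x + 2 ≡ 2 * suc x
    arith′ = solve-∀
  steps-bound* []       = z≤n
  steps-bound* {suc k} (t ∷ ts) = begin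
    steps* ts + steps t + suc k    ≡⟨ arith (steps* ts) (steps t) k ⟩
    suc (steps t) + (steps* ts + k) ≤⟨ +-mono-≤ (steps-bound t) (steps-bound* ts) ⟩
    2 * size t + 2 * size* ts      ≡⟨ sym (*-distribˡ-+ 2 (size t) (size* ts)) ⟩
    2 * (size t + size* ts)        ≡⟨ cong (2 *_) (sym (length-++ (labels t))) ⟩
    2 * size* (t ∷ ts)             ∎
    where
    open ≤-Reasoning
    arith : ∀ x y k → x + y + suc k ≡ suc y + (x + k)
    arith = solve-∀

  Agree : ℕ → (E C E′ C′ : ℕ → ℕ) → Set
  Agree o E C E′ C′ = ∀ x → o ≤ x → E′ x ≡ E x × C′ x ≡ C x

  record Done {t} (q : Cut t) (o : ℕ) (E C : ℕ → ℕ) (s : Store) : Set where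
    field
      {E′ C′} : ℕ → ℕ
      ready   : Ready o E′ C′ s
      filled  : Filled E′ C′ q o
      agree   : Agree (o + size t) E C E′ C′

  record Done* {k} {ts : Vec Term k} (qs : Cut* ts) (o : ℕ) (E C : ℕ → ℕ) (s : Store) : Set where
    field
      {E′ C′} : ℕ → ℕ
      ready   : Ready o E′ C′ s
      filled  : Filled* E′ C′ qs o
      agree   : Agree (o + size* ts) E C E′ C′

  -- What the decision about the hole of a node at o has to guarantee.
  Good : ∀ f {ts : Vec Term (ρ f)} → Cut (node f ts) → ℕ → (E C : ℕ → ℕ) → ℕ → Set
  Good f {ts} q o E C v = ∀ {E′ C′} → E′ o ≡ o + size (node {ℕ-alphabet ρ} f ts) → C′ o ≡ v →
    Agree (suc o) E C E′ C′ → Filled E′ C′ q o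

  root-good : ∀ f {ts : Vec Term (ρ f)} (qs : Cut* ts) {o E C v} → Filled* E C qs (suc o) → v ≡ o →
    ∀ {E′ C′} → E′ o ≡ o + size (node {ℕ-alphabet ρ} f ts) → C′ o ≡ v → Agree (suc o) E C E′ C′ →
    E′ o ≡ o + size (node {ℕ-alphabet ρ} f ts) × C′ o ≡ o + 0 ×
    E′ (o + 0) ≡ o + 0 + size (node {ℕ-alphabet ρ} f ts) × C′ (o + 0) ≡ o + 0 × Filled* E′ C′ qs (suc (o + 0))
  root-good f qs {o} fs v≡ e h agree rewrite +-identityʳ o =
    e , trans h v≡ , e , trans h v≡ , filled-cong* qs (suc o) agree fs

  -- The cases are those of `build`, so that the stored hole belongs to the very cut that `cut`
  -- computes. The size of a context is obtained as the size of the subtree minus that of the core,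
  -- both known from recorded ends.
  chosen : ∀ f {ts} (qs : Cut* ts) d (b : Branching qs) {o E C q s Φ} → Filled* E C qs (suc o) →
    var s 4 ≡ μ → var s 5 ≡ o → var s 6 ≡ o + size (node {ℕ-alphabet ρ} f ts) →
    var s 8 ≡ branches* qs → var s 9 ≡ lastBig qs (suc o) q → arr s 3 ≡ E → arr s 4 ≡ C →
    (∀ s′ → Same s s′ → Good f (build f qs d b) o E C (var s′ 12) → Φ s′) →
    wp D V In fillChoose Φ s
  chosen f qs (yes t<) b fs e₄ e₅ e₆ e₈ e₉ eE eC k = choose-any (λ s′ sm → k s′ sm (λ e _ _ → e))
  chosen f qs (no t≮) (none e) fs e₄ e₅ e₆ e₈ e₉ eE eC k =
    choose-root (λ h → 0≢1+n (trans (sym (trans e₈ e)) h))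
      (λ s′ sm v → k s′ sm (root-good f qs fs (trans v e₅)))
  chosen f qs (no t≮) (many l) fs e₄ e₅ e₆ e₈ e₉ eE eC k =
    choose-root (λ h → 1+n≰n (subst (2 ≤_) (trans (sym e₈) h) l))
      (λ s′ sm v → k s′ sm (root-good f qs fs (trans v e₅)))
  chosen f qs (no t≮) (one {u = u} {κ = κ} {cs = cs} s₁) {o} {E} {C} {q} {s} {Φ} fs e₄ e₅ e₆ e₈ e₉ refl refl k =
    split (_ <? μ) k
    where
    hole : C (lastBig qs (suc o) q) ≡ suc o + length (before* cs) × FilledCore E C κ (suc o + length (before* cs))
    hole = single-filled s₁ (suc o) q fs
    c = suc o + length (before* cs)
    test : var s 4 ∸ ((var s 6 ∸ var s 5) ∸ (arr s 3 c ∸ c)) ≡ μ ∸ ctxSize (node {ℕ-alphabet ρ} f cs)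
    test = cong₂ _∸_ e₄ (trans (cong₂ _∸_
      (trans (cong₂ _∸_ e₆ e₅) (trans (m+n∸m≡n o _) (size-plug {ℕ-alphabet ρ} (node f cs) u)))
      (trans (cong (_∸ c) (filledCore-end E C κ (proj₂ hole))) (m+n∸m≡n c (size u))))
      (m+n∸n≡m (ctxSize (node {ℕ-alphabet ρ} f cs)) (size u)))
    split : ∀ d → (∀ s′ → Same s s′ → Good f (build₁ f s₁ (≮⇒≥ t≮) d) o E C (var s′ 12) → Φ s′) →
      wp D V In fillChoose Φ s
    split (yes c<) k = choose-one c _ (trans e₈ (single-branches s₁)) (trans (cong C e₉) (proj₁ hole)) test
      (λ _ s′ sm v → k s′ sm (λ {E′} {C′} e h agree →
        e , trans h (trans v (sym (+-suc o _))) ,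
        subst (FilledCore E′ C′ κ) (sym (+-suc o _))
          (filledCore-cong κ c (λ x le → agree x (≤-trans (m≤m+n (suc o) _) le)) (proj₂ hole))))
      (λ z≡0 → ⊥-elim (<⇒∸≢0 c< z≡0))
    split (no c≮) k = choose-one c _ (trans e₈ (single-branches s₁)) (trans (cong C e₉) (proj₁ hole)) test
      (λ z≢0 → ⊥-elim (z≢0 (≤⇒∸≡0 (≮⇒≥ c≮))))
      (λ _ s′ sm v → k s′ sm (root-good f qs fs (trans v e₅)))

  store-wp : ∀ {s Φ} → (∀ s′ → fillFrameOf s′ ≡ fillFrameOf s → var s′ 5 ≡ var s 5 → var s′ 6 ≡ var s 5 →
      var s′ 7 ≡ arr s 1 (var s 5 ∸ 1) → var s′ 8 ≡ 0 →
      arr s′ 3 ≡ arr s 3 [ var s 5 ↦ var s 6 ] → arr s′ 4 ≡ arr s 4 [ var s 5 ↦ var s 12 ] → Φ s′) →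
    wp D V In fillStore Φ s
  store-wp f = f _ refl refl refl refl refl refl refl

  finish-wp : ∀ {s Φ} → var s 7 ≡ 0 →
    wp D V In fillChoose (wp D V In fillStore Φ) ⟬ var s [ 5 ↦ var s 5 ∸ 1 ] , arr s ⟭ → wp D V In fillBody Φ s
  finish-wp k≡0 p = (λ k≢0 → ⊥-elim (k≢0 k≡0)) , (λ _ → p)

  module Node (f : ℕ) (ts : Vec Term (ρ f)) (o : ℕ) (E C : ℕ → ℕ) where

    finish : ∀ {s₁ s₂ s₃ s₄} (K : Done* (cut* ts) (suc o) E C s₁) →
      var s₂ 5 ≡ o → var s₂ 6 ≡ o + size (node {ℕ-alphabet ρ} f ts) → fillFrameOf s₂ ≡ F →
      arr s₂ 3 ≡ Done*.E′ K → arr s₂ 4 ≡ Done*.C′ K → Same s₂ s₃ →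
      Good f (cut (node f ts)) o (Done*.E′ K) (Done*.C′ K) (var s₃ 12) →
      fillFrameOf s₄ ≡ fillFrameOf s₃ → var s₄ 5 ≡ var s₃ 5 → var s₄ 6 ≡ var s₃ 5 →
      var s₄ 7 ≡ arr s₃ 1 (var s₃ 5 ∸ 1) → var s₄ 8 ≡ 0 →
      arr s₄ 3 ≡ arr s₃ 3 [ var s₃ 5 ↦ var s₃ 6 ] → arr s₄ 4 ≡ arr s₃ 4 [ var s₃ 5 ↦ var s₃ 12 ] →
      Done (cut (node f ts)) o E C s₄
    finish {s₂ = s₂} {s₃} K e₅ e₆ fr eE eC sm good q₀ q₅ q₆ q₇ q₈ qE qC = record
      { ready = record
          { frame = trans q₀ (trans S.frame≡ fr) ; at = trans q₅ e₅′ ; ptr = trans q₆ e₅′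
          ; kids = trans q₇ (cong₂ (λ g x → g (x ∸ 1)) (cong FillFrame.a₁ (trans S.frame≡ fr)) e₅′)
          ; heavy = q₈ ; ends = qE ; holes = qC }
      ; filled = good (trans (update-at (arr s₃ 3) e₅′) (trans S.v₆≡ e₆)) (update-at (arr s₃ 4) e₅′)
          (λ x o<x → update-off (cong (λ a → a 3) S.arr≡) eE e₅′ o<x , update-off (cong (λ a → a 4) S.arr≡) eC e₅′ o<x)
      ; agree = λ x le →
          let o<x = ≤-trans (≤-trans (s≤s (m≤m+n o _)) (≤-reflexive (sym (+-suc o _)))) le
              le′ = ≤-trans (≤-reflexive (sym (+-suc o _))) le
          in trans (update-off (cong (λ a → a 3) S.arr≡) eE e₅′ o<x) (proj₁ (K.agree x le′)) ,
             trans (update-off (cong (λ a → a 4) S.arr≡) eC e₅′ o<x) (proj₂ (K.agree x le′)) }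
      where
      module S = Same sm
      module K = Done* K
      e₅′ : var s₃ 5 ≡ o
      e₅′ = trans S.v₅≡ e₅
      update-at : ∀ h {i v} → i ≡ o → (h [ i ↦ v ]) o ≡ v
      update-at h refl = update-same h o _
      update-off : ∀ {h h′ H : ℕ → ℕ} {i v x} → h ≡ h′ → h′ ≡ H → i ≡ o → suc o ≤ x → (h [ i ↦ v ]) x ≡ H x
      update-off {h} {x = x} refl refl refl o<x = update-diff h o _ x (λ e → <⇒≢ o<x (sym e))
    decided : ∀ {s₁ s₂} (K : Done* (cut* ts) (suc o) E C s₁) →
      Counting o (suc o + size* ts) 0 (branches* (cut* ts)) (lastBig (cut* ts) (suc o) (var s₁ 9)) (Done*.E′ K) (Done*.C′ K) s₂ →
      Loop 1 (Done (cut (node f ts)) o E C) s₂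
    decided {s₁} {s₂} K N = iterate {D} {V} {In} {5} {fillBody} {N = 0} {Φ = Done (cut (node f ts)) o E C} {s = s₂} (at≢0 N)
      (finish-wp {s = s₂} {Φ = Reach D V In 5 fillBody 0 (Done (cut (node f ts)) o E C)} (kids N)
        (chosen f (cut* ts) (_ <? μ) (branching (cut* ts))
          {q = var s₁ 9} {s = ⟬ var s₂ [ 5 ↦ var s₂ 5 ∸ 1 ] , arr s₂ ⟭}
          {Φ = wp D V In fillStore (Reach D V In 5 fillBody 0 (Done (cut (node f ts)) o E C))}
          (Done*.filled K) (v₄≡ s₂ (frame N)) e₅ e₆ (heavy N) (last N) (ends N) (holes N)
          (λ s₃ sm good → store-wp {s₃} {Reach D V In 5 fillBody 0 (Done (cut (node f ts)) o E C)} (λ s₄ q₀ q₅ q₆ q₇ q₈ qE qC → reached 0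
            (finish {s₂ = ⟬ var s₂ [ 5 ↦ var s₂ 5 ∸ 1 ] , arr s₂ ⟭} {s₃} {s₄} K e₅ e₆ (frame N) (ends N) (holes N) sm good
              q₀ q₅ q₆ q₇ q₈ qE qC)))))
      where
      e₅ = cong (_∸ 1) (at N)
      e₆ = trans (ptr N) (sym (+-suc o _))

  -- The children are filled from the last to the first. `Agree` protects the entries of later
  -- siblings, since a subtree changes nothing behind its end. The node itself then takes one round
  -- per child and one to finish.
  fill  : ∀ t o {E C s} → StoredAt a₁ o (map ρ (labels t)) → Ready (o + size t) E C s →
    Loop (steps t) (Done (cut t) o E C) s
  fill* : ∀ {k} (ts : Vec Term k) o {E C s} → StoredAt a₁ o (map ρ (labels* ts)) → Ready (o + size* ts) E C s →
    Loop (steps* ts) (Done* (cut* ts) o E C) s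
  fill (node f ts) o {E} {C} {s} (ρ≡ , stored) R = reach-trans {M = steps* ts} {N = ρ f + 1}
    (fill* ts (suc o) stored (subst (λ p → Ready p E C s) (+-suc o _) R)) after-kids
    where
    counting : ∀ {s₁} (K : Done* (cut* ts) (suc o) E C s₁) →
      Counting o (suc o) (ρ f) 0 (var s₁ 9) (Done*.E′ K) (Done*.C′ K) s₁
    counting K = record
      { frame = R₁.frame ; at = R₁.at ; ptr = R₁.ptr ; kids = trans R₁.kids ρ≡ ; heavy = R₁.heavy
      ; last = refl ; ends = R₁.ends ; holes = R₁.holes }
      where module R₁ = Ready (Done*.ready K)
    after-kids : ∀ {s₁} → Done* (cut* ts) (suc o) E C s₁ → Loop (ρ f + 1) (Done (cut (node f ts)) o E C) s₁
    after-kids {s₁} K = reach-trans {M = ρ f} {N = 1}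
      (scanKids (cut* ts) {q = var s₁ 9} (Done*.filled K) (counting K)) (Node.decided f ts o E C K)
  fill* [] o {E} {C} {s} _ R = reached 0 (record
    { ready = subst (λ p → Ready p E C s) (+-identityʳ o) R ; filled = tt ; agree = λ x _ → refl , refl })
  fill* (t ∷ ts) o {E} {C} {s} stored R = reach-trans
    (fill* ts (o + size t) stored-ts (subst (λ p → Ready p E C s) assoc R))
    (λ {s₁} K → let module K = Done* K in
      reach-weaken (≤-reflexive (+-identityʳ _)) (reach-trans (fill t o stored-t K.ready)
      (λ {s₂} L → let module L = Done L in reached 0 (record
        { ready = L.ready
        ; filled = L.filled , filled-cong* (cut* ts) (o + size t) L.agree K.filled
        ; agree = λ x le →
            let p , q = L.agree x (≤-trans (≤-trans (m≤m+n _ _) (≤-reflexive (sym assoc))) le)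
                p′ , q′ = K.agree x (≤-trans (≤-reflexive (sym assoc)) le)
            in trans p p′ , trans q q′ }))))
    where
    assoc : o + length (labels t ++ labels* ts) ≡ o + size t + size* ts
    assoc = trans (cong (o +_) (length-++ (labels t))) (sym (+-assoc o _ _))
    both = stored-++⁻ o (map ρ (labels t)) (subst (StoredAt a₁ o) (map-++ ρ (labels t) (labels* ts)) stored)
    stored-t : StoredAt a₁ o (map ρ (labels t))
    stored-t = proj₁ both
    stored-ts : StoredAt a₁ (o + size t) (map ρ (labels* ts))
    stored-ts = subst (λ l → StoredAt a₁ (o + l) (map ρ (labels* ts))) (length-map ρ (labels t)) (proj₂ both)

-- The scan from left to right: writing the grammar.

-- Variable 5 is the position in the tree. While 6 is nonzero, the cluster between 7 and
-- 8 with hole 9, number 10 and rank 11 is being copied; its rule ends at 12, but counts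
-- only once 13, the end of the rules, is moved there. 14 is the number of rules, 15 the
-- end of the start rule. When a context is opened, the jump at the end of its hole is
-- set to its own end, and copying continues at the hole.
emitGuard emitPlain emitHole emitToken emitFinish emitOpen emitSmall emitRoot emitJump emitContext
  emitLarge emitNode emitMain emitSlice emitBody : Code
emitGuard = cond 6 (lit 16 1) (minus 16 0 5)
emitPlain =
  put 8 12 22 ⍮ inc 12 ⍮ fetch 18 0 7 ⍮ put 8 12 18 ⍮ inc 12 ⍮ fetch 18 1 7 ⍮ put 8 12 18 ⍮ inc 12 ⍮
  fetch 18 2 7 ⍮ times 10 10 2 ⍮ plus 10 10 18 ⍮ inc 7
emitHole =
  put 8 12 21 ⍮ inc 12 ⍮ put 8 12 21 ⍮ inc 12 ⍮ put 8 12 21 ⍮ inc 12 ⍮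
  times 10 10 2 ⍮ plus 10 10 3 ⍮ fetch 7 3 7
emitToken = minus 18 7 9 ⍮ minus 19 9 7 ⍮ cond 18 emitPlain (cond 19 emitPlain emitHole)
emitFinish =
  fetch 18 7 10 ⍮ cond 18 skip (inc 14 ⍮ mov 18 14 ⍮ put 7 10 18 ⍮ mov 13 12) ⍮
  put 9 15 23 ⍮ inc 15 ⍮ put 9 15 18 ⍮ inc 15 ⍮ put 9 15 11 ⍮ inc 15 ⍮ lit 6 0
emitOpen =
  mov 7 5 ⍮ mov 8 17 ⍮ mov 12 13 ⍮ put 8 12 11 ⍮ inc 12 ⍮ lit 10 0 ⍮ lit 6 1
emitSmall = mov 9 17 ⍮ mov 11 21 ⍮ emitOpen ⍮ mov 5 17
emitRoot =
  put 9 15 22 ⍮ inc 15 ⍮ fetch 18 0 5 ⍮ put 9 15 18 ⍮ inc 15 ⍮ fetch 18 1 5 ⍮ put 9 15 18 ⍮ inc 15 ⍮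
  inc 5
emitJump = fetch 18 3 19 ⍮ minus 20 17 18 ⍮ cond 20 (put 5 18 17) skip ⍮ mov 5 19
emitContext = mov 9 19 ⍮ mov 11 22 ⍮ emitOpen ⍮ emitJump
emitLarge = fetch 19 4 5 ⍮ minus 18 19 5 ⍮ cond 18 emitContext emitRoot
emitNode = fetch 17 3 5 ⍮ minus 18 17 5 ⍮ inc 18 ⍮ minus 18 18 4 ⍮ cond 18 emitLarge emitSmall
emitMain = fetch 18 5 5 ⍮ cond 18 (mov 5 18) emitNode
emitSlice = minus 18 8 7 ⍮ cond 18 emitToken emitFinish
emitBody = cond 6 emitSlice emitMain ⍮ emitGuard

record EmitFrame : Set where
  constructor emitFrame
  field
    v₀ v₂ v₃ v₄ v₂₁ v₂₂ v₂₃ : ℕ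
    a₀ a₁ a₂ a₃ a₄ : ℕ → ℕ

emitFrameOf : Store → EmitFrame
emitFrameOf s = emitFrame (var s 0) (var s 2) (var s 3) (var s 4) (var s 21) (var s 22) (var s 23)
  (arr s 0) (arr s 1) (arr s 2) (arr s 3) (arr s 4)

module Emission (ρ : ℕ → ℕ) (μ : ℕ) (0<μ : 0 < μ) (D V : ℕ) (In : ℕ → ℕ)
  (n β hd : ℕ) (δ : ℕ → ℕ) (δ<β : ∀ f → δ f < β) (hd<β : hd < β) (β^μ≤V : β ^ μ ≤ V)
  (nm rk dg E C : ℕ → ℕ) where
  open Cutting {ℕ-alphabet ρ} μ 0<μ
  open Clusters ρ
  open Layout ρ μ 0<μ
  open Radix β

  F : EmitFrame
  F = emitFrame n β hd μ 0 1 2 nm rk dg E C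

  Loop : ℕ → (Store → Set) → Store → Set
  Loop = Reach D V In 16 emitBody

  digit : Maybe ℕ → ℕ
  digit = tokenDigit hd δ

  wordKey : List (Maybe ℕ) → ℕ
  wordKey w = radix (map digit w)

  key : Cluster → ℕ
  key x = wordKey (clusterWord x)

  open Dictionary key

  rulesOf : List Cluster → List ℕ
  rulesOf = concatMap clusterCode

  Placed : ℕ → List ℕ → Set
  Placed o []       = ⊤
  Placed o (f ∷ fs) = (nm o ≡ f × rk o ≡ ρ f × dg o ≡ δ f) × Placed (suc o) fs

  placed-++ : ∀ o xs {ys} → Placed o (xs ++ ys) → Placed o xs × Placed (o + length xs) ys
  placed-++ o [] {ys} p = tt , subst (λ o → Placed o ys) (sym (+-identityʳ o)) p
  placed-++ o (x ∷ xs) {ys} (e , p) =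
    let q , r = placed-++ (suc o) xs p in (e , q) , subst (λ o → Placed o ys) (sym (+-suc o _)) r

  record Main (p : ℕ) (J : ℕ → ℕ) (d : List Cluster) (xs : List ℕ) (s : Store) : Set where
    field
      frame : emitFrameOf s ≡ F
      pos   : var s 5 ≡ p
      idle  : var s 6 ≡ 0
      guard : var s 16 ≡ n ∸ p
      jumps : arr s 5 ≡ J
      count : var s 14 ≡ length d
      table : ∀ κ → arr s 7 κ ≡ find d κ
      rules : Buffer (arr s 8) (var s 13) (rulesOf d)
      out   : Buffer (arr s 9) (var s 15) xs

  -- Token by token, the cluster between q and e is being copied, w being the
  -- part already copied and h the position of the hole.
  record Slicing (p : ℕ) (J : ℕ → ℕ) (d : List Cluster) (xs : List ℕ) (r q e h : ℕ)
                 (w : List (Maybe ℕ)) (s : Store) : Set where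
    field
      frame : emitFrameOf s ≡ F
      pos   : var s 5 ≡ p
      busy  : var s 6 ≡ 1
      guard : var s 16 ≢ 0
      jumps : arr s 5 ≡ J
      count : var s 14 ≡ length d
      table : ∀ κ → arr s 7 κ ≡ find d κ
      base  : var s 13 ≡ length (rulesOf d)
      rules : Buffer (arr s 8) (var s 12) (rulesOf d ++ r ∷ concatMap token w)
      coded : var s 10 ≡ wordKey w
      at    : var s 7 ≡ q
      end   : var s 8 ≡ e
      hole  : var s 9 ≡ h
      rank≡ : var s 11 ≡ r
      out   : Buffer (arr s 9) (var s 15) xs

  wordKey-snoc : ∀ w m → wordKey (w ++ [ m ]) ≡ wordKey w * β + digit m
  wordKey-snoc w m rewrite map-++ digit w [ m ] = radix-snoc (map digit w) (digit m)

  digit<β : ∀ m → digit m < β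
  digit<β nothing  = hd<β
  digit<β (just f) = δ<β f

  -- The side condition of the product and the sum: numbers of at most `μ` digits stay below
  -- `β ^ μ`. The hole counts as a digit, and the word of a context still fits, since its nodes are
  -- fewer than `μ`.
  key-step : ∀ w m → length w < μ → wordKey w * β + digit m < V
  key-step w m w< = <-≤-trans (subst (_< β ^ length (map digit (w ++ [ m ]))) (wordKey-snoc w m)
    (radix-bound (all-digits (w ++ [ m ]))))
    (≤-trans (^-monoʳ-≤ β {{>-nonZero (≤-<-trans z≤n hd<β)}} len) β^μ≤V)
    where
    all-digits : ∀ w → All (_< β) (map digit w)
    all-digits []      = []
    all-digits (m ∷ w) = digit<β m ∷ all-digits w
    len : length (map digit (w ++ [ m ])) ≤ μ
    len rewrite length-map digit (w ++ [ m ]) | length-++ w {[ m ]} | +-comm (length w) 1 = w<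

  rules-step : ∀ d r w m → (rulesOf d ++ r ∷ concatMap token w) ++ token m ≡ rulesOf d ++ r ∷ concatMap token (w ++ [ m ])
  rules-step d r w m = trans (++-assoc (rulesOf d) _ _) (cong (λ z → rulesOf d ++ r ∷ z)
    (trans (cong (concatMap token w ++_) (sym (++-identityʳ (token m)))) (sym (concatMap-++ token w [ m ]))))

  push-token : ∀ {M p d r w m u₁ u₂ u₃ v₁ v₂ v₃} → token m ≡ v₁ ∷ v₂ ∷ v₃ ∷ [] → u₁ ≡ v₁ → u₂ ≡ v₂ → u₃ ≡ v₃ →
    Buffer M p (rulesOf d ++ r ∷ concatMap token w) →
    Buffer (((M [ p ↦ u₁ ]) [ suc p ↦ u₂ ]) [ suc (suc p) ↦ u₃ ]) (suc (suc (suc p)))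
      (rulesOf d ++ r ∷ concatMap token (w ++ [ m ]))
  push-token {d = d} {r} {w} {m} t≡ e₁ e₂ e₃ b = subst (Buffer _ _)
    (trans (cong ((rulesOf d ++ r ∷ concatMap token w) ++_) (sym t≡)) (rules-step d r w m))
    (push₃ e₁ e₂ e₃ b)

  module _ {p : ℕ} {J : ℕ → ℕ} {d : List Cluster} {xs : List ℕ} {r q e h : ℕ} {w : List (Maybe ℕ)} where

    plain-wp : ∀ f → nm q ≡ f × rk q ≡ ρ f × dg q ≡ δ f → length w < μ → ∀ {s} → Slicing p J d xs r q e h w s →
      wp D V In emitPlain (wp D V In emitGuard (Reach D V In 16 emitBody 0 (Slicing p J d xs r (suc q) e h (w ++ [ just f ])))) s
    plain-wp f (n≡ , r≡ , d≡) w< {s} S =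
      ≤-<-trans (m≤m+n _ _) bound , bound ,
      (λ _ → reached 0 (record
        { frame = frame ; pos = pos ; busy = busy ; guard = (λ ()) ; jumps = jumps ; count = count ; table = table
        ; base = base
        ; rules = push-token {d = d} {w = w} refl (cong EmitFrame.v₂₂ frame) nm≡ rk≡ rules
        ; coded = trans (cong₂ _+_ code≡ dg≡) (sym (wordKey-snoc w (just f)))
        ; at = cong suc at ; end = end ; hole = hole ; rank≡ = rank≡ ; out = out })) ,
      (λ b → ⊥-elim (1+n≢0 (trans (sym busy) b)))
      where
      open Slicing S
      read : ∀ {g g′ : ℕ → ℕ} {v} → g ≡ g′ → g′ q ≡ v → g (var s 7) ≡ v
      read refl g≡ = trans (cong _ at) g≡
      nm≡ : arr s 0 (var s 7) ≡ f
      nm≡ = read (cong EmitFrame.a₀ frame) n≡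
      rk≡ : arr s 1 (var s 7) ≡ ρ f
      rk≡ = read (cong EmitFrame.a₁ frame) r≡
      dg≡ : arr s 2 (var s 7) ≡ δ f
      dg≡ = read (cong EmitFrame.a₂ frame) d≡
      code≡ : var s 10 * var s 2 ≡ wordKey w * β
      code≡ = cong₂ _*_ coded (cong EmitFrame.v₂ frame)
      bound : var s 10 * var s 2 + arr s 2 (var s 7) < V
      bound = subst (_< V) (sym (cong₂ _+_ code≡ dg≡)) (key-step w (just f) w<)

    plain : ∀ f → nm q ≡ f × rk q ≡ ρ f × dg q ≡ δ f → length w < μ → q < e → q ≢ h →
      ∀ {s} → Slicing p J d xs r q e h w s → Loop 1 (Slicing p J d xs r (suc q) e h (w ++ [ just f ])) s
    plain f placed w< q<e q≢h {s} S = iterate (Slicing.guard S)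
      ( (λ _ → (λ _ → (λ _ → plain-wp f placed w< {s₁} S₁) ,
                      (λ q≤h → (λ _ → plain-wp f placed w< {s₁} S₁) ,
                               (λ h≤q → ⊥-elim (q≢h (trans (sym at) (trans (≤-antisym (∸≡0⇒≤ q≤h) (∸≡0⇒≤ h≤q)) hole)))))) ,
               (λ e≤q → ⊥-elim (<⇒≱ q<e (subst₂ _≤_ end at (∸≡0⇒≤ e≤q)))))
      , (λ b → ⊥-elim (1+n≢0 (trans (sym busy) b))))
      where
      open Slicing S
      s₁ : Store
      s₁ = ⟬ ((var s [ 18 ↦ var s 8 ∸ var s 7 ]) [ 18 ↦ var s 7 ∸ var s 9 ]) [ 19 ↦ var s 9 ∸ var s 7 ] , arr s ⟭
      S₁ : Slicing p J d xs r q e h w s₁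
      S₁ = record
        { frame = frame ; pos = pos ; busy = busy ; guard = guard ; jumps = jumps ; count = count ; table = table
        ; base = base ; rules = rules ; coded = coded ; at = at ; end = end ; hole = hole ; rank≡ = rank≡ ; out = out }

    hollow-wp : length w < μ → ∀ {q′} → E q ≡ q′ → ∀ {s} → Slicing p J d xs r q e h w s →
      wp D V In emitHole (wp D V In emitGuard (Reach D V In 16 emitBody 0 (Slicing p J d xs r q′ e h (w ++ [ nothing ])))) s
    hollow-wp w< {q′} E≡ {s} S =
      ≤-<-trans (m≤m+n _ _) bound , bound ,
      (λ _ → reached 0 (record
        { frame = frame ; pos = pos ; busy = busy ; guard = (λ ()) ; jumps = jumps ; count = count ; table = table
        ; base = base
        ; rules = push-token {d = d} {w = w} refl v₂₁ v₂₁ v₂₁ rules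
        ; coded = trans code≡ (sym (wordKey-snoc w nothing))
        ; at = trans (cong₂ (λ g x → g x) (cong EmitFrame.a₃ frame) at) E≡
        ; end = end ; hole = hole ; rank≡ = rank≡ ; out = out })) ,
      (λ b → ⊥-elim (1+n≢0 (trans (sym busy) b)))
      where
      open Slicing S
      v₂₁ : var s 21 ≡ 0
      v₂₁ = cong EmitFrame.v₂₁ frame
      code≡ : var s 10 * var s 2 + var s 3 ≡ wordKey w * β + hd
      code≡ = cong₂ _+_ (cong₂ _*_ coded (cong EmitFrame.v₂ frame)) (cong EmitFrame.v₃ frame)
      bound : var s 10 * var s 2 + var s 3 < V
      bound = subst (_< V) (sym code≡) (key-step w nothing w<)

    hollow : length w < μ → q < e → q ≡ h → ∀ {q′} → E q ≡ q′ →
      ∀ {s} → Slicing p J d xs r q e h w s → Loop 1 (Slicing p J d xs r q′ e h (w ++ [ nothing ]))  s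
    hollow w< q<e q≡h {q′} E≡ {s} S = iterate (Slicing.guard S)
      ( (λ _ → (λ _ → (λ q≰h → ⊥-elim (q≰h (trans (cong₂ _∸_ at hole) (≤⇒∸≡0 (≤-reflexive q≡h))))) ,
                      (λ _ → (λ h≰q → ⊥-elim (h≰q (trans (cong₂ _∸_ hole at) (≤⇒∸≡0 (≤-reflexive (sym q≡h)))))) ,
                             (λ _ → hollow-wp w< E≡ {s₁} S₁))) ,
               (λ e≤q → ⊥-elim (<⇒≱ q<e (subst₂ _≤_ end at (∸≡0⇒≤ e≤q)))))
      , (λ b → ⊥-elim (1+n≢0 (trans (sym busy) b))))
      where
      open Slicing S
      s₁ : Store
      s₁ = ⟬ ((var s [ 18 ↦ var s 8 ∸ var s 7 ]) [ 18 ↦ var s 7 ∸ var s 9 ]) [ 19 ↦ var s 9 ∸ var s 7 ] , arr s ⟭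
      S₁ : Slicing p J d xs r q e h w s₁
      S₁ = record
        { frame = frame ; pos = pos ; busy = busy ; guard = guard ; jumps = jumps ; count = count ; table = table
        ; base = base ; rules = rules ; coded = coded ; at = at ; end = end ; hole = hole ; rank≡ = rank≡ ; out = out }

  plains : ∀ ls {p J d xs r q e h w s} → Placed q ls → length w + length ls ≤ μ → q + length ls ≤ e →
    q + length ls ≤ h ⊎ h < q → Slicing p J d xs r q e h w s →
    Loop (length ls) (Slicing p J d xs r (q + length ls) e h (w ++ map just ls)) s
  plains [] {q = q} {w = w} {s} _ _ _ _ S = reached 0
    (subst₂ (λ q w → Slicing _ _ _ _ _ q _ _ w s) (sym (+-identityʳ q)) (sym (++-identityʳ w)) S)
  plains (f ∷ ls) {p} {J} {d} {xs} {r} {q} {e} {h} {w} {s} (pl , pls) w≤ q≤ away S =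
    reach-trans (plain f pl (≤-trans (≤-trans (s≤s (m≤m+n _ _)) (≤-reflexive (sym (+-suc _ _)))) w≤)
                  (≤-trans (≤-trans (s≤s (m≤m+n _ _)) (≤-reflexive (sym (+-suc _ _)))) q≤) (apart away) S)
      (λ S′ → again (plains ls pls w≤′ (≤-trans (≤-reflexive (sym (+-suc q _))) q≤) (away′ away) S′))
    where
    apart : q + length (f ∷ ls) ≤ h ⊎ h < q → q ≢ h
    apart (inj₁ l) refl = <⇒≱ (m<m+n q (s≤s z≤n)) l
    apart (inj₂ l) refl = <-irrefl refl l
    away′ : q + length (f ∷ ls) ≤ h ⊎ h < q → suc q + length ls ≤ h ⊎ h < suc q
    away′ (inj₁ l) = inj₁ (≤-trans (≤-reflexive (sym (+-suc q _))) l)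
    away′ (inj₂ l) = inj₂ (≤-trans l (n≤1+n q))
    w≤′ : length (w ++ [ just f ]) + length ls ≤ μ
    w≤′ rewrite length-++ w {[ just f ]} | +-assoc (length w) 1 (length ls) = w≤
    again : ∀ {s′} → Loop (length ls) (Slicing p J d xs r (suc q + length ls) e h ((w ++ [ just f ]) ++ map just ls)) s′ →
      Loop (length ls) (Slicing p J d xs r (q + length (f ∷ ls)) e h (w ++ map just (f ∷ ls))) s′
    again rewrite +-suc q (length ls) | ++-assoc w [ just f ] (map just ls) = λ l → l

  rulesOf-snoc : ∀ d x → rulesOf (d ++ [ x ]) ≡ rulesOf d ++ clusterCode x
  rulesOf-snoc d x = trans (concatMap-++ clusterCode d [ x ]) (cong (rulesOf d ++_) (++-identityʳ (clusterCode x)))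

  finish : ∀ {p J d xs e h s} x → Slicing p J d xs (clusterRank x) e e h (clusterWord x) s →
    Loop 1 (Main p J (insert d x) (xs ++ 2 ∷ find (insert d x) (key x) ∷ clusterRank x ∷ [])) s
  finish {p} {J} {d} {xs} {e} {h} {s} x S = iterate (Slicing.guard S)
    ( (λ _ → (λ ne → ⊥-elim (ne (trans (cong₂ _∸_ end at) (n∸n≡0 e)))) ,
             (λ _ →
      (λ z≢0 → (λ b → ⊥-elim (b refl)) , (λ _ → reached 0 (record
        { frame = frame ; pos = pos ; idle = refl ; guard = guard′ ; jumps = jumps
        ; count = trans count (cong length (sym (old z≢0)))
        ; table = λ κ → trans (table κ) (cong (λ d → find d κ) (sym (old z≢0)))
        -- The pattern is known: variable 13 stays, and the draft behind it is dropped.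
        ; rules = subst (λ d → Buffer (arr s 8) (var s 13) (rulesOf d)) (sym (old z≢0))
            (base , proj₁ (stored-++⁻ 0 (rulesOf d) (proj₂ rules)))
        ; out = push₃ two≡ (trans found (cong (λ d → find d (key x)) (sym (old z≢0)))) rank≡ out }))) ,
      (λ z≡0 → (λ b → ⊥-elim (b refl)) , (λ _ → reached 0 (record
        { frame = frame ; pos = pos ; idle = refl ; guard = guard′ ; jumps = jumps
        ; count = trans (cong suc count) (trans (+-comm 1 _) (trans (sym (length-++ d)) (cong length (sym (new z≡0)))))
        ; table = λ κ → trans (table′ κ) (trans (sym (find-snoc d x κ (absent z≡0))) (cong (λ d → find d κ) (sym (new z≡0))))
        ; rules = subst (Buffer (arr s 8) (var s 12))
            (trans (sym (rulesOf-snoc d x)) (cong rulesOf (sym (new z≡0)))) rules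
        ; out = push₃ two≡ (sym (trans (cong (λ d → find d (key x)) (new z≡0)) (trans (find-snoc d x (key x) (absent z≡0))
            (trans (update-same (find d) (key x) _) (cong suc (sym count)))))) rank≡ out })))))
    , (λ b → ⊥-elim (1+n≢0 (trans (sym busy) b))))
    where
    open Slicing S
    guard′ : var s 0 ∸ var s 5 ≡ n ∸ p
    guard′ = cong₂ _∸_ (cong EmitFrame.v₀ frame) pos
    two≡ : var s 23 ≡ 2
    two≡ = cong EmitFrame.v₂₃ frame
    found : arr s 7 (var s 10) ≡ find d (key x)
    found = trans (cong (arr s 7) coded) (table (key x))
    old : arr s 7 (var s 10) ≢ 0 → insert d x ≡ d
    old z≢0 = insert-old d x (λ e → z≢0 (trans found e))
    absent : arr s 7 (var s 10) ≡ 0 → find d (key x) ≡ 0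
    absent z≡0 = trans (sym found) z≡0
    new : arr s 7 (var s 10) ≡ 0 → insert d x ≡ d ++ [ x ]
    new z≡0 = insert-new d x (absent z≡0)
    table′ : ∀ κ → (arr s 7 [ var s 10 ↦ suc (var s 14) ]) κ ≡ (find d [ key x ↦ suc (length d) ]) κ
    table′ κ = trans (cong (λ g → (arr s 7 [ g ↦ suc (var s 14) ]) κ) coded)
      (update-cong (key x) table (cong suc count) κ)

  -- Entries from `e` on belong to enclosing contexts, and those before `e′` have to remain clear
  -- for the visit of the hole. If nothing follows the hole, then `e′` is `e` and no jump is set: it
  -- would lead from `e` to itself, and could replace the jump of an enclosing context.
  record Opened (p : ℕ) (J : ℕ → ℕ) (d : List Cluster) (xs : List ℕ) (e c e′ : ℕ) (s : Store) : Set where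
    field
      {J′}     : ℕ → ℕ
      slicing  : Slicing c J′ d xs 1 p e c [] s
      beyond   : ∀ x → e ≤ x → J′ x ≡ J x
      within   : ∀ x → x < e′ → J′ x ≡ J x
      jumps-to : e′ < e → J′ e′ ≡ e

  root-wp : ∀ {p J d xs f s} → Main p J d xs s → nm p ≡ f → rk p ≡ ρ f →
    wp D V In emitRoot (wp D V In emitGuard (Reach D V In 16 emitBody 0 (Main (suc p) J d (xs ++ 1 ∷ f ∷ ρ f ∷ [])))) s
  root-wp {p} {f = f} {s} M n≡ r≡ =
    (λ b → ⊥-elim (b idle)) , (λ _ → reached 0 (record
      { frame = frame ; pos = cong suc pos ; idle = idle
      ; guard = cong₂ _∸_ (cong EmitFrame.v₀ frame) (cong suc pos) ; jumps = jumps
      ; count = count ; table = table ; rules = rules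
      ; out = push₃ (cong EmitFrame.v₂₂ frame) name≡ rank≡ out }))
    where
    open Main M
    name≡ : arr s 0 (var s 5) ≡ f
    name≡ = trans (cong₂ (λ g x → g x) (cong EmitFrame.a₀ frame) pos) n≡
    rank≡ : arr s 1 (var s 5) ≡ ρ f
    rank≡ = trans (cong₂ (λ g x → g x) (cong EmitFrame.a₁ frame) pos) r≡

  small-wp : ∀ {p J d xs e s} → Main p J d xs s → var s 17 ≡ e →
    wp D V In emitSmall (wp D V In emitGuard (Reach D V In 16 emitBody 0 (Slicing e J d xs 0 p e e []))) s
  small-wp M e≡ =
    (λ _ → reached 0 (record
      { frame = frame ; pos = e≡ ; busy = refl ; guard = (λ ()) ; jumps = jumps
      ; count = count ; table = table ; base = proj₁ rules
      ; rules = push (cong EmitFrame.v₂₁ frame) rules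
      ; coded = refl ; at = pos ; end = e≡ ; hole = e≡
      ; rank≡ = cong EmitFrame.v₂₁ frame ; out = out })) ,
    (λ b → ⊥-elim (1+n≢0 b))
    where open Main M

  jump-wp : ∀ {p J d xs e c e′ s} → Slicing p J d xs 1 p e c [] s → var s 17 ≡ e → var s 19 ≡ c → E c ≡ e′ →
    wp D V In emitJump (wp D V In emitGuard (Reach D V In 16 emitBody 0 (Opened p J d xs e c e′))) s
  jump-wp {J = J} {e = e} {c} {e′} {s} S e≡ c≡ Ec =
    (λ z → (λ _ → reached 0 (record
      { slicing = record
          { frame = frame ; pos = c≡ ; busy = busy ; guard = (λ ()) ; jumps = refl
          ; count = count ; table = table ; base = base ; rules = rules
          ; coded = coded ; at = at ; end = end ; hole = hole ; rank≡ = rank≡ ; out = out }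
      ; beyond = λ x e≤x → trans (off x (λ q → <⇒≱ (e′<e z) (≤-trans e≤x (≤-reflexive q)))) (cong (λ g → g x) jumps)
      ; within = λ x x<e′ → trans (off x (<⇒≢ x<e′)) (cong (λ g → g x) jumps)
      ; jumps-to = λ _ → trans (cong (λ y → (arr s 5 [ y ↦ var s 17 ]) e′) hole-end)
          (trans (update-same (arr s 5) e′ _) e≡) })) ,
           (λ b → ⊥-elim (1+n≢0 (trans (sym busy) b)))) ,
    (λ z → (λ _ → reached 0 (record
      { slicing = record
          { frame = frame ; pos = c≡ ; busy = busy ; guard = (λ ()) ; jumps = jumps
          ; count = count ; table = table ; base = base ; rules = rules
          ; coded = coded ; at = at ; end = end ; hole = hole ; rank≡ = rank≡ ; out = out }
      ; beyond = λ x _ → refl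
      ; within = λ x _ → refl
      ; jumps-to = λ e′<e → ⊥-elim (<⇒≱ e′<e (subst₂ _≤_ e≡ hole-end (∸≡0⇒≤ z))) })) ,
           (λ b → ⊥-elim (1+n≢0 (trans (sym busy) b))))
    where
    open Slicing S
    hole-end : arr s 3 (var s 19) ≡ e′
    hole-end = trans (cong₂ (λ g x → g x) (cong EmitFrame.a₃ frame) c≡) Ec
    e′<e : var s 17 ∸ arr s 3 (var s 19) ≢ 0 → e′ < e
    e′<e z = subst₂ _<_ hole-end e≡ (∸≢0⇒< z)
    off : ∀ x → x ≢ e′ → (arr s 5 [ arr s 3 (var s 19) ↦ var s 17 ]) x ≡ arr s 5 x
    off x x≢ = update-diff (arr s 5) _ _ x (λ q → x≢ (trans q hole-end))

  module _ {p : ℕ} {J : ℕ → ℕ} {d : List Cluster} {xs : List ℕ} {s : Store}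
    (M : Main p J d xs s) (p<n : p < n) where
    open Main M

    main-guard : var s 16 ≢ 0
    main-guard g = <⇒∸≢0 p<n (trans (sym guard) g)

    jump≡ : arr s 5 (var s 5) ≡ J p
    jump≡ = cong₂ (λ g x → g x) jumps pos

    end≡ : arr s 3 (var s 5) ≡ E p
    end≡ = cong₂ (λ g x → g x) (cong EmitFrame.a₃ frame) pos

    large≡ : suc (arr s 3 (var s 5) ∸ var s 5) ∸ var s 4 ≡ suc (E p ∸ p) ∸ μ
    large≡ = cong₂ _∸_ (cong suc (cong₂ _∸_ end≡ pos)) (cong EmitFrame.v₄ frame)

    hole≡ : arr s 4 (var s 5) ≡ C p
    hole≡ = cong₂ (λ g x → g x) (cong EmitFrame.a₄ frame) pos

    large≢0 : μ ≤ E p ∸ p → suc (arr s 3 (var s 5) ∸ var s 5) ∸ var s 4 ≢ 0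
    large≢0 large e = <⇒∸≢0 (s≤s large) (trans (sym large≡) e)

    small≡0 : E p ∸ p < μ → suc (arr s 3 (var s 5) ∸ var s 5) ∸ var s 4 ≡ 0
    small≡0 small< = trans large≡ (≤⇒∸≡0 small<)

    offset≡ : ∀ {c} → C p ≡ c → arr s 4 (var s 5) ∸ var s 5 ≡ c ∸ p
    offset≡ Cp = cong₂ _∸_ (trans hole≡ Cp) pos

    jump : ∀ {e} → J p ≡ e → e ≢ 0 → Loop 1 (Main e J d xs) s
    jump {e} Jp e≢0 = iterate main-guard
      ( (λ b → ⊥-elim (b idle))
      , (λ _ → (λ _ → (λ b → ⊥-elim (b idle)) , (λ _ → reached 0 (record
          { frame = frame ; pos = trans jump≡ Jp ; idle = idle
          ; guard = cong₂ _∸_ (cong EmitFrame.v₀ frame) (trans jump≡ Jp) ; jumps = jumps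
          ; count = count ; table = table ; rules = rules ; out = out }))) ,
               (λ j≡0 → ⊥-elim (e≢0 (trans (sym (trans jump≡ Jp)) j≡0)))))

    tested located : Store
    tested = ⟬ ((((var s [ 18 ↦ arr s 5 (var s 5) ]) [ 17 ↦ arr s 3 (var s 5) ])
      [ 18 ↦ arr s 3 (var s 5) ∸ var s 5 ]) [ 18 ↦ suc (arr s 3 (var s 5) ∸ var s 5) ])
      [ 18 ↦ suc (arr s 3 (var s 5) ∸ var s 5) ∸ var s 4 ] , arr s ⟭
    located = ⟬ (var tested [ 19 ↦ arr s 4 (var s 5) ]) [ 18 ↦ arr s 4 (var s 5) ∸ var s 5 ] , arr s ⟭

    tested-main : Main p J d xs tested
    tested-main = record
      { frame = frame ; pos = pos ; idle = idle ; guard = guard ; jumps = jumps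
      ; count = count ; table = table ; rules = rules ; out = out }

    located-main : Main p J d xs located
    located-main = record
      { frame = frame ; pos = pos ; idle = idle ; guard = guard ; jumps = jumps
      ; count = count ; table = table ; rules = rules ; out = out }

    no-jump : J p ≡ 0 → arr s 5 (var s 5) ≡ 0
    no-jump Jp = trans jump≡ Jp

    root : ∀ {f} → J p ≡ 0 → μ ≤ E p ∸ p → C p ≡ p → nm p ≡ f × rk p ≡ ρ f × dg p ≡ δ f →
      Loop 1 (Main (suc p) J d (xs ++ 1 ∷ f ∷ ρ f ∷ [])) s
    root Jp large Cp (n≡ , r≡ , _) = iterate main-guard
      ( (λ b → ⊥-elim (b idle))
      , (λ _ → (λ j≢0 → ⊥-elim (j≢0 (no-jump Jp))) ,
               (λ _ → (λ _ → (λ ne → ⊥-elim (ne (trans (offset≡ Cp) (n∸n≡0 p)))) ,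
                             (λ _ → root-wp {s = located} located-main n≡ r≡)) ,
                      (λ e → ⊥-elim (large≢0 large e)))))

    openSmall : ∀ {e} → J p ≡ 0 → E p ≡ e → E p ∸ p < μ → Loop 1 (Slicing e J d xs 0 p e e []) s
    openSmall Jp Ep small< = iterate main-guard
      ( (λ b → ⊥-elim (b idle))
      , (λ _ → (λ j≢0 → ⊥-elim (j≢0 (no-jump Jp))) ,
               (λ _ → (λ ne → ⊥-elim (ne (small≡0 small<))) ,
                      (λ _ → small-wp {s = tested} tested-main (trans end≡ Ep)))))

    prepared : Store
    prepared = ⟬ ((((((((var located [ 9 ↦ arr s 4 (var s 5) ]) [ 11 ↦ var s 22 ]) [ 7 ↦ var s 5 ])
      [ 8 ↦ arr s 3 (var s 5) ]) [ 12 ↦ var s 13 ]) [ 12 ↦ suc (var s 13) ]) [ 10 ↦ 0 ]) [ 6 ↦ 1 ])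
      , arr s [ 8 ∙ var s 13 ↦ var s 22 ] ⟭

    openContext : ∀ {e c e′} → J p ≡ 0 → μ ≤ E p ∸ p → E p ≡ e → C p ≡ c → p < c → E c ≡ e′ →
      Loop 1 (Opened p J d xs e c e′) s
    openContext {e} {c} Jp large Ep Cp p<c Ec = iterate main-guard
      ( (λ b → ⊥-elim (b idle))
      , (λ _ → (λ j≢0 → ⊥-elim (j≢0 (no-jump Jp))) ,
               (λ _ → (λ _ → (λ _ → jump-wp {s = prepared} slicing (trans end≡ Ep) (trans hole≡ Cp) Ec) ,
                             (λ z → ⊥-elim (<⇒∸≢0 p<c (trans (sym (offset≡ Cp)) z)))) ,
                      (λ z → ⊥-elim (large≢0 large z)))))
      where
      slicing : Slicing p J d xs 1 p e c [] prepared
      slicing = record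
        { frame = frame ; pos = pos ; busy = refl ; guard = main-guard ; jumps = jumps
        ; count = count ; table = table ; base = proj₁ rules
        ; rules = push (cong EmitFrame.v₂₂ frame) rules
        ; coded = refl ; at = pos ; end = trans end≡ Ep ; hole = trans hole≡ Cp
        ; rank≡ = cong EmitFrame.v₂₂ frame ; out = out }

  module Preorder (Dᶠ : List Cluster) where
    open Parts μ 0<μ
    open Skeleton μ 0<μ key Dᶠ using (code; code*; coreCode)

    -- No jump may lie in a part of the preorder still to be visited, since the scan would take it
    -- and skip nodes.
    Clear : (ℕ → ℕ) → ℕ → ℕ → Set
    Clear J o e = ∀ x → o ≤ x → x < e → J x ≡ 0

    record Emitted (e : ℕ) (J : ℕ → ℕ) (d : List Cluster) (xs : List ℕ) (s : Store) : Set where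
      field
        {J′}   : ℕ → ℕ
        main   : Main e J′ d xs s
        beyond : ∀ x → e ≤ x → J′ x ≡ J x

    emitted : ∀ {e e′ J d d′ xs xs′ s} → e ≡ e′ → d ≡ d′ → xs ≡ xs′ → Emitted e J d xs s → Emitted e′ J d′ xs′ s
    emitted refl refl refl X = X

    -- The program writes the position in the dictionary so far. That dictionary being a prefix of
    -- the final one, it is the final number too.
    finishᶠ : ∀ {p J d xs e h s} x → insert d x ⊑ Dᶠ → Slicing p J d xs (clusterRank x) e e h (clusterWord x) s →
      Loop 1 (Main p J (insert d x) (xs ++ 2 ∷ find Dᶠ (key x) ∷ clusterRank x ∷ [])) s
    finishᶠ {p} {J} {d} {xs} {s = s} x incl S =
      subst (λ i → Loop 1 (Main p J (insert d x) (xs ++ 2 ∷ i ∷ clusterRank x ∷ [])) s)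
        (sym (find-⊑ (key x) incl (find-insert d x))) (finish x S)

    root<n : ∀ {o} t → o + size t ≤ n → o < n
    root<n {o} t le = ≤-trans (m<m+n o (size>0 {ℕ-alphabet ρ} t)) le

    -- Five rounds per node: a context of one node is allotted one round for its token and one each
    -- for opening, hole, finishing and jump. The context is copied as a whole before the scan turns
    -- to its core.
    emit     : ∀ {t} (q : Cut t) o {J d xs s} → Filled E C q o → Placed o (labels t) → o + size t ≤ n →
      Clear J o (o + size t) → collect d (parts q) ⊑ Dᶠ → Main o J d xs s →
      Loop (5 * size t) (Emitted (o + size t) J (collect d (parts q)) (xs ++ code q)) s
    emit*    : ∀ {k} {ts : Vec Term k} (qs : Cut* ts) o {J d xs s} → Filled* E C qs o → Placed o (labels* ts) →
      o + size* ts ≤ n → Clear J o (o + size* ts) → collect d (parts* qs) ⊑ Dᶠ → Main o J d xs s →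
      Loop (5 * size* ts) (Emitted (o + size* ts) J (collect d (parts* qs)) (xs ++ code* qs)) s
    emitCore : ∀ {u} (κ : Core u) o {J d xs s} → FilledCore E C κ o → Placed o (labels u) → o + size u ≤ n →
      Clear J o (o + size u) → collect d (coreParts κ) ⊑ Dᶠ → Main o J d xs s →
      Loop (5 * size u) (Emitted (o + size u) J (collect d (coreParts κ)) (xs ++ coreCode κ)) s

    emit (small {t} t<) o {J} {d} {xs} E≡ placed fits clear incl M = reach-weaken steps
      (reach-trans (openSmall M (root<n t fits) (clear o ≤-refl (m<m+n o (size>0 {ℕ-alphabet ρ} t))) E≡ short)
        (λ S → reach-trans (plains (labels t) placed (<⇒≤ t<) ≤-refl (inj₁ ≤-refl) S)
          (λ {s′} S′ → reach-weaken ≤-refl (reach-trans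
            (finishᶠ (closed t) incl (subst (λ w → Slicing (o + size t) J d xs 0 (o + size t) (o + size t) (o + size t) w s′)
              (sym (clusterWord-closed t)) S′))
            (λ M′ → reached 0 (record { main = M′ ; beyond = λ _ _ → refl }))))))
      where
      short : E o ∸ o < μ
      short = subst (_< μ) (sym (trans (cong (_∸ o) E≡) (m+n∸m≡n o (size t)))) t<
      steps : 1 + (size t + 1) ≤ 5 * size t
      steps = go (size t) (size>0 {ℕ-alphabet ρ} t)
        where
        go : ∀ m → 0 < m → 1 + (m + 1) ≤ 5 * m
        go (suc m) _ = ≤-trans (m≤m+n _ (4 * m + 2)) (≤-reflexive (arith m))
          where
          arith : ∀ m → 1 + (suc m + 1) + (4 * m + 2) ≡ 5 * suc m
          arith = solve-∀
    emit (big □ {u} c< κ t≥) o {J} {d} {xs} {s} (_ , _ , filled) placed fits clear incl M =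
      emitCore κ o (subst (FilledCore E C κ) (+-identityʳ o) filled) placed fits clear incl M
    emit (big c@(node f cs) {u} c< κ t≥) o {J} {d} {xs} {s} (E≡ , C≡ , filled) placed fits clear incl M =
      reach-weaken steps
      (reach-trans
        (openContext M (root<n (plug c u) fits) (clear o ≤-refl (m<m+n o (size>0 {ℕ-alphabet ρ} (plug c u)))) large E≡ C≡
          (m<m+n o (s≤s z≤n)) E-hole)
        (λ X → let module X = Opened X in
          reach-trans (plains (before c) placed-before len₁ o′≤e (inj₁ ≤-refl) X.slicing)
          (λ S₁ → reach-trans (hollow len₁′ o′<e refl E-hole S₁)
            (λ S₂ → reach-trans (plains (after c) placed-after len₂ (≤-reflexive (sym e≡)) (inj₂ o′<e′) S₂)
              (λ {s₃} S₃ → reach-trans (finishᶠ (opened c) sub₁ (repack S₃))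
                (λ M₁ → reach-trans
                  (emitCore κ o′ filled placed-core o′+u≤n
                    (λ x o′≤x x<e′ → trans (X.within x x<e′)
                      (clear x (≤-trans (m≤m+n o b) o′≤x) (≤-trans x<e′ e′≤e))) incl M₁)
                  (λ Y → let module Y = Emitted Y in
                    leave (X.jumps-to) (X.beyond) Y)))))))
      where
      b = length (before c)
      a = length (after c)
      o′ = o + b
      e′ = o′ + size u
      e = o + size (plug c u)
      x = opened c
      e≡ : e ≡ e′ + a
      e≡ = trans (cong (o +_) (size-plug c u)) (arith o b a (size u))
        where
        arith : ∀ o b a u → o + (b + a + u) ≡ o + b + u + a
        arith = solve-∀
      e′≤e : e′ ≤ e
      e′≤e = ≤-trans (m≤m+n e′ a) (≤-reflexive (sym e≡))
      o′<e′ : o′ < e′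
      o′<e′ = m<m+n o′ (size>0 {ℕ-alphabet ρ} u)
      o′<e : o′ < e
      o′<e = ≤-trans o′<e′ e′≤e
      o′≤e : o + b ≤ e
      o′≤e = <⇒≤ o′<e
      o′+u≤n : e′ ≤ n
      o′+u≤n = ≤-trans e′≤e fits
      len₁ : 0 + b ≤ μ
      len₁ = ≤-trans (m≤m+n b a) (<⇒≤ c<)
      len₁′ : length (map {B = Maybe ℕ} just (before c)) < μ
      len₁′ = ≤-<-trans (≤-trans (≤-reflexive (length-map just (before c))) (m≤m+n b a)) c<
      len₂ : length (([] ++ map just (before c)) ++ [ nothing ]) + a ≤ μ
      len₂ = ≤-trans (≤-reflexive (trans (cong (_+ a) (trans (length-++ (map just (before c)))
        (cong (_+ 1) (length-map just (before c))))) (arith b a))) c<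
        where
        arith : ∀ b a → b + 1 + a ≡ suc (b + a)
        arith = solve-∀
      large : μ ≤ E o ∸ o
      large = subst (μ ≤_) (sym (trans (cong (_∸ o) E≡) (m+n∸m≡n o (size (plug c u))))) t≥
      E-hole : E o′ ≡ e′
      E-hole = filledCore-end E C κ filled
      placed′ = placed-++ o (before c) (subst (Placed o) (labels-plug c u) placed)
      placed-before = proj₁ placed′
      placed″ = placed-++ o′ (labels u) (proj₂ placed′)
      placed-core = proj₁ placed″
      placed-after = proj₂ placed″
      sub₁ : insert d x ⊑ Dᶠ
      sub₁ = ⊑-trans (collect-⊑ (insert d x) (coreParts κ)) incl
      repack : ∀ {J′ s₃} → Slicing o′ J′ d xs 1 (e′ + a) e o′ ((map just (before c) ++ [ nothing ]) ++ map just (after c)) s₃ →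
        Slicing o′ J′ d xs 1 e e o′ (clusterWord x) s₃
      repack {J′} {s₃} S = subst₂ (λ q w → Slicing o′ J′ d xs 1 q e o′ w s₃) (sym e≡)
        (trans (++-assoc (map just (before c)) _ _) (sym (word-pattern c))) S
      leave : ∀ {J′ s₅} → (e′ < e → J′ e′ ≡ e) → (∀ x → e ≤ x → J′ x ≡ J x) →
        Emitted e′ J′ (collect (insert d x) (coreParts κ)) ((xs ++ 2 ∷ find Dᶠ (key x) ∷ 1 ∷ []) ++ coreCode κ) s₅ →
        Loop 1 (Emitted e J (collect (insert d x) (coreParts κ)) (xs ++ 2 ∷ find Dᶠ (key x) ∷ 1 ∷ coreCode κ)) s₅
      leave {J′} jumps-to beyond Y with e′ ≟ e
      -- Nothing follows the hole, so the scan is already at the end and the round set aside for a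
      -- jump is not spent.
      ... | yes e′≡e = reached 1 (emitted e′≡e refl (++-assoc xs _ _)
              (record { main = Y.main ; beyond = λ x le → trans (Y.beyond x le) (beyond x (subst (_≤ x) e′≡e le)) }))
        where module Y = Emitted Y
      ... | no e′≢e = reach-trans (jump Y.main (≤-trans e′<e fits) (trans (Y.beyond e′ ≤-refl) (jumps-to e′<e)) (0<⇒≢0 (≤-trans (s≤s z≤n) e′<e)))
              (λ M → reached 0 (emitted refl refl (++-assoc xs _ _)
                (record { main = M ; beyond = λ x le → trans (Y.beyond x (≤-trans e′≤e le)) (beyond x le) })))
        where
        module Y = Emitted Y
        e′<e = ≤∧≢⇒< e′≤e e′≢e
      steps : 1 + (b + (1 + (a + (1 + (5 * size u + 1))))) ≤ 5 * size (plug c u)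
      steps = ≤-trans (m≤m+n _ (4 * length (before* cs) + 4 * a)) (≤-reflexive (trans (arith (length (before* cs)) a (size u))
        (cong (5 *_) (sym (size-plug c u)))))
        where
        arith : ∀ b a u → 1 + (suc b + (1 + (a + (1 + (5 * u + 1))))) + (4 * b + 4 * a) ≡ 5 * (suc b + a + u)
        arith = solve-∀
    emit* [] o {xs = xs} _ _ _ _ _ M = reached 0
      (emitted (sym (+-identityʳ o)) refl (sym (++-identityʳ xs)) (record { main = M ; beyond = λ _ _ → refl }))
    emit* (_∷_ {t = t} {ts} q qs) o {J} {d} {xs} (filled , filleds) placed fits clear incl M =
      reach-weaken (≤-reflexive (trans (sym (*-distribˡ-+ 5 (size t) _)) (cong (5 *_) (sym (length-++ (labels t))))))
      (reach-trans
        (emit q o filled (proj₁ placed′) (≤-trans first fits)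
          (λ x l r → clear x l (≤-trans r first)) (⊑-trans (collect-⊑ _ (parts* qs)) sub′) M)
        (λ X → let module X = Emitted X in
          reach-weaken (≤-reflexive (+-identityʳ (5 * size* ts))) (reach-trans
          (emit* qs (o + size t) filleds (proj₂ placed′) (≤-trans (≤-reflexive assoc) fits)
            (λ x l r → trans (X.beyond x l) (clear x (≤-trans (m≤m+n o _) l) (≤-trans r (≤-reflexive assoc)))) sub′ X.main)
          (λ Y → let module Y = Emitted Y in reached 0
            (emitted assoc (sym (collect-++ d (parts q) (parts* qs))) (++-assoc xs _ _)
              (record { main = Y.main ; beyond = λ x le → trans (Y.beyond x le)
                (X.beyond x (≤-trans (m≤m+n _ _) le)) }))))))
      where
      assoc : o + size t + size* ts ≡ o + length (labels t ++ labels* ts)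
      assoc = trans (+-assoc o _ _) (cong (o +_) (sym (length-++ (labels t))))
      first : o + size t ≤ o + length (labels t ++ labels* ts)
      first = ≤-trans (m≤m+n _ _) (≤-reflexive assoc)
      placed′ = placed-++ o (labels t) placed
      sub′ : collect (collect d (parts q)) (parts* qs) ⊑ Dᶠ
      sub′ = subst (_⊑ Dᶠ) (collect-++ d (parts q) (parts* qs)) incl
    emitCore (core f {ts} qs _ t≥) o {J} {d} {xs} (E≡ , C≡ , filleds) (pl , placed) fits clear incl M =
      reach-weaken (≤-trans (m≤m+n _ 4) (≤-reflexive (arith (size* ts)))) (reach-trans
        (root M (≤-trans (m<m+n o (s≤s z≤n)) fits) (clear o ≤-refl (m<m+n o (s≤s z≤n)))
          (subst (μ ≤_) (sym (trans (cong (_∸ o) E≡) (m+n∸m≡n o _))) t≥) C≡ pl)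
        (λ M′ → reach-weaken (≤-reflexive (+-identityʳ (5 * size* ts))) (reach-trans
          (emit* qs (suc o) filleds placed (≤-trans (≤-reflexive (sym (+-suc o _))) fits)
            (λ x l r → clear x (<⇒≤ l) (≤-trans r (≤-reflexive (sym (+-suc o _))))) incl M′)
          (λ Y → reached 0 (emitted (sym (+-suc o _)) refl (++-assoc xs _ _) Y)))))
      where
      arith : ∀ m → 1 + 5 * m + 4 ≡ 5 * suc m
      arith = solve-∀

-- Joining the rules to the start rule and moving the output.

appendInit appendBody : Code
-- The number of nonterminals is known only now. It replaces the first of three zeros at the head of
-- the output, variable 21 being 0. The other two are the start symbol and its rank.
appendInit = mov 5 14 ⍮ inc 5 ⍮ put 9 21 5 ⍮ mov 5 13 ⍮ lit 6 0
appendBody = fetch 7 8 6 ⍮ put 9 15 7 ⍮ inc 15 ⍮ inc 6 ⍮ dec 5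

module Appending (D V : ℕ) (In : ℕ → ℕ) where

  record Append (xs ys : List ℕ) (s : Store) : Set where
    field
      remaining : var s 5 ≡ length ys
      source    : StoredAt (arr s 8) (var s 6) ys
      target    : Buffer (arr s 9) (var s 15) xs

  append : ∀ ys {xs s} → Append xs ys s →
    Reach D V In 5 appendBody (length ys) (λ s′ → var s′ 5 ≡ 0 × Buffer (arr s′ 9) (var s′ 15) (xs ++ ys)) s
  append [] {xs} {s} A = reached 0 (remaining , subst (Buffer (arr s 9) (var s 15)) (sym (++-identityʳ xs)) target)
    where open Append A
  append (y ∷ ys) {xs} {s} A = iterate (λ e → 1+n≢0 (trans (sym remaining) e))
    (subst (λ zs → Reach D V In 5 appendBody (length ys) (λ s′ → var s′ 5 ≡ 0 × Buffer (arr s′ 9) (var s′ 15) zs) _)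
      (++-assoc xs [ y ] ys)
      (append ys (record
        { remaining = cong (_∸ 1) remaining
        ; source = proj₂ source
        ; target = push (proj₁ source) target })))
    where open Append A

-- In place: reading runs ahead of writing, since cell i of an array lies above
-- address i.
copyBody copyOut : Program
copyBody = address′ ⨾ load 0 0 ⨾ store 1 0 ⨾ set 0 1 ⨾ calc 1 add 0 1 ⨾ calc 19 sub 19 0
  where
  address′ : Program
  address′ = set 0 16 ⨾ calc 0 mul 0 1 ⨾ set 2 9 ⨾ calc 0 add 0 2 ⨾ calc 0 add 3 0
copyOut = set 1 0 ⨾ (whileNonzero 19 loop copyBody) ⨾ set 0 0

module Copying (w D B : ℕ) (0<D : 0 < D) (16<2^w : 16 < 2 ^ w) (cell<2^w : ∀ i → i ≤ B → cell D 9 i < 2 ^ w) where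

  -- The output has to be contiguous, whereas cells of an array are 16 apart. Register 19 is
  -- variable 15, the length of the output.
  record Copy (i : ℕ) (xs ys : List ℕ) (S : State) : Set where
    field
      counter : reg S 1 ≡ i
      base    : reg S 3 ≡ D
      left    : reg S 19 ≡ length ys
      done    : i ≡ length xs
      written : StoredAt (mem S) 0 xs
      unread  : StoredAt (λ j → mem S (cell D 9 j)) i ys
      words   : All (_< 2 ^ w) ys
      bounded : i + length ys ≤ B

  copy : ∀ ys {i xs S} → Copy i xs ys S →
    ∃[ S′ ] (w ⊢ S ─[ whileNonzero 19 loop copyBody ]→ S′ ∥ (1 + 11 * length ys)) × StoredAt (mem S′) 0 (xs ++ ys)
  copy [] {i} {xs} {S} A = S , while-zero left , subst (StoredAt (mem S) 0) (sym (++-identityʳ xs)) written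
    where open Copy A
  copy (y ∷ ys) {i} {xs} {S} A with copy ys {suc i} {xs ++ [ y ]} (record
      { counter = cong suc counter ; base = base ; left = cong (_∸ 1) left
      ; done = trans (cong suc done) (trans (+-comm 1 _) (sym (length-++ xs)))
      ; written = stored-++⁺ 0 xs
          (stored-cong 0 xs (λ x _ x< → update-diff (mem S) _ _ x
            (λ e → <⇒≢ x< (trans e (trans counter done)))) written)
          (trans (cong (λ a → (mem S [ reg S 1 ↦ mem S now ]) a) (sym (trans counter done)))
            (trans (update-same (mem S) (reg S 1) _) now≡) , tt)
      ; unread = stored-cong (suc i) ys (λ x i<x _ → update-diff (mem S) _ _ (cell D 9 x)
            (λ e → <⇒≢ (<-≤-trans i<x (above x)) (trans (sym counter) (sym e)))) (proj₂ unread)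
      ; words = All.tail words
      ; bounded = ≤-trans (≤-reflexive (sym (+-suc i _))) bounded })
    where
    open Copy A
    now : ℕ
    now = reg S 3 + (16 * reg S 1 + 9)
    now≡ : mem S now ≡ y
    now≡ = trans (cong₂ (λ d c → mem S (d + (16 * c + 9))) base counter) (proj₁ unread)
    above : ∀ x → x ≤ cell D 9 x
    above x = ≤-trans (≤-trans (m≤n*m x 16) (m≤m+n _ 9)) (m≤n+m _ D)
  ... | S′ , run , stored = S′ , subst (w ⊢ S ─[ whileNonzero 19 loop copyBody ]→ S′ ∥_) time
        (while-nonzero (λ e → 1+n≢0 (trans (sym left) e))
          (seq (seq (set 16<2^w) (seq (calc row<) (seq (set 9<) (seq (calc row′<) (calc all<)))))
            (seq (load (subst (_< 2 ^ w) (sym now≡) (All.head words)))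
              (seq store (seq (set 1<) (seq (calc next<) (calc left<)))))) run) ,
        subst (StoredAt (mem S′) 0) (++-assoc xs [ y ] ys) stored
    where
    open Copy A
    now : ℕ
    now = reg S 3 + (16 * reg S 1 + 9)
    now≡ : mem S now ≡ y
    now≡ = trans (cong₂ (λ d c → mem S (d + (16 * c + 9))) base counter) (proj₁ unread)
    i<B : suc i ≤ B
    i<B = ≤-trans (≤-trans (s≤s (m≤m+n i _)) (≤-reflexive (sym (+-suc i _)))) bounded
    all< : now < 2 ^ w
    all< = subst₂ (λ d c → d + (16 * c + 9) < 2 ^ w) (sym base) (sym counter) (cell<2^w i (≤-trans (n≤1+n i) i<B))
    row′< : 16 * reg S 1 + 9 < 2 ^ w
    row′< = ≤-<-trans (m≤n+m _ (reg S 3)) all<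
    row< : 16 * reg S 1 < 2 ^ w
    row< = ≤-<-trans (m≤m+n _ 9) row′<
    9< : 9 < 2 ^ w
    9< = ≤-<-trans (≤-trans (n≤1+n 9) (m≤m+n 10 6)) 16<2^w
    1< : 1 < 2 ^ w
    1< = ≤-<-trans (m≤m+n 1 15) 16<2^w
    next< : suc (reg S 1) < 2 ^ w
    next< = ≤-<-trans (subst (λ c → suc c ≤ cell D 9 (suc c)) (sym counter) (≤-trans (≤-trans (m≤n*m (suc i) 16) (m≤m+n _ 9)) (m≤n+m _ D)))
      (subst (λ c → cell D 9 (suc c) < 2 ^ w) (sym counter) (cell<2^w (suc i) i<B))
    left< : reg S 19 ∸ 1 < 2 ^ w
    left< = subst (λ l → l ∸ 1 < 2 ^ w) (sym left) (≤-<-trans (≤-trans (m≤n+m _ i) (≤-trans (+-monoʳ-≤ i (n≤1+n _)) bounded))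
      (≤-<-trans (≤-trans (m≤n*m B 16) (≤-trans (m≤m+n _ 9) (m≤n+m _ D))) (cell<2^w B ≤-refl)))
    time : 1 + 10 + (1 + 11 * length ys) ≡ 1 + 11 * length (y ∷ ys)
    time = arith (length ys)
      where
      arith : ∀ l → 1 + 10 + (1 + 11 * l) ≡ 1 + 11 * suc l
      arith = solve-∀

  copyOut-run : ∀ {S} xs → reg S 3 ≡ D → reg S 19 ≡ length xs → StoredAt (λ j → mem S (cell D 9 j)) 0 xs →
    All (_< 2 ^ w) xs → length xs ≤ B →
    ∃[ S′ ] (w ⊢ S ─[ copyOut ]→ S′ ∥ (3 + 11 * length xs)) × Outputs S′ xs
  copyOut-run {S} xs base len stored words bound with copy xs {0} {[]} {⟨ reg S [ 1 ↦ 0 ] , mem S ⟩} (record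
    { counter = refl ; base = base ; left = len ; done = refl ; written = tt ; unread = stored
    ; words = words ; bounded = bound })
  ... | S′ , run , out = ⟨ reg S′ [ 0 ↦ 0 ] , mem S′ ⟩ ,
    subst (w ⊢ S ─[ copyOut ]→ ⟨ reg S′ [ 0 ↦ 0 ] , mem S′ ⟩ ∥_) (cong (2 +_) (+-comm (11 * length xs) 1)) (seq (set 0<) (seq run (set 0<))) , out
    where
    0< : 0 < 2 ^ w
    0< = ≤-<-trans z≤n 16<2^w

-- The initial memory, and the program as a sequence of stages.

memoryOf-stored : ∀ xs → StoredAt (memoryOf xs) 0 xs
memoryOf-stored xs = go xs 0 (λ i → refl)
  where
  go : ∀ {M : ℕ → ℕ} xs a → (∀ i → M (a + i) ≡ memoryOf xs i) → StoredAt M a xs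
  go []           a e = tt
  go {M} (x ∷ xs) a e = trans (cong M (sym (+-identityʳ a))) (e 0) ,
    go xs (suc a) (λ i → trans (cong M (sym (+-suc a i))) (e (suc i)))

memoryOf-< : ∀ {V} xs → 0 < V → All (_< V) xs → ∀ i → memoryOf xs i < V
memoryOf-< []       0<V ps       i       = 0<V
memoryOf-< (x ∷ xs) 0<V (p ∷ ps) zero    = p
memoryOf-< (x ∷ xs) 0<V (p ∷ ps) (suc i) = memoryOf-< xs 0<V ps i

memoryOf-beyond : ∀ xs i → length xs ≤ i → memoryOf xs i ≡ 0
memoryOf-beyond []       i       le       = refl
memoryOf-beyond (x ∷ xs) (suc i) (s≤s le) = memoryOf-beyond xs i le

stage : Code → ℕ → Code → Program
stage init g body = compile init ⨾ (whileNonzero (4 + g) loop compile body)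

stageCost : Code → Code → ℕ → ℕ
stageCost init body N = cost init + suc (N * suc (cost body))

-- Bounds are written n * k rather than k * n, which would unfold for literal k.
module Stages (n : ℕ) (1≤n : 1 ≤ n) (w D V A : ℕ) (In : ℕ → ℕ)
  (In<V : ∀ i → i < D → In i < V) (16≤V : 16 ≤ V) (fits : D + (16 * (V + n * A) + 16) ≤ 2 ^ w) where
  open Simulation w D V (n * A) In In<V 16≤V fits

  represents-≤ : ∀ {t t′ S s} → t ≤ t′ → Represents t S s → Represents t′ S s
  represents-≤ {t} {S = S} {s} le R =
    subst (λ t → Represents t S s) (m+[n∸m]≡n le) (represents-later R)

  linear : ∀ c N b → c + suc (N * n * b) ≤ n * (c + suc (N * b))
  linear c N b = begin
    c + suc (N * n * b)             ≤⟨ +-mono-≤ (m≤n*m c n {{>-nonZero 1≤n}}) (+-monoˡ-≤ _ 1≤n) ⟩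
    n * c + (n + N * n * b)         ≡⟨ arith n c N b ⟩
    n * (c + suc (N * b))           ∎
    where
    open ≤-Reasoning
    arith : ∀ n c N b → n * c + (n + N * n * b) ≡ n * (c + suc (N * b))
    arith = solve-∀

  within : ∀ c N b {a} → a + (c + suc (N * b)) ≤ A → n * a + (c + suc (N * n * b)) ≤ n * A
  within c N b {a} le = ≤-trans (+-monoʳ-≤ (n * a) (linear c N b))
    (≤-trans (≤-reflexive (sym (*-distribˡ-+ n a _))) (*-monoʳ-≤ n le))

  record Ran (P : Program) (a k : ℕ) (S : State) (Ψ : Store → Set) : Set where
    field
      {S′}  : State
      {took} : ℕ
      {s′}  : Store
      run   : w ⊢ S ─[ P ]→ S′ ∥ took
      time  : took ≤ n * k
      repr  : Represents (n * (a + k)) S′ s′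
      holds : Ψ s′

  abstract
    run-stage : ∀ init g body N {a Φ Ψ S s} → SmallConstants init → SmallConstants body →
      a + stageCost init body N ≤ A → Represents (n * a) S s → wp D V In init Φ s →
      (∀ {s′} → Φ s′ → Reach D V In g body (N * n) (λ s″ → var s″ g ≡ 0 × Ψ s″) s′) →
      Ran (stage init g body) a (stageCost init body N) S Ψ
    run-stage init g body N {a} {Φ} {Ψ} {S} ok₁ ok₂ le R p f
      with simulate init {Φ = Φ} ok₁ (≤-trans (m≤m+n _ _) (≤-trans (≤-reflexive (+-assoc (n * a) _ _)) (within (cost init) N (suc (cost body)) le))) R p
    ... | S₁ , T₁ , s₁ , run₁ , T₁≤ , R₁ , q
      with simulate-loop g body (N * n) {Φ = Ψ} ok₂ (≤-trans (≤-reflexive (+-assoc (n * a) _ _)) (within (cost init) N (suc (cost body)) le)) R₁ (f q)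
    ... | S₂ , T₂ , s₂ , run₂ , T₂≤ , R₂ , r = record
      { run = seq run₁ run₂
      ; time = ≤-trans (+-mono-≤ T₁≤ T₂≤) (linear (cost init) N (suc (cost body)))
      ; repr = represents-≤ (≤-trans (≤-reflexive (+-assoc (n * a) _ _))
          (≤-trans (+-monoʳ-≤ (n * a) (linear (cost init) N (suc (cost body)))) (≤-reflexive (sym (*-distribˡ-+ n a _))))) R₂
      ; holds = r }

-- Register 4, which is variable 0, receives `n` from address 0. Register 3 receives `3 * n + 1`,
-- the length of the input, where the arrays begin.
prelude : Program
prelude = set 0 0 ⨾ load 4 0 ⨾ set 1 3 ⨾ calc 3 mul 1 4 ⨾ set 1 1 ⨾ calc 3 add 1 3

-- Variables 21, 22 and 23 hold 0, 1 and 2, the kinds of nodes in the encoding, because `put` takes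
-- its value from a variable. The three zeros reserve the head of the output.
emitInit : Code
emitInit =
  lit 5 0 ⍮ lit 6 0 ⍮ lit 13 0 ⍮ lit 14 0 ⍮ lit 21 0 ⍮ lit 22 1 ⍮ lit 23 2 ⍮ lit 15 0 ⍮
  put 9 15 21 ⍮ inc 15 ⍮ put 9 15 21 ⍮ inc 15 ⍮ put 9 15 21 ⍮ inc 15 ⍮ minus 16 0 5

scanStage thresholdStage fillStage emitStage appendStage compressor : Program
scanStage      = stage scanInit 7 scanBody
thresholdStage = stage thresholdInit 7 thresholdBody
fillStage      = stage fillInit 5 fillBody
emitStage      = stage emitInit 16 emitBody
appendStage    = stage appendInit 5 appendBody
compressor     = prelude ⨾ scanStage ⨾ thresholdStage ⨾ fillStage ⨾ emitStage ⨾ appendStage ⨾ copyOut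

-- Bounds on ranks, clusters and encodings.

module _ {Σ : RankedAlphabet} where

  labels-weaken  : ∀ {n} (t : Tree Σ 0) → labels (weaken {n = n} t) ≡ labels t
  labels-weaken* : ∀ {n k} (ts : Vec (Tree Σ 0) k) → labels* (weaken* {n = n} ts) ≡ labels* ts
  labels-weaken (node f ts) = cong (f ∷_) (labels-weaken* ts)
  labels-weaken* []         = refl
  labels-weaken* (t ∷ ts)   = cong₂ _++_ (labels-weaken t) (labels-weaken* ts)

  labels-pattern  : (c : Ctx {Σ}) → labels (pattern₁ c) ≡ before c ++ after c
  labels-pattern* : ∀ {k} (cs : Ctx* {Σ} k) → labels* (pattern₁* cs) ≡ before* cs ++ after* cs
  labels-pattern □           = refl
  labels-pattern (node f cs) = cong (f ∷_) (labels-pattern* cs)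
  labels-pattern* (here c ts)  = trans (cong₂ _++_ (labels-pattern c) (labels-weaken* ts)) (++-assoc (before c) _ _)
  labels-pattern* (there t cs) = trans (cong₂ _++_ (labels-weaken t) (labels-pattern* cs)) (sym (++-assoc (labels t) _ _))

  -- Every child has a node of its own. This bounds the ranks among the words of the input by `n`.
  ranks-small  : (t : Tree Σ 0) → All (λ f → rank Σ f < size t) (labels t)
  ranks-small* : ∀ {k} (ts : Vec (Tree Σ 0) k) → All (λ f → rank Σ f < size* ts) (labels* ts) × k ≤ size* ts
  ranks-small (node f ts) =
    let ps , k≤ = ranks-small* ts in s≤s k≤ ∷ All.map (λ l → ≤-trans l (n≤1+n _)) ps
  ranks-small* []                 = [] , z≤n
  ranks-small* (t ∷ ts) =
    let ps , k≤ = ranks-small* ts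
        split = length-++ (labels t) {labels* ts}
    in subst (λ m → All (λ f → rank Σ f < m) (labels t ++ labels* ts)) (sym split)
         (++⁺ (All.map (λ l → ≤-trans l (m≤m+n _ _)) (ranks-small t))
              (All.map (λ l → ≤-trans l (m≤n+m _ _)) ps)) ,
       ≤-trans (+-mono-≤ (size>0 t) k≤) (≤-reflexive (sym split))

module PartFacts (ρ : ℕ → ℕ) (μ : ℕ) (0<μ : 0 < μ) where
  open Cutting {ℕ-alphabet ρ} μ 0<μ
  open Clusters ρ
  open Parts μ 0<μ

  module _ {P : ℕ → Set} where

    all-just : ∀ {ls} → All P ls → All (OfToken P) (map just ls)
    all-just []       = []
    all-just (p ∷ ps) = p ∷ all-just ps

    parts-all     : ∀ {t} (q : Cut t) → All P (labels t) → All (λ x → All (OfToken P) (clusterWord x)) (parts q)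
    parts-all*    : ∀ {k} {ts : Vec Term k} (qs : Cut* ts) → All P (labels* ts) →
      All (λ x → All (OfToken P) (clusterWord x)) (parts* qs)
    coreParts-all : ∀ {u} (κ : Core u) → All P (labels u) → All (λ x → All (OfToken P) (clusterWord x)) (coreParts κ)
    parts-all (small {t} _) ps = subst (All (OfToken P)) (sym (clusterWord-closed t)) (all-just ps) ∷ []
    parts-all (big □ _ κ _) ps = coreParts-all κ ps
    parts-all (big c@(node _ _) {u} _ κ _) ps =
      subst (All (OfToken P)) (sym (word-pattern c))
        (++⁺ (all-just (++⁻ˡ (before c) ps′)) (tt ∷ all-just (++⁻ʳ (labels u) (++⁻ʳ (before c) ps′)))) ∷
      coreParts-all κ (++⁻ˡ (labels u) (++⁻ʳ (before c) ps′))
      where ps′ = subst (All P) (labels-plug c u) ps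
    parts-all* []                 ps = []
    parts-all* (_∷_ {t = t} q qs) ps = ++⁺ (parts-all q (++⁻ˡ (labels t) ps)) (parts-all* qs (++⁻ʳ (labels t) ps))
    coreParts-all (core f qs _ _) (_ ∷ ps) = parts-all* qs ps

  Short : Cluster → Set
  Short x = clusterSize x < μ × length (clusterWord x) ≤ μ

  parts-short     : ∀ {t} (q : Cut t) → All Short (parts q)
  parts-short*    : ∀ {k} {ts : Vec Term k} (qs : Cut* ts) → All Short (parts* qs)
  coreParts-short : ∀ {u} (κ : Core u) → All Short (coreParts κ)
  parts-short (small {t} t<) = (t< , ≤-trans (≤-reflexive (trans (cong length (clusterWord-closed t)) (length-map just (labels t)))) (<⇒≤ t<)) ∷ []
  parts-short (big □ _ κ _) = coreParts-short κ
  parts-short (big c@(node _ _) c< κ _) =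
    (subst (_< μ) (sym (trans (cong length (labels-pattern c)) (length-++ (before c)))) c< ,
     ≤-trans (≤-reflexive (trans (cong length (word-pattern c)) (trans (length-++ (map just (before c)))
       (trans (cong₂ (λ a b → a + suc b) (length-map just (before c)) (length-map just (after c))) (+-suc (length (before c)) (length (after c))))))) c<) ∷
    coreParts-short κ
  parts-short* []       = []
  parts-short* (q ∷ qs) = ++⁺ (parts-short q) (parts-short* qs)
  coreParts-short (core f qs _ _) = parts-short* qs

  length-tokens : ∀ w → length (concatMap token w) ≡ 3 * length w
  length-tokens []            = refl
  length-tokens (nothing ∷ w) = trans (cong (3 +_) (length-tokens w)) (sym (*-suc 3 (length w)))
  length-tokens (just f ∷ w)  = trans (cong (3 +_) (length-tokens w)) (sym (*-suc 3 (length w)))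

  rulesLength : List Cluster → ℕ
  rulesLength xs = length (concatMap clusterCode xs)

  -- A context of one node is the worst case: a word for its rank, and three each for the node and
  -- the hole.
  parts-rules     : ∀ {t} (q : Cut t) → rulesLength (parts q) ≤ 7 * size t
  parts-rules*    : ∀ {k} {ts : Vec Term k} (qs : Cut* ts) → rulesLength (parts* qs) ≤ 7 * size* ts
  coreParts-rules : ∀ {u} (κ : Core u) → rulesLength (coreParts κ) ≤ 7 * size u
  parts-rules (small {t} _) = begin
    length (clusterCode (closed t) ++ [])  ≡⟨ cong length (++-identityʳ (clusterCode (closed t))) ⟩
    suc (length (concatMap token (clusterWord (closed t))))  ≡⟨ cong suc (length-tokens (clusterWord (closed t))) ⟩
    suc (3 * length (clusterWord (closed t)))
      ≡⟨ cong (λ l → suc (3 * l)) (trans (cong length (clusterWord-closed t)) (length-map just (labels t))) ⟩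
    1 + 3 * size t         ≤⟨ +-monoˡ-≤ (3 * size t) (size>0 t) ⟩
    size t + 3 * size t    ≤⟨ m≤m+n _ (3 * size t) ⟩
    size t + 3 * size t + 3 * size t  ≡⟨ arith (size t) ⟩
    7 * size t ∎
    where
    open ≤-Reasoning
    arith : ∀ m → m + 3 * m + 3 * m ≡ 7 * m
    arith = solve-∀
  parts-rules (big □ _ κ _) = coreParts-rules κ
  parts-rules (big c@(node f cs) {u} _ κ _) = begin
    length (clusterCode (opened c) ++ concatMap clusterCode (coreParts κ))
      ≡⟨ length-++ (clusterCode (opened c)) ⟩
    suc (length (concatMap token (clusterWord (opened c)))) + rulesLength (coreParts κ)
      ≡⟨ cong (λ l → suc l + rulesLength (coreParts κ)) (trans (length-tokens (clusterWord (opened c))) (cong (3 *_)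
           (trans (cong length (word-pattern c)) (trans (length-++ (map just (before c)))
           (cong₂ (λ a b → a + suc b) (length-map just (before c)) (length-map just (after c))))))) ⟩
    suc (3 * (suc b + suc a)) + rulesLength (coreParts κ)
      ≤⟨ +-monoʳ-≤ (suc (3 * (suc b + suc a))) (coreParts-rules κ) ⟩
    suc (3 * (suc b + suc a)) + 7 * size u
      ≤⟨ m≤m+n _ (4 * (a + b)) ⟩
    suc (3 * (suc b + suc a)) + 7 * size u + 4 * (a + b)
      ≡⟨ arith a b (size u) ⟩
    7 * (suc b + a + size u)
      ≡⟨ cong (7 *_) (sym (size-plug c u)) ⟩
    7 * size (plug c u) ∎
    where
    open ≤-Reasoning
    b = length (before* cs)
    a = length (after* cs)
    arith : ∀ a b u → suc (3 * (suc b + suc a)) + 7 * u + 4 * (a + b) ≡ 7 * (suc b + a + u)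
    arith = solve-∀
  parts-rules* []                 = z≤n
  parts-rules* (_∷_ {t = t} {ts} q qs) = begin
    rulesLength (parts q ++ parts* qs)
      ≡⟨ trans (cong length (concatMap-++ clusterCode (parts q) (parts* qs))) (length-++ (concatMap clusterCode (parts q))) ⟩
    rulesLength (parts q) + rulesLength (parts* qs)
      ≤⟨ +-mono-≤ (parts-rules q) (parts-rules* qs) ⟩
    7 * size t + 7 * size* ts
      ≡⟨ trans (sym (*-distribˡ-+ 7 (size t) _)) (cong (7 *_) (sym (length-++ (labels t)))) ⟩
    7 * size* (t ∷ ts) ∎
    where open ≤-Reasoning
  coreParts-rules (core f qs _ _) = ≤-trans (parts-rules* qs) (*-monoʳ-≤ 7 (n≤1+n _))

  module _ (key : Cluster → ℕ) where
    open Dictionary key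

    rules-insert : ∀ d x → rulesLength (insert d x) ≤ rulesLength d + length (clusterCode x)
    rules-insert [] x = ≤-reflexive (cong length (++-identityʳ (clusterCode x)))
    rules-insert (y ∷ d) x with key x ≡ᵇ key y
    ... | true  = m≤m+n (rulesLength (y ∷ d)) _
    ... | false = begin
      length (clusterCode y ++ concatMap clusterCode (insert d x))   ≡⟨ length-++ (clusterCode y) ⟩
      length (clusterCode y) + rulesLength (insert d x)              ≤⟨ +-monoʳ-≤ (length (clusterCode y)) (rules-insert d x) ⟩
      length (clusterCode y) + (rulesLength d + length (clusterCode x)) ≡⟨ sym (+-assoc (length (clusterCode y)) _ _) ⟩
      length (clusterCode y) + rulesLength d + length (clusterCode x)
        ≡⟨ cong (_+ length (clusterCode x)) (sym (length-++ (clusterCode y))) ⟩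
      rulesLength (y ∷ d) + length (clusterCode x) ∎
      where open ≤-Reasoning

    rules-collect : ∀ d xs → rulesLength (collect d xs) ≤ rulesLength d + rulesLength xs
    rules-collect d []       = m≤m+n (rulesLength d) _
    rules-collect d (x ∷ xs) = begin
      rulesLength (collect (insert d x) xs)            ≤⟨ rules-collect (insert d x) xs ⟩
      rulesLength (insert d x) + rulesLength xs        ≤⟨ +-monoˡ-≤ _ (rules-insert d x) ⟩
      rulesLength d + length (clusterCode x) + rulesLength xs  ≡⟨ +-assoc (rulesLength d) _ _ ⟩
      rulesLength d + (length (clusterCode x) + rulesLength xs)
        ≡⟨ cong (rulesLength d +_) (sym (length-++ (clusterCode x))) ⟩
      rulesLength d + rulesLength (x ∷ xs) ∎
      where open ≤-Reasoning

    module _ (D : List Cluster) where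
      open Skeleton μ 0<μ key D

      code-length     : ∀ {t} (q : Cut t) → length (code q) ≤ 3 * size t
      code-length*    : ∀ {k} {ts : Vec Term k} (qs : Cut* ts) → length (code* qs) ≤ 3 * size* ts
      coreCode-length : ∀ {u} (κ : Core u) → length (coreCode κ) ≤ 3 * size u
      code-length (small {t} _) = *-monoʳ-≤ 3 (size>0 t)
      code-length (big □ _ κ _) = coreCode-length κ
      code-length (big c@(node f cs) {u} _ κ _) = begin
        3 + length (coreCode κ)  ≤⟨ +-monoʳ-≤ 3 (coreCode-length κ) ⟩
        3 + 3 * size u           ≡⟨ sym (*-suc 3 (size u)) ⟩
        3 * suc (size u)         ≤⟨ *-monoʳ-≤ 3 (+-monoˡ-≤ (size u) (s≤s (z≤n {length (before* cs) + length (after* cs)}))) ⟩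
        3 * (ctxSize c + size u) ≡⟨ cong (3 *_) (sym (size-plug c u)) ⟩
        3 * size (plug c u)      ∎
        where open ≤-Reasoning
      code-length* []                      = z≤n
      code-length* (_∷_ {t = t} {ts} q qs) = begin
        length (code q ++ code* qs)        ≡⟨ length-++ (code q) ⟩
        length (code q) + length (code* qs) ≤⟨ +-mono-≤ (code-length q) (code-length* qs) ⟩
        3 * size t + 3 * size* ts
          ≡⟨ trans (sym (*-distribˡ-+ 3 (size t) _)) (cong (3 *_) (sym (length-++ (labels t)))) ⟩
        3 * size* (t ∷ ts)                 ∎
        where open ≤-Reasoning
      coreCode-length (core f qs _ _) = ≤-trans (+-monoʳ-≤ 3 (code-length* qs)) (≤-reflexive (sym (*-suc 3 _)))

-- Equal keys mean equal patterns.

module Keys (ρ : ℕ → ℕ) (seen : List ℕ) where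
  open Clusters ρ
  open Names

  -- Symbols have the digits 1 to `σ` and the hole has `suc σ`. Zero is left out, so that words of
  -- different lengths get different numbers. This makes the base `σ + 2`.
  σ β hole : ℕ
  σ    = length seen
  hole = suc σ
  β    = suc hole

  symbolDigit : ℕ → ℕ
  symbolDigit = find seen

  open Radix β

  digit : Maybe ℕ → ℕ
  digit = tokenDigit hole symbolDigit

  Seen : Maybe ℕ → Set
  Seen = OfToken (λ f → find seen f ≢ 0)

  symbolDigit-injective : ∀ f g → find seen f ≢ 0 → symbolDigit f ≡ symbolDigit g → f ≡ g
  symbolDigit-injective f g f≢0 e with find seen f in ef
  ... | zero  = ⊥-elim (f≢0 refl)
  ... | suc i with find-lookup seen f i ef | find-lookup seen g i (sym e)
  ...   | j , j≡ , jf | k , k≡ , kg with toℕ-injective (trans j≡ (sym k≡))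
  ...     | refl = trans (sym jf) kg

  digit-injective : ∀ m m′ → Seen m → Seen m′ → digit m ≡ digit m′ → m ≡ m′
  digit-injective nothing  nothing  _ _ e = refl
  digit-injective nothing  (just g) _ _ e = ⊥-elim (1+n≰n (subst (_≤ σ) (sym e) (find-≤ seen g)))
  digit-injective (just f) nothing  _ _ e = ⊥-elim (1+n≰n (subst (_≤ σ) e (find-≤ seen f)))
  digit-injective (just f) (just g) p _ e = cong just (symbolDigit-injective f g p e)

  token-digit : ∀ m → Seen m → Digit (digit m)
  token-digit nothing  _ = s≤s z≤n , ≤-refl
  token-digit (just f) p = ≢0⇒0< p , s≤s (≤-trans (find-≤ seen f) (n≤1+n _))

  word-digits : ∀ {w} → All Seen w → All Digit (map digit w)
  word-digits []              = []
  word-digits {m ∷ w} (p ∷ ps) = token-digit m p ∷ word-digits ps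

  word-tokens-injective : ∀ {w w′} → All Seen w → All Seen w′ → map digit w ≡ map digit w′ → w ≡ w′
  word-tokens-injective []       []       e = refl
  word-tokens-injective {m ∷ w} {m′ ∷ w′} (p ∷ ps) (q ∷ qs) e =
    cong₂ _∷_ (digit-injective m m′ p q (proj₁ (∷-injective e)))
      (word-tokens-injective ps qs (proj₂ (∷-injective e)))

  clusterKey : Cluster → ℕ
  clusterKey x = radix (map digit (clusterWord x))

  clusterKey-injective : ∀ x y → All Seen (clusterWord x) → All Seen (clusterWord y) →
    clusterKey x ≡ clusterKey y → pattern-of x ≡ pattern-of y
  clusterKey-injective x y p q e = clusterWord-injective x y
    (word-tokens-injective p q (radix-injective (word-digits p) (word-digits q) e))

-- Logarithms, and the origin of the constants.

n≤2^⌈log₂n⌉ : ∀ n → n ≤ 2 ^ ⌈log₂ n ⌉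
n≤2^⌈log₂n⌉ = <-rec _ go
  where
  go : ∀ n → (∀ {m} → m < n → m ≤ 2 ^ ⌈log₂ m ⌉) → n ≤ 2 ^ ⌈log₂ n ⌉
  go 0 ih = z≤n
  go 1 ih = m^n>0 2 ⌈log₂ 1 ⌉
  go n@(suc (suc k)) ih = begin
    n                                 ≡⟨ sym (⌊n/2⌋+⌈n/2⌉≡n n) ⟩
    ⌊ n /2⌋ + ⌈ n /2⌉        ≤⟨ +-monoˡ-≤ _ (⌊n/2⌋≤⌈n/2⌉ n) ⟩
    ⌈ n /2⌉ + ⌈ n /2⌉                 ≡⟨ cong (⌈ n /2⌉ +_) (sym (+-identityʳ ⌈ n /2⌉)) ⟩
    2 * ⌈ n /2⌉                       ≤⟨ *-monoʳ-≤ 2 (ih (⌈n/2⌉<n k)) ⟩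
    2 * 2 ^ ⌈log₂ ⌈ n /2⌉ ⌉           ≡⟨ cong (λ x → 2 * 2 ^ x) (⌈log₂⌈n/2⌉⌉≡⌈log₂n⌉∸1 n) ⟩
    2 * 2 ^ (⌈log₂ n ⌉ ∸ 1)           ≡⟨ cong (2 ^_) (m+[n∸m]≡n (⌈log₂⌉-mono-≤ {2} {n} (s≤s (s≤s z≤n)))) ⟩
    2 ^ ⌈log₂ n ⌉                     ∎
    where open ≤-Reasoning

n<2^[1+⌊log₂n⌋] : ∀ n → n < 2 ^ suc ⌊log₂ n ⌋
n<2^[1+⌊log₂n⌋] n = ≰⇒> λ le → 1+n≰n
  (≤-trans (≤-reflexive (sym (⌊log₂[2^n]⌋≡n (suc ⌊log₂ n ⌋)))) (⌊log₂⌋-mono-≤ le))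

⌈log₂⌉-≤ : ∀ {n x} → n ≤ 2 ^ x → ⌈log₂ n ⌉ ≤ x
⌈log₂⌉-≤ {x = x} le = ≤-trans (⌈log₂⌉-mono-≤ le) (≤-reflexive (⌈log₂2^n⌉≡n x))

2^-mono : ∀ {x y} → x ≤ y → 2 ^ x ≤ 2 ^ y
2^-mono = ^-monoʳ-≤ 2

pow-swap : ∀ β m → (β ^ 4) ^ m ≡ β ^ (4 * m)
pow-swap β m = ^-*-assoc β 4 m

-- The factor 12 is the exponent 4 times the 3 in `2 + ℓ ≤ 3 * ℓ`.
log-bound : ∀ {n β ℓ} m → β ≤ 2 ^ (2 + ℓ) → 1 ≤ ℓ → n < (β ^ 4) ^ suc m → ⌈log₂ n ⌉ ≤ 12 * (ℓ * suc m)
log-bound {n} {β} {ℓ} m β≤ 1≤ℓ n< = ≤-trans (⌈log₂⌉-≤ (begin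
  n                                ≤⟨ <⇒≤ n< ⟩
  (β ^ 4) ^ suc m                  ≡⟨ pow-swap β (suc m) ⟩
  β ^ (4 * suc m)                  ≤⟨ ^-monoˡ-≤ (4 * suc m) β≤ ⟩
  (2 ^ (2 + ℓ)) ^ (4 * suc m)      ≡⟨ ^-*-assoc 2 (2 + ℓ) (4 * suc m) ⟩
  2 ^ ((2 + ℓ) * (4 * suc m))      ∎)) (begin
  (2 + ℓ) * (4 * suc m)            ≤⟨ *-monoˡ-≤ (4 * suc m) (+-monoˡ-≤ ℓ (*-monoʳ-≤ 2 1≤ℓ)) ⟩
  (2 * ℓ + ℓ) * (4 * suc m)        ≡⟨ arith ℓ m ⟩
  12 * (ℓ * suc m)                 ∎)
  where
  open ≤-Reasoning
  arith : ∀ ℓ m → (2 * ℓ + ℓ) * (4 * suc m) ≡ 12 * (ℓ * suc m)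
  arith = solve-∀

-- The exponent 4 in (β ^ 4) ^ m ≤ n leaves room for β ^ suc m rules of size m, times
-- a factor suc m for the logarithm of n.
dictionary-bound : ∀ {n β d} m → 2 ≤ β → (β ^ 4) ^ m ≤ n → d ≤ β ^ suc m → d * m * suc m ≤ n
dictionary-bound {d = d} zero 2≤β low d≤ = ≤-trans (≤-reflexive (cong (_* 1) (*-zeroʳ d))) z≤n
dictionary-bound {n} {β} {d} m@(suc k) 2≤β low d≤ = begin
  d * m * suc m                                ≡⟨ *-assoc d m (suc m) ⟩
  d * (m * suc m)                              ≤⟨ *-mono-≤ d≤ (*-mono-≤ (≤-trans (<⇒≤ (m<2^m m)) 2^m≤) (≤-trans (m<2^m m) 2^m≤)) ⟩
  β ^ suc m * (β ^ m * β ^ m)                  ≤⟨ *-monoˡ-≤ _ (^-monoʳ-≤ β {{>-nonZero 0<β}} (+-monoˡ-≤ m {1} {m} (s≤s z≤n))) ⟩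
  β ^ (m + m) * (β ^ m * β ^ m)                ≡⟨ cong (β ^ (m + m) *_) (sym (^-distribˡ-+-* β m m)) ⟩
  β ^ (m + m) * β ^ (m + m)                    ≡⟨ sym (^-distribˡ-+-* β (m + m) (m + m)) ⟩
  β ^ (m + m + (m + m))                        ≡⟨ cong (β ^_) (arith m) ⟩
  β ^ (4 * m)                                  ≡⟨ sym (pow-swap β m) ⟩
  (β ^ 4) ^ m                                  ≤⟨ low ⟩
  n                                            ∎
  where
  open ≤-Reasoning
  0<β = ≤-trans (s≤s z≤n) 2≤β
  2^m≤ : 2 ^ m ≤ β ^ m
  2^m≤ = ^-monoˡ-≤ m 2≤β
  arith : ∀ m → m + m + (m + m) ≡ 4 * m
  arith = solve-∀

-- The threshold `suc m` thus does not exceed `n`, so the whole tree is not small and its cut has a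
-- core.
threshold<n : ∀ {n β} m → 2 ≤ β → (β ^ 4) ^ m ≤ n → m < n
threshold<n {n} {β} m 2≤β low = begin-strict
  m            <⟨ m<2^m m ⟩
  2 ^ m        ≤⟨ ^-monoˡ-≤ m 2≤β ⟩
  β ^ m        ≤⟨ ^-monoˡ-≤ m (≤-trans (≤-reflexive (sym (*-identityʳ β))) (^-monoʳ-≤ β {{>-nonZero (≤-trans (s≤s z≤n) 2≤β)}} (s≤s (z≤n {3})))) ⟩
  (β ^ 4) ^ m  ≤⟨ low ⟩
  n            ∎
  where open ≤-Reasoning

-- The start rule takes `4 * n * r / μ` and the other rules `n / μ`, while the logarithm is at most
-- `12 * ℓ * μ`. This gives 12 times 4 + 1.
total-size : ∀ {n r ℓ L k d} m → k * suc m ≤ 4 * (n * r) → d * suc m ≤ n → 1 ≤ r → L ≤ 12 * (ℓ * suc m) →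
  (k + d) * L ≤ 60 * (n * ℓ * r)
total-size {n} {r} {ℓ} {L} {k} {d} m k≤ d≤ 1≤r L≤ = begin
  (k + d) * L                                ≤⟨ *-monoʳ-≤ (k + d) L≤ ⟩
  (k + d) * (12 * (ℓ * suc m))               ≡⟨ arith₁ k d ℓ (suc m) ⟩
  12 * ℓ * (k * suc m + d * suc m)           ≤⟨ *-monoʳ-≤ (12 * ℓ) (+-mono-≤ k≤ (≤-trans d≤ (m≤m*n n r {{>-nonZero 1≤r}}))) ⟩
  12 * ℓ * (4 * (n * r) + n * r)             ≡⟨ arith₂ ℓ n r ⟩
  60 * (n * ℓ * r)                           ∎
  where
  open ≤-Reasoning
  arith₁ : ∀ k d ℓ m → (k + d) * (12 * (ℓ * m)) ≡ 12 * ℓ * (k * m + d * m)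
  arith₁ = solve-∀
  arith₂ : ∀ ℓ n r → 12 * ℓ * (4 * (n * r) + n * r) ≡ 60 * (n * ℓ * r)
  arith₂ = solve-∀

-- The reserve in `core-bound` pays for the call of the outermost context. The factor 4 comes from
-- `2 * suc r ≤ 4 * r`.
skeleton-size : ∀ {ρ : ℕ → ℕ} m {t : Tree (ℕ-alphabet ρ) 0} (q : Cutting.Cut (suc m) (s≤s z≤n) t) {r} → m < size t → 1 ≤ r →
  All (λ f → ρ f ≤ r) (labels t) → Cutting.skeletonSize (suc m) (s≤s z≤n) q * suc m ≤ 4 * (size t * r)
skeleton-size m {t} (Cutting.small t<) {r} m<n 1≤r narrow = ⊥-elim (<⇒≱ t< m<n)
skeleton-size {ρ} m (Cutting.big c {u} c< κ c≥) {r} m<n 1≤r narrow = begin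
  skeletonSize (big c c< κ c≥) * suc m           ≤⟨ *-monoˡ-≤ (suc m) (closed c c< c≥) ⟩
  suc (coreSize κ) * suc m                       ≤⟨ *-monoˡ-≤ (suc m) (≤-trans (+-monoˡ-≤ (coreSize κ) (s≤s z≤n)) (≤-reflexive (+-comm (suc r) (coreSize κ)))) ⟩
  (coreSize κ + suc r) * suc m                   ≡⟨ arith₁ (coreSize κ) r (suc m) ⟩
  suc m * coreSize κ + suc m * suc r             ≤⟨ core-bound r κ (++⁻ˡ (labels u) (++⁻ʳ (before c) (subst (All (λ f → ρ f ≤ r)) (labels-plug c u) narrow))) ⟩
  2 * suc r * size u                             ≤⟨ *-mono-≤ (*-monoʳ-≤ 2 (+-monoˡ-≤ r 1≤r)) (≤-trans (m≤n+m (size u) (ctxSize c)) (≤-reflexive (sym (size-plug c u)))) ⟩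
  2 * (r + r) * size (plug c u)                  ≡⟨ arith₂ r (size (plug c u)) ⟩
  4 * (size (plug c u) * r)                      ∎
  where
  open Cutting {ℕ-alphabet ρ} (suc m) (s≤s z≤n)
  open ≤-Reasoning
  closed : ∀ c c< c≥ → skeletonSize (big c c< κ c≥) ≤ suc (coreSize κ)
  closed □           _ _ = n≤1+n _
  closed (node f cs) _ _ = ≤-refl
  arith₁ : ∀ k r m → (k + suc r) * m ≡ m * k + m * suc r
  arith₁ = solve-∀
  arith₂ : ∀ r n → 2 * (r + r) * n ≡ 4 * (n * r)
  arith₂ = solve-∀

seen-length : ∀ ls → length (Names.collect [] ls) ≤ length (deduplicate _≟_ ls)
seen-length ls = Names.distinct-length (deduplicate _≟_ ls) (Names.distinct-collect [] ls [])
  (Names.all-collect [] ls [] (All.tabulate (∈-deduplicate⁺ _≟_)))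

-- The last arguments are the rounds per node of the tree. The threshold takes at most `n + 1`
-- rounds, hence 2.
scanCost thresholdCost fillCost emitCost appendCost totalCost : ℕ
scanCost = stageCost scanInit scanBody 1
thresholdCost = stageCost thresholdInit thresholdBody 2
fillCost = stageCost fillInit fillBody 2
emitCost = stageCost emitInit emitBody 5
appendCost = stageCost appendInit appendBody 7
totalCost = scanCost + thresholdCost + fillCost + emitCost + appendCost

stored-all : ∀ {M B} a xs → (∀ i → M i < B) → StoredAt M a xs → All (_< B) xs
stored-all a []       M< _        = []
stored-all {B = B} a (x ∷ xs) M< (e , s) = subst (_< B) e (M< a) ∷ stored-all (suc a) xs M< s

-- 152 is 11 steps for each of at most `13 * n` words copied, together with 6 for the prelude and 3
-- around the copying loop.
total-time : ∀ n k₁ k₂ k₃ k₄ k₅ {T₁ T₂ T₃ T₄ T₅ l} → 1 ≤ n →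
  T₁ ≤ n * k₁ → T₂ ≤ n * k₂ → T₃ ≤ n * k₃ → T₄ ≤ n * k₄ → T₅ ≤ n * k₅ → l ≤ 13 * n →
  6 + (T₁ + (T₂ + (T₃ + (T₄ + (T₅ + (3 + 11 * l)))))) ≤ n * (k₁ + k₂ + k₃ + k₄ + k₅ + 152)
total-time n k₁ k₂ k₃ k₄ k₅ {T₁} {T₂} {T₃} {T₄} {T₅} {l} 1≤n t₁ t₂ t₃ t₄ t₅ l≤ = begin
  6 + (T₁ + (T₂ + (T₃ + (T₄ + (T₅ + (3 + 11 * l))))))
    ≤⟨ +-monoʳ-≤ 6 (+-mono-≤ t₁ (+-mono-≤ t₂ (+-mono-≤ t₃
         (+-mono-≤ t₄ (+-mono-≤ t₅ (+-monoʳ-≤ 3 (*-monoʳ-≤ 11 l≤))))))) ⟩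
  6 + (n * k₁ + (n * k₂ + (n * k₃ + (n * k₄ + (n * k₅ + (3 + 11 * (13 * n)))))))
    ≡⟨ arith₁ n k₁ k₂ k₃ k₄ k₅ ⟩
  9 + (n * (k₁ + k₂ + k₃ + k₄ + k₅) + n * 143)
    ≤⟨ +-monoˡ-≤ _ (m≤n*m 9 n {{>-nonZero 1≤n}}) ⟩
  n * 9 + (n * (k₁ + k₂ + k₃ + k₄ + k₅) + n * 143)
    ≡⟨ arith₂ n (k₁ + k₂ + k₃ + k₄ + k₅) ⟩
  n * (k₁ + k₂ + k₃ + k₄ + k₅ + 152) ∎
  where
  open ≤-Reasoning
  arith₁ : ∀ n a b c d e → 6 + (n * a + (n * b + (n * c + (n * d + (n * e + (3 + 11 * (13 * n))))))) ≡
    9 + (n * (a + b + c + d + e) + n * 143)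
  arith₁ = solve-∀
  arith₂ : ∀ n K → n * 9 + (n * K + n * 143) ≡ n * (K + 152)
  arith₂ = solve-∀

-- The stages run one after the other on a given tree.

module Compression (ρ : ℕ → ℕ) (t : Tree (ℕ-alphabet ρ) 0) (2≤n : 2 ≤ size t) where
  open Clusters ρ

  n D : ℕ
  n = size t
  D = suc (3 * n)

  ls seen : List ℕ
  ls   = labels t
  seen = Names.collect [] ls

  open Keys ρ seen using (σ; β; hole; symbolDigit; clusterKey)

  1≤n : 1 ≤ n
  1≤n = ≤-trans (n≤1+n 1) 2≤n

  length-triples : ∀ xs → length (triples ρ xs) ≡ 3 * length xs
  length-triples []       = refl
  length-triples (x ∷ xs) = trans (cong (3 +_) (length-triples xs)) (sym (*-suc 3 (length xs)))

  words : List ℕ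
  words = encodeInput t

  words≡ : words ≡ n ∷ triples ρ ls
  words≡ = cong (n ∷_) (trans (cong (encodeTree (1 ,_)) (sym (weaken-0 t))) (encodeTree-weaken (1 ,_) {n = 0} t))

  length-words : length words ≡ D
  length-words = trans (cong length words≡) (cong suc (length-triples ls))

  record Prepared (F : FillFrame) : Set where
    open FillFrame F
    field
      total   : v₀ ≡ n
      base    : v₂ ≡ β
      holes   : v₃ ≡ hole
      names   : StoredAt a₀ 0 ls
      arities : StoredAt a₁ 0 (map ρ ls)
      digits  : StoredAt a₂ 0 (map symbolDigit ls)
      jumps0  : ∀ i → a₅ i ≡ 0
      codes0  : ∀ i → a₇ i ≡ 0

  module Run (w V : ℕ) (16≤V : 16 ≤ V) (n<V : n < V) (names<V : All (_< V) ls)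
    (b<V : n * β ^ 4 < V) (fits : D + (16 * (V + n * totalCost) + 16) ≤ 2 ^ w) where

    In : ℕ → ℕ
    In = memoryOf words

    0<V : 0 < V
    0<V = ≤-trans (s≤s z≤n) 16≤V

    In<V : ∀ i → i < D → In i < V
    In<V i _ = memoryOf-< words 0<V (subst (All (_< V)) (sym words≡) (n<V ∷ go names<V (ranks-small t))) i
      where
      go : ∀ {xs} → All (_< V) xs → All (λ f → ρ f < n) xs → All (_< V) (triples ρ xs)
      go []       []       = []
      go (p ∷ ps) (q ∷ qs) = ≤-trans (s≤s (s≤s z≤n)) 16≤V ∷ p ∷ <-trans q n<V ∷ go ps qs

    open Stages n 1≤n w D V totalCost In In<V 16≤V fits
    open Simulation w D V (n * totalCost) In In<V 16≤V fits using (Represents; small<; cell<)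

    s₀ : Store
    s₀ = ⟬ (λ _ → 0) [ 0 ↦ n ] , (λ _ _ → 0) ⟭

    D<2^w : D < 2 ^ w
    D<2^w = ≤-trans (≤-trans (≤-reflexive (+-comm 1 D)) (+-monoʳ-≤ D (≤-trans (s≤s z≤n) (m≤n+m 16 _)))) fits

    3n<2^w : 3 * n < 2 ^ w
    3n<2^w = <-trans ≤-refl D<2^w

    run-prelude : ∃[ S ] (w ⊢ initial words ─[ prelude ]→ S ∥ 6) × Represents (n * 0) S s₀
    run-prelude = _ ,
      seq (set (small< z≤n)) (seq (load (≤-<-trans (m≤n*m n 3) 3n<2^w)) (seq (set (small< (m≤m+n 3 13)))
        (seq (calc 3n<2^w) (seq (set (small< (m≤m+n 1 15))) (calc D<2^w))))) ,
      represents-≤ {t = 0} z≤n (record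
        { vars = λ x → refl ; base = refl
        ; arrs = λ j i _ → memoryOf-beyond words (cell D j i) (≤-trans (≤-reflexive length-words) (m≤m+n D _))
        ; inpt = λ i _ → refl
        ; var< = update-all (_< V + 0) (λ _ → 0) 0 n (λ _ → ≤-trans 0<V (m≤m+n V 0)) (≤-trans n<V (m≤m+n V 0))
        ; arr< = λ j i → ≤-trans 0<V (m≤m+n V 0) })

    open Scanning ρ D V In using (Scan; scan)

    scan-start : wp D V In scanInit (Scan n ls [] ls) s₀
    scan-start = record
      { all-labels = refl ; total = refl ; count = refl ; remaining = refl ; at = 1 ; at≡ = refl
      ; inside = ≤-refl
      ; stored = proj₂ (subst (StoredAt In 0) words≡ (memoryOf-stored words))
      ; names = refl , tt ; arities = refl , tt ; digits = refl , tt
      ; table = λ κ → refl ; jumps0 = λ i → refl ; codes0 = λ i → refl }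

    ran-scan : ∀ {S} → Represents (n * 0) S s₀ → Ran scanStage 0 scanCost S (Scan n ls ls [])
    ran-scan R = run-stage scanInit 7 scanBody 1 {Φ = Scan n ls [] ls} _ _ (≤ᵇ⇒≤ _ _ _) R scan-start
      (λ K → reach-weaken (≤-reflexive (sym (+-identityʳ n))) (scan ls {[]} K))

    open Threshold D V In n β 1≤n (s≤s (s≤s z≤n)) b<V using (b; Growing; grow)

    -- The zeros blank out variables 1 and 4. As variable 4 is the threshold under construction,
    -- this makes `Kept` invariant under the loop by computation.
    Kept : Store → Set
    Kept s = Prepared (fillFrame (var s 0) 0 (var s 2) (var s 3) 0 (arr s 0) (arr s 1) (arr s 2) (arr s 5) (arr s 7))

    Thresholded : Store → Set
    Thresholded s = Kept s × ∃[ m ] var s 4 ≡ suc m × b ^ m ≤ n × n < b ^ suc m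

    threshold-start : ∀ {s} → Scan n ls ls [] s → wp D V In thresholdInit (λ s → Growing 0 s × Kept s) s
    threshold-start {s} K = β²< , b< , record
        { vb = b≡ ; vB = trans b≡ (sym (*-identityʳ b)) ; vμ = refl ; vn = cong suc total
        ; vg = cong₂ _∸_ (cong suc total) (trans b≡ (sym (*-identityʳ b))) ; low = 1≤n } , record
        { total = total ; base = cong (2 +_) count ; holes = cong suc count
        ; names = proj₂ names ; arities = proj₂ arities ; digits = proj₂ digits
        ; jumps0 = jumps0 ; codes0 = codes0 }
      where
      open Scan K
      power : ∀ x → (x * x) * (x * x) ≡ x * (x * (x * (x * 1)))
      power = solve-∀
      square : ∀ x → x * x ≡ x * (x * 1)
      square = solve-∀
      b≡ : let x = suc (suc (var s 1)) in (x * x) * (x * x) ≡ b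
      b≡ = trans (cong (λ c → let x = suc (suc c) in (x * x) * (x * x)) count) (power β)
      b≤ : b < V
      b≤ = ≤-<-trans (m≤n*m b n {{>-nonZero 1≤n}}) b<V
      b< : let x = suc (suc (var s 1)) in (x * x) * (x * x) < V
      b< = subst (_< V) (sym b≡) b≤
      β²< : let x = suc (suc (var s 1)) in x * x < V
      β²< = subst (λ c → suc (suc c) * suc (suc c) < V) (sym count)
        (≤-<-trans (≤-trans (≤-reflexive (square β)) (^-monoʳ-≤ β (m≤m+n 2 2))) b≤)

    ran-threshold : ∀ {S s} → Represents (n * scanCost) S s → Scan n ls ls [] s → Ran thresholdStage scanCost thresholdCost S Thresholded
    ran-threshold {s = s} R K = run-stage thresholdInit 7 thresholdBody 2
      {Φ = λ s → Growing 0 s × Kept s} _ _ (≤ᵇ⇒≤ _ _ _) R (threshold-start K)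
      (λ { (G , P) → reach-weaken suc-n (grow (suc n) ≤-refl G Kept (λ s x y z P → P) P) })
      where
      suc-n : suc n ≤ 2 * n
      suc-n = ≤-trans (+-monoˡ-≤ n 1≤n) (≤-reflexive (cong (n +_) (sym (+-identityʳ n))))

    module Cut-off (m : ℕ) (b^m≤n : b ^ m ≤ n) (n<b^m′ : n < b ^ suc m) where

      μ : ℕ
      μ = suc m

      0<μ : 0 < μ
      0<μ = s≤s z≤n

      open Cutting {ℕ-alphabet ρ} μ 0<μ
      open Parts μ 0<μ
      open Layout ρ μ 0<μ

      q : Cut t
      q = cut t

      Filled-in : FillFrame → Store → Set
      Filled-in F s = fillFrameOf s ≡ F × Filled (arr s 3) (arr s 4) q 0

      ran-fill : ∀ {S s} → Represents (n * (scanCost + thresholdCost)) S s → Kept s → var s 4 ≡ μ →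
        Ran fillStage (scanCost + thresholdCost) fillCost S (Filled-in (fillFrameOf s))
      ran-fill {s = s} R P v₄ = run-stage fillInit 5 fillBody 2 {Φ = Ready (0 + n) (arr s 3) (arr s 4)} _ _ (≤ᵇ⇒≤ _ _ _) R
        (record { frame = refl ; at = Prepared.total P ; ptr = Prepared.total P
                ; kids = cong (λ x → arr s 1 (x ∸ 1)) (Prepared.total P) ; heavy = refl ; ends = refl ; holes = refl })
        (λ K → reach-weaken (≤-trans (≤-reflexive (+-identityʳ (steps t))) (≤-trans (n≤1+n _) (steps-bound t)))
          (reach-trans (fill t 0 (Prepared.arities P) K) (λ X → reached 0 (finished X))))
        where
        open Filling ρ μ 0<μ D V In (fillFrameOf s) v₄
        finished : ∀ {E C s′} → Done q 0 E C s′ → var s′ 5 ≡ 0 × Filled-in (fillFrameOf s) s′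
        finished X = Ready.at X.ready , Ready.frame X.ready ,
          subst₂ (λ E C → Filled E C q 0) (sym (Ready.ends X.ready)) (sym (Ready.holes X.ready)) X.filled
          where module X = Done X

      dictionary : List Cluster
      dictionary = Dictionary.collect clusterKey [] (parts q)

      open Skeleton μ 0<μ clusterKey dictionary using (code)

      rules : List ℕ
      rules = concatMap clusterCode dictionary

      Emitted-all : Store → Set
      Emitted-all s = var s 21 ≡ 0 × var s 14 ≡ length dictionary ×
        Buffer (arr s 8) (var s 13) rules × Buffer (arr s 9) (var s 15) (0 ∷ 0 ∷ 0 ∷ code q)

      b^m*β≤V : β ^ μ ≤ V
      b^m*β≤V = begin
        β * β ^ m    ≤⟨ *-mono-≤ (≤-trans (≤-reflexive (sym (*-identityʳ β))) (^-monoʳ-≤ β (s≤s (z≤n {3})))) (^-monoˡ-≤ m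
                          (≤-trans (≤-reflexive (sym (*-identityʳ β))) (^-monoʳ-≤ β (s≤s (z≤n {3}))))) ⟩
        b * b ^ m    ≤⟨ *-monoʳ-≤ b b^m≤n ⟩
        b * n        ≡⟨ *-comm b n ⟩
        n * b        ≤⟨ <⇒≤ b<V ⟩
        V            ∎
        where open ≤-Reasoning

      module Emit (nm rk dg E C : ℕ → ℕ) where
        open Emission ρ μ 0<μ D V In n β hole symbolDigit
          (λ f → s≤s (≤-trans (Names.find-≤ seen f) (n≤1+n σ))) ≤-refl b^m*β≤V nm rk dg E C public

        place : ∀ o xs → StoredAt nm o xs → StoredAt rk o (map ρ xs) → StoredAt dg o (map symbolDigit xs) → Placed o xs
        place o []       _       _       _       = tt
        place o (x ∷ xs) (a , p) (b , q) (c , r) = (a , b , c) , place (suc o) xs p q r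

      frame-eq : ∀ {v₀ v₂ v₃ v₄ x y z nm rk dg E C v₀′ v₂′ v₃′ v₄′} → v₀ ≡ v₀′ → v₂ ≡ v₂′ → v₃ ≡ v₃′ → v₄ ≡ v₄′ →
        emitFrame v₀ v₂ v₃ v₄ x y z nm rk dg E C ≡ emitFrame v₀′ v₂′ v₃′ v₄′ x y z nm rk dg E C
      frame-eq refl refl refl refl = refl

      ran-emit : ∀ {S s} → Represents (n * (scanCost + thresholdCost + fillCost)) S s → Kept s → var s 4 ≡ μ →
        Filled (arr s 3) (arr s 4) q 0 → Ran emitStage (scanCost + thresholdCost + fillCost) emitCost S Emitted-all
      ran-emit {s = s} R P v₄ filled = run-stage emitInit 16 emitBody 5 {Φ = Main 0 (arr s 5) [] (0 ∷ 0 ∷ 0 ∷ [])}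
        _ _ (≤ᵇ⇒≤ _ _ _) R
        (record { frame = frame-eq (Prepared.total P) (Prepared.base P) (Prepared.holes P) v₄
                ; pos = refl ; idle = refl ; guard = Prepared.total P ; jumps = refl ; count = refl
                ; table = Prepared.codes0 P ; rules = refl , tt ; out = push₃ {arr s 9} {xs = []} refl refl refl (refl , tt) })
        (λ K → reach-weaken (≤-reflexive (+-identityʳ (5 * n))) (reach-trans
          (emit q 0 filled
            (place 0 ls (Prepared.names P) (Prepared.arities P) (Prepared.digits P)) ≤-refl
            (λ x _ _ → Prepared.jumps0 P x) ⊑-refl K)
          (λ X → reached 0 (finished X))))
        where
        open Emit (arr s 0) (arr s 1) (arr s 2) (arr s 3) (arr s 4)
        open Preorder dictionary
        open Dictionary clusterKey using (⊑-refl)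
        finished : ∀ {J s′} → Emitted n J dictionary (0 ∷ 0 ∷ 0 ∷ code q) s′ → var s′ 16 ≡ 0 × Emitted-all s′
        finished X = trans (Main.guard X.main) (n∸n≡0 n) ,
          cong EmitFrame.v₂₁ (Main.frame X.main) , Main.count X.main , Main.rules X.main , Main.out X.main
          where module X = Emitted X

      output : List ℕ
      output = (suc (length dictionary) ∷ 0 ∷ 0 ∷ code q) ++ rules

      open PartFacts ρ μ 0<μ

      rules-length : length rules ≤ 7 * n
      rules-length = ≤-trans (rules-collect clusterKey [] (parts q)) (parts-rules q)

      overwrite : ∀ {M : ℕ → ℕ} {p x y y′ xs i} → i ≡ 0 → y′ ≡ y → Buffer M p (x ∷ xs) → Buffer (M [ i ↦ y′ ]) p (y ∷ xs)
      overwrite {M} {xs = xs} refl refl (len , _ , s) =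
        len , refl , stored-cong 1 xs (λ x 1≤x _ → update-diff M 0 _ x (λ e → <⇒≢ 1≤x (sym e))) s

      ran-append : ∀ {S s} → Represents (n * (scanCost + thresholdCost + fillCost + emitCost)) S s → Emitted-all s →
        Ran appendStage (scanCost + thresholdCost + fillCost + emitCost) appendCost S (λ s → Buffer (arr s 9) (var s 15) output)
      ran-append {s = s} R (v₂₁ , v₁₄ , (v₁₃ , stored) , out) = run-stage appendInit 5 appendBody 7
        {Φ = Append (suc (length dictionary) ∷ 0 ∷ 0 ∷ code q) rules} _ _ (≤ᵇ⇒≤ _ _ _) R
        (record { remaining = v₁₃ ; source = stored ; target = overwrite v₂₁ (cong suc v₁₄) out })
        (λ K → reach-weaken rules-length (append rules K))
        where open Appending D V In

      -- The head takes 3 words, the start rule 3 per node of the tree and the rules of the clusters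
      -- 7.
      output-length : length output ≤ 13 * n
      output-length = begin
        length output                          ≡⟨ length-++ (suc (length dictionary) ∷ 0 ∷ 0 ∷ code q) ⟩
        3 + length (code q) + length rules     ≤⟨ +-mono-≤ (+-mono-≤ (*-monoʳ-≤ 3 1≤n) (code-length clusterKey dictionary q)) rules-length ⟩
        3 * n + 3 * n + 7 * n                  ≡⟨ arith n ⟩
        13 * n                                 ∎
        where
        open ≤-Reasoning
        arith : ∀ n → 3 * n + 3 * n + 7 * n ≡ 13 * n
        arith = solve-∀

      run-copy : ∀ {S s} → Represents (n * totalCost) S s → Buffer (arr s 9) (var s 15) output →
        ∃[ S′ ] (w ⊢ S ─[ copyOut ]→ S′ ∥ (3 + 11 * length output)) × Outputs S′ output
      run-copy {S} {s} R (len , stored) = copyOut-run output R.base (trans (R.vars 15) len)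
        (stored-cong 0 output (λ x _ _ → R.arrs 9 x (m≤m+n 9 6)) stored)
        (stored-all 0 output (λ i → word-fits {n * totalCost} ≤-refl (R.arr< 9 i)) stored) output-length
        where
        module R = Represents R
        open Simulation w D V (n * totalCost) In In<V 16≤V fits using (word-fits)
        -- The room reserved for running time also covers the cells of the output, since `totalCost`
        -- is at least 13.
        13n≤ : ∀ i → i ≤ 13 * n → i < V + n * totalCost
        13n≤ i i≤ = +-mono-<-≤ 0<V (≤-trans i≤ (≤-trans (≤-reflexive (*-comm 13 n)) (*-monoʳ-≤ n (≤ᵇ⇒≤ 13 totalCost _))))
        open Copying w D (13 * n) (s≤s z≤n) (small< ≤-refl)
          (λ i i≤ → cell< {n * totalCost} {9} {i} ≤-refl (m≤m+n 9 6) (13n≤ i i≤))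

      seen-all : All (λ f → Names.find seen f ≢ 0) ls
      seen-all = Names.find-collect [] ls

      parts-seen : All (λ x → All (Keys.Seen ρ seen) (clusterWord x)) (parts q)
      parts-seen = parts-all q seen-all

      open Dictionary clusterKey using (find-collect; find-lookup; all-collect; distinct-collect; distinct-length)

      dictionary-seen : All (λ x → All (Keys.Seen ρ seen) (clusterWord x)) dictionary
      dictionary-seen = all-collect [] (parts q) [] parts-seen

      dictionary-short : All Short dictionary
      dictionary-short = all-collect [] (parts q) [] (parts-short q)

      open Skeleton μ 0<μ clusterKey dictionary using (Listed; module Grammar)

      listed : All Listed (parts q)
      listed = All.zipWith (λ { {x} (p , f≢0) → list x p f≢0 }) (parts-seen , find-collect [] (parts q))
        where
        list : ∀ x → All (Keys.Seen ρ seen) (clusterWord x) → Dictionary.find clusterKey dictionary (clusterKey x) ≢ 0 → Listed x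
        list x p f≢0 with Dictionary.find clusterKey dictionary (clusterKey x) in eq
        ... | zero  = ⊥-elim (f≢0 refl)
        ... | suc i = let j , j≡ , key≡ = find-lookup dictionary (clusterKey x) i eq in
          j , Keys.clusterKey-injective ρ seen _ x (All.lookup dictionary-seen (∈-lookup j)) p key≡ , cong suc j≡

      open Grammar q listed public using (grammar; grammar-value; grammar-size; grammar-code; grammar-rank)

      -- The keys are distinct, and they are numbers of at most `μ` digits.
      dictionary-length : length dictionary ≤ β ^ μ
      dictionary-length = ≤-trans
        (distinct-length (upTo (β ^ μ)) (distinct-collect [] (parts q) [])
          (All.zipWith (λ { {x} (p , _ , l) → ∈-upTo⁺ (bound {x} p l) }) (dictionary-seen , dictionary-short)))
        (≤-reflexive (length-upTo (β ^ μ)))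
        where
        bound : ∀ {x} → All (Keys.Seen ρ seen) (clusterWord x) → length (clusterWord x) ≤ μ → clusterKey x < β ^ μ
        bound {x} p l = <-≤-trans
          (Radix.radix-bound β (All.map proj₂ (Keys.word-digits ρ seen p)))
          (^-monoʳ-≤ β (≤-trans (≤-reflexive (length-map (Keys.digit ρ seen) (clusterWord x))) l))

      dictionary-size : sum (map clusterSize dictionary) ≤ length dictionary * m
      dictionary-size = go dictionary-short
        where
        go : ∀ {xs} → All Short xs → sum (map clusterSize xs) ≤ length xs * m
        go []                = z≤n
        go ((s≤s l , _) ∷ ps) = +-mono-≤ l (go ps)

    record Compressed : Set where
      field
        {m}     : ℕ
        low     : b ^ m ≤ n
        high    : n < b ^ suc m
        {S}     : State
        {took}  : ℕ
        run     : w ⊢ initial words ─[ compressor ]→ S ∥ took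
        time    : took ≤ n * (totalCost + 152)
        outputs : Outputs S (Cut-off.output m low high)

    -- The later stages are parametrised by `m`, which is known only from the result of the
    -- threshold stage. The postcondition `_≡ s₂` ties that stage to the store about which `m` is
    -- known.
    compress-from : ∀ {S₀ s₂} m (low : b ^ m ≤ n) (high : n < b ^ suc m) → w ⊢ initial words ─[ prelude ]→ S₀ ∥ 6 →
      (X₁ : Ran scanStage 0 scanCost S₀ (Scan n ls ls [])) (X₂ : Ran thresholdStage scanCost thresholdCost (Ran.S′ X₁) (_≡ s₂)) →
      Kept s₂ → var s₂ 4 ≡ suc m → Compressed
    compress-from {s₂ = s₂} m low high r₀ X₁ X₂ P₂ v₄ = record
      { low = low ; high = high
      ; run = seq r₀ (seq (Ran.run X₁) (seq (Ran.run X₂) (seq (Ran.run X₃) (seq (Ran.run X₄) (seq (Ran.run X₅) (proj₁ (proj₂ X₆)))))))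
      ; time = time₆
      ; outputs = proj₂ (proj₂ X₆) }
      where
      open Cut-off m low high
      R₂ : Represents (n * (scanCost + thresholdCost)) (Ran.S′ X₂) s₂
      R₂ = subst (Represents (n * (scanCost + thresholdCost)) (Ran.S′ X₂)) (Ran.holds X₂) (Ran.repr X₂)
      X₃ : Ran fillStage (scanCost + thresholdCost) fillCost (Ran.S′ X₂) (Filled-in (fillFrameOf s₂))
      X₃ = ran-fill R₂ P₂ v₄
      same : fillFrameOf (Ran.s′ X₃) ≡ fillFrameOf s₂
      same = proj₁ (Ran.holds X₃)
      kept : Kept (Ran.s′ X₃)
      kept = record
        { total = trans (cong FillFrame.v₀ same) (Prepared.total P₂)
        ; base = trans (cong FillFrame.v₂ same) (Prepared.base P₂)
        ; holes = trans (cong FillFrame.v₃ same) (Prepared.holes P₂)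
        ; names = subst (λ a → StoredAt a 0 ls) (sym (cong FillFrame.a₀ same)) (Prepared.names P₂)
        ; arities = subst (λ a → StoredAt a 0 (map ρ ls)) (sym (cong FillFrame.a₁ same)) (Prepared.arities P₂)
        ; digits = subst (λ a → StoredAt a 0 (map symbolDigit ls)) (sym (cong FillFrame.a₂ same)) (Prepared.digits P₂)
        ; jumps0 = λ i → trans (cong (λ F → FillFrame.a₅ F i) same) (Prepared.jumps0 P₂ i)
        ; codes0 = λ i → trans (cong (λ F → FillFrame.a₇ F i) same) (Prepared.codes0 P₂ i) }
      X₄ : Ran emitStage (scanCost + thresholdCost + fillCost) emitCost (Ran.S′ X₃) Emitted-all
      X₄ = ran-emit (Ran.repr X₃) kept (trans (cong FillFrame.v₄ same) v₄) (proj₂ (Ran.holds X₃))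
      X₅ : Ran appendStage (scanCost + thresholdCost + fillCost + emitCost) appendCost (Ran.S′ X₄) (λ s → Buffer (arr s 9) (var s 15) output)
      X₅ = ran-append (Ran.repr X₄) (Ran.holds X₄)
      X₆ : ∃[ S′ ] (w ⊢ Ran.S′ X₅ ─[ copyOut ]→ S′ ∥ (3 + 11 * length output)) × Outputs S′ output
      X₆ = run-copy (Ran.repr X₅) (Ran.holds X₅)
      time₆ : 6 + (Ran.took X₁ + (Ran.took X₂ + (Ran.took X₃ + (Ran.took X₄ + (Ran.took X₅ + (3 + 11 * length output)))))) ≤ n * (totalCost + 152)
      time₆ = total-time n scanCost thresholdCost fillCost emitCost appendCost {Ran.took X₁} {Ran.took X₂} {Ran.took X₃} {Ran.took X₄} {Ran.took X₅} {length output} 1≤n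
        (Ran.time X₁) (Ran.time X₂) (Ran.time X₃) (Ran.time X₄) (Ran.time X₅) output-length

    compress-after : ∀ {S₀} → w ⊢ initial words ─[ prelude ]→ S₀ ∥ 6 → (X₁ : Ran scanStage 0 scanCost S₀ (Scan n ls ls [])) →
      Ran thresholdStage scanCost thresholdCost (Ran.S′ X₁) Thresholded → Compressed
    compress-after r₀ X₁ record { S′ = S′ ; took = took ; s′ = s′ ; run = run ; time = time ; repr = repr ; holds = P₂ , m , v₄ , low , high } =
      compress-from m low high r₀ X₁
        (record { S′ = S′ ; took = took ; s′ = s′ ; run = run ; time = time ; repr = repr ; holds = refl }) P₂ v₄

    compress-prelude : ∀ {S₀} → (w ⊢ initial words ─[ prelude ]→ S₀ ∥ 6) × Represents (n * 0) S₀ s₀ → Compressed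
    compress-prelude (r₀ , R₀) = compress-after r₀ X₁ (ran-threshold (Ran.repr X₁) (Ran.holds X₁))
      where
      X₁ : Ran scanStage 0 scanCost _ (Scan n ls ls [])
      X₁ = ran-scan R₀

    abstract
      compressed : Compressed
      compressed = compress-prelude (proj₂ run-prelude)

    compressed-size : ∀ {r ℓ} (C : Compressed) → All (λ f → ρ f ≤ r) ls → 1 ≤ r → 1 ≤ ℓ → β ≤ 2 ^ (2 + ℓ) →
      ∃[ G ] ∃[ s ] ∃[ T ]
      (w ⊢ initial words ─[ compressor ]→ s ∥ T)
      × T ≤ n * (totalCost + 152)
      × Outputs s (encodeTSLP G)
      × val G ≡ t
      × TSLP-size G * ⌈log₂ n ⌉ ≤ 60 * (n * ℓ * r)
      × (∀ A → ntRank G A ≤ r)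
    compressed-size {r} {ℓ} C narrow 1≤r 1≤ℓ β≤ =
      grammar , C.S , C.took , C.run , C.time , subst (Outputs C.S) (sym grammar-code) C.outputs , grammar-value ,
      subst (λ z → z * ⌈log₂ n ⌉ ≤ 60 * (n * ℓ * r)) (sym grammar-size)
        (total-size {k = skeletonSize q} {d = sum (map clusterSize dictionary)} C.m (skeleton-size C.m q (threshold<n C.m 2≤β C.low) 1≤r narrow)
          (≤-trans (*-monoˡ-≤ (suc C.m) dictionary-size) (dictionary-bound C.m 2≤β C.low dictionary-length))
          1≤r (log-bound C.m β≤ 1≤ℓ C.high)) ,
      (λ A → ≤-trans (grammar-rank A) 1≤r)
      where
      module C = Compressed C
      open Cut-off C.m C.low C.high
      open Cutting {ℕ-alphabet ρ} μ 0<μ using (skeletonSize)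
      2≤β : 2 ≤ β
      2≤β = s≤s (s≤s z≤n)

-- The word length, as a multiple of the logarithm of `n`.

timeBits : ℕ
-- Any exponent with `totalCost ≤ 2 ^ timeBits` would do. The inequality is checked by evaluation in
-- `totalCost-small`.
timeBits = 20

abstract
  timeFactor : ℕ
  timeFactor = totalCost + 152

  timeFactor-bounds : totalCost + 152 ≤ timeFactor
  timeFactor-bounds = ≤-refl

  totalCost-small : totalCost ≤ 2 ^ timeBits
  totalCost-small = ≤ᵇ⇒≤ totalCost (2 ^ timeBits) _

module Words (k L n β D : ℕ) (1≤L : 1 ≤ L) (n≤ : n ≤ 2 ^ L) (β≤ : β ≤ n + 2) (2≤n : 2 ≤ n) (D≡ : D ≡ suc (3 * n)) where

  -- `β ≤ 2 * n ≤ 2 ^ (2 * L)` gives `n * β ^ 4 ≤ 2 ^ (9 * L)`, strictly below `V`, and `k` makes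
  -- room for the names of the symbols. `M` bounds the length of the input, `V` and the charge for
  -- time. The addresses are sums of 34 such terms at most, whence 64 and the 6 more multiples of
  -- `L` in `fits`.
  V M : ℕ
  V = 2 ^ ((k + 10) * L)
  M = 2 ^ ((k + timeBits + 10) * L)

  ^L : ∀ x y → x ≤ y → 2 ^ (x * L) ≤ 2 ^ (y * L)
  ^L x y le = 2^-mono (*-monoˡ-≤ L le)

  lit≤ : ∀ x → 2 ^ x ≤ 2 ^ (x * L)
  lit≤ x = 2^-mono (≤-trans (≤-reflexive (sym (*-identityʳ x))) (*-monoʳ-≤ x 1≤L))

  n≤₁ : n ≤ 2 ^ (1 * L)
  n≤₁ = ≤-trans n≤ (≤-reflexive (cong (2 ^_) (sym (*-identityˡ L))))

  +L : ∀ x y → 2 ^ (x * L) * 2 ^ (y * L) ≡ 2 ^ ((x + y) * L)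
  +L x y = trans (sym (^-distribˡ-+-* 2 (x * L) (y * L))) (cong (2 ^_) (sym (*-distribʳ-+ L x y)))

  9L<V : 2 ^ (9 * L) < V
  9L<V = <-≤-trans (^-monoʳ-< 2 ≤-refl (*-monoˡ-< L {{>-nonZero 1≤L}} (≤-refl {10}))) (^L 10 (k + 10) (m≤n+m 10 k))

  16≤V : 16 ≤ V
  16≤V = ≤-trans (lit≤ 4) (^L 4 (k + 10) (≤-trans (m≤m+n 4 6) (m≤n+m 10 k)))

  n<V : n < V
  n<V = ≤-<-trans (≤-trans n≤₁ (^L 1 9 (m≤m+n 1 8))) 9L<V

  names≤V : 2 ^ (k * L) ≤ V
  names≤V = ^L k (k + 10) (m≤m+n k 10)

  β≤₂ : β ≤ 2 ^ (2 * L)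
  β≤₂ = begin
    β                            ≤⟨ β≤ ⟩
    n + 2                        ≤⟨ +-monoʳ-≤ n 2≤n ⟩
    n + n                        ≡⟨ cong (n +_) (sym (+-identityʳ n)) ⟩
    2 * n                        ≤⟨ *-mono-≤ (lit≤ 1) n≤₁ ⟩
    2 ^ (1 * L) * 2 ^ (1 * L)    ≡⟨ +L 1 1 ⟩
    2 ^ (2 * L)                  ∎
    where open ≤-Reasoning

  b<V : n * β ^ 4 < V
  b<V = begin-strict
    n * β ^ 4                          ≤⟨ *-mono-≤ n≤₁ (^-monoˡ-≤ 4 β≤₂) ⟩
    2 ^ (1 * L) * (2 ^ (2 * L)) ^ 4    ≡⟨ cong (2 ^ (1 * L) *_) (trans (^-*-assoc 2 (2 * L) 4) (cong (2 ^_) (arith L))) ⟩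
    2 ^ (1 * L) * 2 ^ (8 * L)          ≡⟨ +L 1 8 ⟩
    2 ^ (9 * L)                        <⟨ 9L<V ⟩
    V                                  ∎
    where
    open ≤-Reasoning
    arith : ∀ L → 2 * L * 4 ≡ 8 * L
    arith = solve-∀

  fits : ∀ {A} → A ≤ 2 ^ timeBits → D + (16 * (V + n * A) + 16) ≤ 2 ^ ((k + timeBits + 16) * L)
  fits {A} A≤ = begin
    D + (16 * (V + n * A) + 16)        ≤⟨ +-mono-≤ D≤ (+-mono-≤ (*-monoʳ-≤ 16 (+-mono-≤ V≤ nA≤)) 16≤) ⟩
    M + (16 * (M + M) + M)             ≤⟨ m≤m+n _ (30 * M) ⟩
    M + (16 * (M + M) + M) + 30 * M    ≡⟨ arith₁ M ⟩
    M * 64                             ≤⟨ *-monoʳ-≤ M (lit≤ 6) ⟩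
    M * 2 ^ (6 * L)                    ≡⟨ +L (k + timeBits + 10) 6 ⟩
    2 ^ ((k + timeBits + 10 + 6) * L)         ≡⟨ cong (λ x → 2 ^ (x * L)) (+-assoc (k + timeBits) 10 6) ⟩
    2 ^ ((k + timeBits + 16) * L)             ∎
    where
    open ≤-Reasoning
    arith₁ : ∀ M → M + (16 * (M + M) + M) + 30 * M ≡ M * 64
    arith₁ = solve-∀
    arith₂ : ∀ n → suc (3 * n) + n ≡ suc (4 * n)
    arith₂ = solve-∀
    D≤ : D ≤ M
    D≤ = begin
      D                                ≡⟨ D≡ ⟩
      suc (3 * n)                      ≤⟨ +-monoˡ-≤ (3 * n) (≤-trans (n≤1+n 1) 2≤n) ⟩
      4 * n                            ≤⟨ *-mono-≤ (lit≤ 2) n≤₁ ⟩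
      2 ^ (2 * L) * 2 ^ (1 * L)        ≡⟨ +L 2 1 ⟩
      2 ^ (3 * L)                      ≤⟨ ^L 3 (k + timeBits + 10) (≤-trans (m≤m+n 3 7) (m≤n+m 10 (k + timeBits))) ⟩
      M                                ∎
    V≤ : V ≤ M
    V≤ = ^L (k + 10) (k + timeBits + 10) (+-monoˡ-≤ 10 (m≤m+n k timeBits))
    nA≤ : n * A ≤ M
    nA≤ = begin
      n * A                            ≤⟨ *-mono-≤ n≤₁ (≤-trans A≤ (lit≤ timeBits)) ⟩
      2 ^ (1 * L) * 2 ^ (timeBits * L)        ≡⟨ +L 1 timeBits ⟩
      2 ^ ((1 + timeBits) * L)                ≤⟨ ^L (1 + timeBits) (k + timeBits + 10) (≤-trans (≤-reflexive (+-comm 1 timeBits)) (+-mono-≤ (m≤n+m timeBits k) (m≤m+n 1 9))) ⟩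
      M                                ∎
    16≤ : 16 ≤ M
    16≤ = ≤-trans 16≤V V≤


compression : ∀ k (ρ : ℕ → ℕ) (t : Tree (ℕ-alphabet ρ) 0) r → 2 ≤ size t →
  All (λ f → ρ f ≤ r) (labels t) → 1 ≤ r → 2 ≤ numLabels t + r →
  All (λ f → f < 2 ^ (k * ⌈log₂ size t ⌉)) (labels t) →
  ∃[ G ] ∃[ s ] ∃[ T ]
  (((k + timeBits + 16) * ⌈log₂ size t ⌉) ⊢ initial (encodeInput t) ─[ compressor ]→ s ∥ T)
  × T ≤ timeFactor * size t
  × Outputs s (encodeTSLP G)
  × val G ≡ t
  × TSLP-size G * ⌈log₂ size t ⌉ ≤ 60 * (size t * ⌊log₂ (numLabels t + r) ⌋ * r)
  × (∀ A → ntRank G A ≤ r)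
compression k ρ t r 2≤n narrow 1≤r 2≤σ+r names< = rescale
  (Compression.Run.compressed-size ρ t 2≤n w W.V W.16≤V W.n<V names<V W.b<V fits
    (Compression.Run.compressed ρ t 2≤n w W.V W.16≤V W.n<V names<V W.b<V fits) narrow 1≤r 1≤ℓ β≤)
  where
  seen = Names.collect [] (labels t)
  L = ⌈log₂ size t ⌉
  ℓ = ⌊log₂ (numLabels t + r) ⌋
  1≤ℓ : 1 ≤ ℓ
  1≤ℓ = ⌊log₂⌋-mono-≤ 2≤σ+r
  seen≤n : length seen ≤ size t
  seen≤n = Names.collect-length [] (labels t)
  module W = Words k L (size t) (Keys.β ρ seen) (suc (3 * size t)) (⌈log₂⌉-mono-≤ 2≤n) (n≤2^⌈log₂n⌉ (size t))
    (≤-trans (s≤s (s≤s seen≤n)) (≤-reflexive (+-comm 2 (size t)))) 2≤n refl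
  β≤ : Keys.β ρ seen ≤ 2 ^ (2 + ℓ)
  β≤ = begin
    2 + length seen                        ≤⟨ +-monoʳ-≤ 2 (seen-length (labels t)) ⟩
    2 + numLabels t                        ≤⟨ m≤m+n _ (numLabels t) ⟩
    2 + numLabels t + numLabels t          ≤⟨ ≤-reflexive (arith (numLabels t)) ⟩
    2 * (numLabels t + 1)                  ≤⟨ *-monoʳ-≤ 2 (+-monoʳ-≤ (numLabels t) 1≤r) ⟩
    2 * (numLabels t + r)                  ≤⟨ *-monoʳ-≤ 2 (<⇒≤ (n<2^[1+⌊log₂n⌋] (numLabels t + r))) ⟩
    2 ^ (2 + ℓ)                            ∎
    where
    open ≤-Reasoning
    arith : ∀ s → 2 + s + s ≡ 2 * (s + 1)
    arith = solve-∀
  w = (k + timeBits + 16) * L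
  names<V : All (_< W.V) (labels t)
  names<V = All.map (λ f< → <-≤-trans f< W.names≤V) names<
  fits : suc (3 * size t) + (16 * (W.V + size t * totalCost) + 16) ≤ 2 ^ w
  fits = W.fits totalCost-small
  -- General in `P` and `Q`, so that only the time bound is touched.
  rescale : {G : Set} {S : Set} {P Q : G → S → ℕ → Set} →
    ∃[ G ] ∃[ s ] ∃[ T ] P G s T × T ≤ size t * (totalCost + 152) × Q G s T →
    ∃[ G ] ∃[ s ] ∃[ T ] P G s T × T ≤ timeFactor * size t × Q G s T
  rescale (G , s , T , run , time , rest) = G , s , T , run ,
    ≤-trans time (≤-trans (*-monoʳ-≤ (size t) timeFactor-bounds) (≤-reflexive (*-comm (size t) timeFactor))) , rest

mainTheorem11 : ∃[ P ] ∃[ cT ] ∃[ cS ] ∀ (k : ℕ) → ∃[ c ]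
    ∀ (ρ : ℕ → ℕ) (t : Tree (ℕ-alphabet ρ) 0) (n σ r : ℕ) →
    size t ≡ n → 2 ≤ n →
    numLabels t ≡ σ →
    All (λ f → ρ f ≤ r) (labels t) → 1 ≤ r → 2 ≤ σ + r →
    All (λ f → f < 2 ^ (k * ⌈log₂ n ⌉)) (labels t) →
    ∃[ G ] ∃[ s ] ∃[ T ]
    ((c * ⌈log₂ n ⌉) ⊢ initial (encodeInput t) ─[ P ]→ s ∥ T)
    × T ≤ cT * n
    × Outputs s (encodeTSLP G)
    × val G ≡ t
    × TSLP-size G * ⌈log₂ n ⌉ ≤ cS * (n * ⌊log₂ (σ + r) ⌋ * r)
    × (∀ A → ntRank G A ≤ r)
mainTheorem11 = compressor , timeFactor , 60 , λ k → k + timeBits + 16 ,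
  λ { ρ t n σ r refl 2≤n refl narrow 1≤r 2≤σ+r names< → compression k ρ t r 2≤n narrow 1≤r 2≤σ+r names< }
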